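{- Let $(X,\mathbf R)$ be a symmetric association scheme with $D\ge3$ classes which is metric with respect to $A_0,\dots,A_D$ and cometric with respect to $E_0,\dots,E_D$, and which is not an ordinary cycle. Let $Y\subseteq X$ with $1<|Y|<|X|$ and set $\delta=\delta(Y)$. Let $0\le t\le D$ and suppose that $E_k^*(x)\chi_Y$ is a relative $t$-design with respect to $x$ for every $0\le k\le D$ and every $x\in Y$. Suppose further that for every $x\in Y$, each irreducible $T(x)$-module $W\subseteq V$ with $1\le r(W)\le\delta$ satisfies $r^*(W)\le r(W)$. Then one of the following holds: (i) $(X,R_1)$ is bipartite and $Y$ is one of its two bipartite halves (colour classes); (ii) $(X,\mathbf R)$ is an antipodal double cover and $Y=\{x,y\}$ is an antipodal pair, i.e. $(x,y)\in R_D$; (iii) $\delta\ge t+1$.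
   Context: $(X,\mathbf R)$ is a symmetric association scheme with associate matrices $A_0=I,\dots,A_D$, Bose–Mesner algebra $M$, primitive idempotents $E_0=|X|^{ -1}J,\dots,E_D$. Metric: $(X,R_1)$ is distance-regular with $R_i$ its distance-$i$ relation. Cometric: each $E_j$ is a polynomial of degree exactly $j$ in $E_1$ under entrywise multiplication. Antipodal double cover: the relation "$y=z$ or $(y,z)\in R_D$" is an equivalence relation on $X$ whose classes all have size $2$. $V=\mathbb C^X$ with standard basis $\{\hat y\}$ and standard Hermitian inner product; $\chi_Y=\sum_{y\in Y}\hat y$. $\delta(Y)=\min\{i\ne0:\langle\chi_Y,A_i\chi_Y\rangle\ne0\}$ (minimum distance). $E_i^*(x)$ diagonal with $(E_i^*(x))_{yy}=(A_i)_{xy}$; $A_i^*(x)$ diagonal with $(A_i^*(x))_{yy}=|X|(E_i)_{xy}$; $T(x)$ generated by $M$ and the $A_i^*(x)$. For an irreducible $T(x)$-module $W$: $r(W)=\min\{i:E_i^*(x)W\ne0\}$, $r^*(W)=\min\{j:E_jW\ne0\}$. $\psi$ is a relative $t$-design with respect to $x$ if $E_j\psi$ and $E_j\hat x$ are linearly dependent for all $1\le j\le t$. -}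

module Defs where

open import Algebra.Bundles using (CommutativeRing; AbelianGroup)
import Algebra.Construct.DirectProduct as DirectProduct
import Algebra.Definitions.RawMonoid as RawMonoidDefs
import Algebra.Properties.Ring as RingProperties
import Algebra.Properties.Semiring.Exp as Exp
import Algebra.Properties.Semiring.Sum as Sum
import Algebra.Solver.Ring.NaturalCoefficients.Default as NatSolver
open import Data.Bool.Base using (if_then_else_)
open import Data.Fin.Base as Fin using (Fin; zero; suc; toℕ; fromℕ)
open import Data.Fin.Permutation using (Permutation′; _⟨$⟩ʳ_)
open import Data.Fin.Properties using (_≟_; any?; all?)
open import Data.Fin.Subset using (Subset; _∈_; _∉_; ∁; ⁅_⁆; _∪_)
open import Data.Fin.Subset.Properties using (_∈?_)
open import Data.Nat as ℕ using (ℕ; zero; suc)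
open import Data.Product.Base using (∃; ∃₂; _×_; _,_)
open import Data.Sum.Base using (_⊎_)
open import Data.Vec.Base as Vec using ()
open import Function.Bundles using (_⇔_)
open import Level using (0ℓ)
open import Relation.Binary.Core using (Rel)
open import Relation.Binary.Definitions using () renaming (Decidable to Decidable₂)
open import Relation.Binary.PropositionalEquality.Core using (_≡_; _≢_)
open import Relation.Binary.Structures using (IsEquivalence; IsStrictTotalOrder)
open import Relation.Nullary using (¬_; Dec; does)
open import Relation.Nullary.Decidable using (_×-dec_; _⊎-dec_; ¬?)
open import Relation.Unary using (Decidable)

-- The real numbers, axiomatised as a complete ordered field; classically
-- these axioms determine ℝ up to unique isomorphism.
record RealNumbers : Set₁ where
  field
    commutativeRing : CommutativeRing 0ℓ 0ℓ
  open CommutativeRing commutativeRing public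
  infix 4 _<_ _≤_
  field
    _<_                : Rel Carrier 0ℓ
    isStrictTotalOrder : IsStrictTotalOrder _≈_ _<_
    +-monoˡ-<          : ∀ {x y} z → x < y → x + z < y + z
    *-pos              : ∀ {x y} → 0# < x → 0# < y → 0# < x * y
    0<1                : 0# < 1#
    inverse            : ∀ x → ¬ (x ≈ 0#) → ∃ λ y → x * y ≈ 1#

  _≤_ : Rel Carrier 0ℓ
  x ≤ y = ¬ (y < x)

  IsUpperBound : (Carrier → Set) → Carrier → Set
  IsUpperBound S b = ∀ x → S x → x ≤ b

  field
    complete : (S : Carrier → Set) → ∃ S → ∃ (IsUpperBound S) →
               ∃ λ s → IsUpperBound S s × (∀ b → IsUpperBound S b → s ≤ b)

-- ℂ = ℝ[i], the pair (a , b) standing for a + bi.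
module ComplexNumbers (ℝ : RealNumbers) where

  private
    module ℝ = RealNumbers ℝ
    open NatSolver ℝ.commutativeSemiring using (solve; _:+_; _:*_; _:=_; con)
    module ⊕ = AbelianGroup
      (DirectProduct.abelianGroup ℝ.+-abelianGroup ℝ.+-abelianGroup)

  ℂ : Set
  ℂ = ℝ.Carrier × ℝ.Carrier

  mul : ℂ → ℂ → ℂ
  mul (a , b) (c , d) = a ℝ.* c ℝ.+ ℝ.- (b ℝ.* d) , a ℝ.* d ℝ.+ b ℝ.* c

  one : ℂ
  one = ℝ.1# , ℝ.0#

  conj : ℂ → ℂ
  conj (a , b) = a , ℝ.- b

  private
    mul-cong : ∀ {x x′ y y′} → x ⊕.≈ x′ → y ⊕.≈ y′ → mul x y ⊕.≈ mul x′ y′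
    mul-cong (p , q) (r , s) =
      ℝ.+-cong (ℝ.*-cong p r) (ℝ.-‿cong (ℝ.*-cong q s)) ,
      ℝ.+-cong (ℝ.*-cong p s) (ℝ.*-cong q r)

    -- Writing -(b d) as m (b d) with m = -1 turns the ring laws of ℂ into
    -- semiring identities in an indeterminate m, which the solver proves.
    mul′ : ℝ.Carrier → ℂ → ℂ → ℂ
    mul′ m (a , b) (c , d) = a ℝ.* c ℝ.+ m ℝ.* (b ℝ.* d) , a ℝ.* d ℝ.+ b ℝ.* c

    -1′ : ℝ.Carrier
    -1′ = ℝ.- ℝ.1#

    mul≈mul′ : ∀ x y → mul x y ⊕.≈ mul′ -1′ x y
    mul≈mul′ (a , b) (c , d) =
      ℝ.+-congˡ (ℝ.sym (RingProperties.-1*x≈-x ℝ.ring (b ℝ.* d))) , ℝ.refl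

    mul-assoc : ∀ x y z → mul (mul x y) z ⊕.≈ mul x (mul y z)
    mul-assoc x@(a , b) y@(c , d) z@(e , f) =
      ⊕.trans (mul-cong (mul≈mul′ x y) ⊕.refl)
        (⊕.trans (mul≈mul′ (mul′ -1′ x y) z)
          (⊕.trans (re -1′ a b c d e f , im -1′ a b c d e f)
            (⊕.sym (⊕.trans (mul-cong {x} ⊕.refl (mul≈mul′ y z))
              (mul≈mul′ x (mul′ -1′ y z))))))
      where
      re = solve 7 (λ m a b c d e f →
        (a :* c :+ m :* (b :* d)) :* e :+ m :* ((a :* d :+ b :* c) :* f)
        := a :* (c :* e :+ m :* (d :* f)) :+ m :* (b :* (c :* f :+ d :* e))) ℝ.refl
      im = solve 7 (λ m a b c d e f →
        (a :* c :+ m :* (b :* d)) :* f :+ (a :* d :+ b :* c) :* e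
        := a :* (c :* f :+ d :* e) :+ b :* (c :* e :+ m :* (d :* f))) ℝ.refl

    mul-comm : ∀ x y → mul x y ⊕.≈ mul y x
    mul-comm (a , b) (c , d) =
      ℝ.+-cong (ℝ.*-comm a c) (ℝ.-‿cong (ℝ.*-comm b d)) ,
      solve 4 (λ a b c d → a :* d :+ b :* c := c :* b :+ d :* a) ℝ.refl a b c d

    one-identityˡ : ∀ x → mul one x ⊕.≈ x
    one-identityˡ x@(a , b) = ⊕.trans (mul≈mul′ one x)
      ( solve 3 (λ m a b → con 1 :* a :+ m :* (con 0 :* b) := a) ℝ.refl -1′ a b
      , solve 2 (λ a b → con 1 :* b :+ con 0 :* a := b) ℝ.refl a b )

    mul-distribˡ : ∀ x y z → mul x (y ⊕.∙ z) ⊕.≈ (mul x y ⊕.∙ mul x z)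
    mul-distribˡ x@(a , b) y@(c , d) z@(e , f) =
      ⊕.trans (mul≈mul′ x (y ⊕.∙ z))
        (⊕.trans (re -1′ a b c d e f , im a b c d e f)
          (⊕.sym (⊕.∙-cong (mul≈mul′ x y) (mul≈mul′ x z))))
      where
      re = solve 7 (λ m a b c d e f →
        a :* (c :+ e) :+ m :* (b :* (d :+ f))
        := (a :* c :+ m :* (b :* d)) :+ (a :* e :+ m :* (b :* f))) ℝ.refl
      im = solve 6 (λ a b c d e f →
        a :* (d :+ f) :+ b :* (c :+ e)
        := (a :* d :+ b :* c) :+ (a :* f :+ b :* e)) ℝ.refl

  ℂ-commutativeRing : CommutativeRing 0ℓ 0ℓ
  ℂ-commutativeRing = record
    { Carrier = ℂ
    ; _≈_     = ⊕._≈_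
    ; _+_     = ⊕._∙_
    ; _*_     = mul
    ; -_      = ⊕._⁻¹
    ; 0#      = ⊕.ε
    ; 1#      = one
    ; isCommutativeRing = record
      { isRing = record
        { +-isAbelianGroup = ⊕.isAbelianGroup
        ; *-cong     = mul-cong
        ; *-assoc    = mul-assoc
        ; *-identity = one-identityˡ , λ x → ⊕.trans (mul-comm x one) (one-identityˡ x)
        ; distrib    = mul-distribˡ , λ x y z →
            ⊕.trans (mul-comm (y ⊕.∙ z) x)
              (⊕.trans (mul-distribˡ x y z)
                (⊕.∙-cong (mul-comm x y) (mul-comm x z)))
        }
      ; *-comm = mul-comm
      }
    }

count : ∀ {n} {P : Fin n → Set} → Decidable P → ℕ
count {n} P? = Vec.count P? (Vec.allFin n)

IsLeast : ∀ {m} → (Fin m → Set) → Fin m → Set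
IsLeast P i = P i × (∀ j → P j → i Fin.≤ j)

-- A simple graph on Fin n is given by its (irreflexive, symmetric) adjacency
-- relation; the definitions below do not mention those two properties because
-- they hold automatically for the graph (X , R₁).
module Graph {n : ℕ} (Adj : Rel (Fin n) 0ℓ) (adj? : Decidable₂ Adj) where

  Walk : ℕ → Rel (Fin n) 0ℓ
  Walk zero    x y = x ≡ y
  Walk (suc k) x y = ∃ λ z → Adj x z × Walk k z y

  Distance : Fin n → Fin n → ℕ → Set
  Distance x y k = Walk k x y × (∀ (l : Fin k) → ¬ Walk (toℕ l) x y)

  walk? : ∀ k → Decidable₂ (Walk k)
  walk? zero    x y = x ≟ y
  walk? (suc k) x y = any? λ z → adj? x z ×-dec walk? k z y

  distance? : ∀ x y k → Dec (Distance x y k)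
  distance? x y k = walk? k x y ×-dec all? λ l → ¬? (walk? (toℕ l) x y)

  Connected : Set
  Connected = ∀ x y → ∃ λ k → Walk k x y

  sphereIntersection : ℕ → ℕ → Fin n → Fin n → ℕ
  sphereIntersection i j x y = count λ z → distance? x z i ×-dec distance? z y j

  DistanceRegular : Set
  DistanceRegular = Connected ×
    (∀ i j k x y x′ y′ → Distance x y k → Distance x′ y′ k →
       sphereIntersection i j x y ≡ sphereIntersection i j x′ y′)

  CyclicallyNext : Rel (Fin n) 0ℓ
  CyclicallyNext i j = toℕ j ≡ suc (toℕ i) ⊎ (suc (toℕ i) ≡ n × toℕ j ≡ 0)

  OrdinaryCycle : Set
  OrdinaryCycle = 3 ℕ.≤ n × ∃ λ (σ : Permutation′ n) → ∀ i j →
    Adj (σ ⟨$⟩ʳ i) (σ ⟨$⟩ʳ j) ⇔ (CyclicallyNext i j ⊎ CyclicallyNext j i)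

  IsBipartition : Subset n → Set
  IsBipartition C = ∀ x y → Adj x y → (x ∈ C × y ∉ C) ⊎ (x ∉ C × y ∈ C)

  Bipartite : Set
  Bipartite = ∃ IsBipartition

  -- When the graph is connected, C and ∁ C are the same for every bipartition
  -- up to swapping.
  IsBipartiteHalf : Subset n → Set
  IsBipartiteHalf Y = ∃ λ C → IsBipartition C × (Y ≡ C ⊎ Y ≡ ∁ C)

-- X = Fin n, and rel x y = i means (x , y) ∈ R_i.
record SymmetricAssociationScheme (n D : ℕ) : Set where
  field
    rel            : Fin n → Fin n → Fin (suc D)
    rel-diagonal   : ∀ x y → rel x y ≡ zero ⇔ x ≡ y
    rel-symmetric  : ∀ x y → rel x y ≡ rel y x
    rel-nonempty   : ∀ i → ∃₂ λ x y → rel x y ≡ i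
    p              : Fin (suc D) → Fin (suc D) → Fin (suc D) → ℕ
    p-intersection : ∀ i j x y →
      count (λ z → (rel x z ≟ i) ×-dec (rel z y ≟ j)) ≡ p i j (rel x y)

module Scheme {n D : ℕ} (𝔛 : SymmetricAssociationScheme n D) where
  open SymmetricAssociationScheme 𝔛

  -- Adjacency in (X , R₁), stated through toℕ so that it also makes sense for D = 0.
  Adj : Rel (Fin n) 0ℓ
  Adj x y = toℕ (rel x y) ≡ 1

  open Graph Adj (λ x y → toℕ (rel x y) ℕ.≟ 1) public

  Metric : Set
  Metric = DistanceRegular ×
    (∀ (i : Fin (suc D)) x y → rel x y ≡ i ⇔ Distance x y (toℕ i))

  AntipodalRel : Rel (Fin n) 0ℓ
  AntipodalRel y z = y ≡ z ⊎ rel y z ≡ fromℕ D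

  AntipodalDoubleCover : Set
  AntipodalDoubleCover = IsEquivalence AntipodalRel ×
    (∀ y → count (λ z → (y ≟ z) ⊎-dec (rel y z ≟ fromℕ D)) ≡ 2)

  IsAntipodalPair : Subset n → Set
  IsAntipodalPair Y = ∃₂ λ x y → rel x y ≡ fromℕ D × Y ≡ ⁅ x ⁆ ∪ ⁅ y ⁆

module Terwilliger (ℝ : RealNumbers) {n D : ℕ}
                   (𝔛 : SymmetricAssociationScheme n D) where
  open SymmetricAssociationScheme 𝔛
  open ComplexNumbers ℝ public
  open CommutativeRing ℂ-commutativeRing public
    using (_≈_; _+_; _*_; 0#; 1#; semiring; +-rawMonoid)
  open Sum semiring public using (sum)
  open Exp semiring public using (_^_)
  open RawMonoidDefs +-rawMonoid using () renaming (_×_ to _·ℕ_) public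

  V : Set
  V = Fin n → ℂ

  Matrix : Set
  Matrix = Fin n → Fin n → ℂ

  infix 4 _≈ᵛ_ _≈ᵐ_
  infixl 6 _+ᵛ_ _+ᵐ_
  infixl 7 _*ᵐ_
  infixr 7 _∙ᵛ_ _∙ᵐ_ _$ᵛ_

  _≈ᵛ_ : Rel V 0ℓ
  u ≈ᵛ v = ∀ y → u y ≈ v y

  0ᵛ : V
  0ᵛ _ = 0#

  _+ᵛ_ : V → V → V
  (u +ᵛ v) y = u y + v y

  _∙ᵛ_ : ℂ → V → V
  (c ∙ᵛ v) y = c * v y

  _≈ᵐ_ : Rel Matrix 0ℓ
  B ≈ᵐ C = ∀ y z → B y z ≈ C y z

  0ᵐ : Matrix
  0ᵐ _ _ = 0#

  _+ᵐ_ : Matrix → Matrix → Matrix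
  (B +ᵐ C) y z = B y z + C y z

  _∙ᵐ_ : ℂ → Matrix → Matrix
  (c ∙ᵐ B) y z = c * B y z

  _*ᵐ_ : Matrix → Matrix → Matrix
  (B *ᵐ C) y z = sum λ w → B y w * C w z

  _$ᵛ_ : Matrix → V → V
  (B $ᵛ v) y = sum λ z → B y z * v z

  diag : V → Matrix
  diag v y z = if does (y ≟ z) then v y else 0#

  ⟨_,_⟩ : V → V → ℂ
  ⟨ u , v ⟩ = sum λ y → u y * conj (v y)

  e : Fin n → V
  e y z = if does (y ≟ z) then 1# else 0#

  χ : Subset n → V
  χ Y y = if does (y ∈? Y) then 1# else 0#

  LinearlyDependent : V → V → Set
  LinearlyDependent u v =
    ∃₂ λ a b → ¬ (a ≈ 0# × b ≈ 0#) × ((a ∙ᵛ u) +ᵛ (b ∙ᵛ v) ≈ᵛ 0ᵛ)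

  A : Fin (suc D) → Matrix
  A i x y = if does (rel x y ≟ i) then 1# else 0#

  InBoseMesner : Matrix → Set
  InBoseMesner B = ∃ λ (c : Fin (suc D) → ℂ) → ∀ y z → B y z ≈ sum λ i → c i * A i y z

  IsMinDistance : Subset n → Fin (suc D) → Set
  IsMinDistance Y = IsLeast λ i → i ≢ zero × ¬ (⟨ χ Y , A i $ᵛ χ Y ⟩ ≈ 0#)

  IsIdempotent : Matrix → Set
  IsIdempotent F = InBoseMesner F × (F *ᵐ F ≈ᵐ F)

  -- Orthogonality F G = 0 is one-sided because the Bose–Mesner algebra is commutative.
  IsPrimitiveIdempotent : Matrix → Set
  IsPrimitiveIdempotent E = IsIdempotent E × ¬ (E ≈ᵐ 0ᵐ) ×
    (∀ F G → IsIdempotent F → IsIdempotent G → F *ᵐ G ≈ᵐ 0ᵐ → E ≈ᵐ F +ᵐ G →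
       F ≈ᵐ 0ᵐ ⊎ G ≈ᵐ 0ᵐ)

  -- An ordering E₀ = |X|⁻¹ J , E₁ , … , E_D of all the primitive idempotents.
  record PrimitiveIdempotents : Set where
    field
      E           : Fin (suc D) → Matrix
      E-primitive : ∀ j → IsPrimitiveIdempotent (E j)
      E-distinct  : ∀ i j → E i ≈ᵐ E j → i ≡ j
      E-all       : ∀ F → IsPrimitiveIdempotent F → ∃ λ j → F ≈ᵐ E j
      E-zero      : ∀ x y → n ·ℕ E zero x y ≈ 1#

  E* : Fin (suc D) → Fin n → Matrix
  E* i x = diag (A i x)

  module _ (ℰ : PrimitiveIdempotents) where
    open PrimitiveIdempotents ℰ

    -- E₁ enters as the hypothesis toℕ i ≡ 1, so that D = 0 need not be excluded.
    Cometric : Set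
    Cometric = ∀ (i : Fin (suc D)) → toℕ i ≡ 1 → ∀ (j : Fin (suc D)) →
      ∃ λ (c : Fin (suc (toℕ j)) → ℂ) → ¬ (c (fromℕ (toℕ j)) ≈ 0#) ×
        (∀ x y → E j x y ≈ sum λ l → c l * (E i x y ^ toℕ l))

    A* : Fin (suc D) → Fin n → Matrix
    A* i x = diag λ y → n ·ℕ E i x y

    data T (x : Fin n) : Matrix → Set where
      bose-mesner : ∀ {B} → InBoseMesner B → T x B
      dual        : ∀ i → T x (A* i x)
      resp        : ∀ {B C} → B ≈ᵐ C → T x B → T x C
      add         : ∀ {B C} → T x B → T x C → T x (B +ᵐ C)
      scale       : ∀ c {B} → T x B → T x (c ∙ᵐ B)
      mult        : ∀ {B C} → T x B → T x C → T x (B *ᵐ C)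

    IsRelativeDesign : ℕ → Fin n → V → Set
    IsRelativeDesign t x ψ = ∀ (j : Fin (suc D)) → 1 ℕ.≤ toℕ j → toℕ j ℕ.≤ t →
      LinearlyDependent (E j $ᵛ ψ) (E j $ᵛ e x)

    record TModule (x : Fin n) : Set₁ where
      field
        Mem       : V → Set
        resp-≈    : ∀ {u v} → u ≈ᵛ v → Mem u → Mem v
        0-closed  : Mem 0ᵛ
        +-closed  : ∀ {u v} → Mem u → Mem v → Mem (u +ᵛ v)
        ∙-closed  : ∀ c {v} → Mem v → Mem (c ∙ᵛ v)
        T-closed  : ∀ {B v} → T x B → Mem v → Mem (B $ᵛ v)

    open TModule

    Irreducible : ∀ {x} → TModule x → Set₁
    Irreducible {x} W = (∃ λ w → Mem W w × ¬ (w ≈ᵛ 0ᵛ)) ×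
      ((U : TModule x) → (∀ {v} → Mem U v → Mem W v) →
         (∀ {v} → Mem U v → v ≈ᵛ 0ᵛ) ⊎ (∀ {v} → Mem W v → Mem U v))

    NonzeroOn : ∀ {x} → Matrix → TModule x → Set
    NonzeroOn B W = ∃ λ w → Mem W w × ¬ (B $ᵛ w ≈ᵛ 0ᵛ)

    IsEndpoint : ∀ {x} → TModule x → Fin (suc D) → Set
    IsEndpoint {x} W = IsLeast λ i → NonzeroOn (E* i x) W

    IsDualEndpoint : ∀ {x} → TModule x → Fin (suc D) → Set
    IsDualEndpoint W = IsLeast λ j → NonzeroOn (E j) W

{-# OPTIONS --safe #-}

-- Let x be a codeword and ψ the component of E*_δ(x) χ_Y orthogonal to the primary
-- T(x)-module M x̂. If δ ≤ t, the design hypothesis gives E_j ψ = 0 for all j ≤ δ. In an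
-- irreducible module W with r*(W) ≤ r(W) the vectors w which, for every i, split within W as
-- w = a + b with E*_k a = 0 for k ≤ i and E_l b = 0 for l > i form a submodule: A and A*
-- are tridiagonal with respect to the two filtrations, as for the split decomposition of a
-- tridiagonal pair. It contains E_{r*} W, hence is all of W, and i = δ shows ψ ⟂ W. So T ψ
-- contains no irreducible module, ψ = 0, and every sphere of radius δ around a codeword
-- meets Y in nothing or is contained in Y. For δ = 1 this forces Y = X, for 2 = δ < D
-- the graph is bipartite with half Y, and for 3 ≤ δ < D it has valency two, so is a cycle.
-- For δ = D the scheme is antipodal with class Y, and expressing E₂ as a quadratic polynomial
-- in E₁ shows that antipodal classes have size two.
module Submission where

open import Defs
open import Algebra.Bundles using (CommutativeRing; Semigroup)
import Algebra.Properties.Ring as RingProperties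
import Algebra.Properties.Semiring.Exp as Exp
import Algebra.Properties.Semiring.Mult as Mult
import Algebra.Properties.Semiring.Sum as Sum
import Algebra.Solver.Ring.NaturalCoefficients.Default as NatSolver
open import Axiom.ExcludedMiddle using (ExcludedMiddle)
open import Data.Bool.Base using (true; false; if_then_else_)
open import Data.Empty using (⊥)
open import Data.Fin.Base as Fin using (Fin; zero; suc; toℕ; fromℕ; fromℕ<; punchIn)
open import Data.Fin.Permutation using (permutation)
open import Data.Fin.Properties as Finₚ using (_≟_)
open import Data.Fin.Subset using (Subset; _∈_; ∣_∣; ⊤; ⁅_⁆; _∪_)
open import Data.Fin.Subset.Properties as Subsetₚ using (_∈?_)
open import Data.Nat.Base as ℕ using (ℕ; zero; suc)
import Data.Nat.Properties as ℕₚ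
open import Data.Product.Base using (_×_; _,_; ∃; ∃₂; proj₁; proj₂)
open import Data.Sum.Base using (_⊎_; inj₁; inj₂)
open import Data.Vec.Base as Vec using ()
open import Data.Vec.Functional using (insertAt; removeAt; _∷_)
open import Data.Vec.Functional.Properties using (insertAt-lookup; insertAt-punchIn)
open import Function.Base using (_∘_; id)
open import Function.Bundles using (Equivalence; mk⇔)
open import Level using (0ℓ)
open import Relation.Binary.Core using (Rel)
open import Relation.Binary.Definitions using (tri<; tri≈; tri>) renaming (Decidable to Decidable₂)
open import Relation.Binary.PropositionalEquality as ≡ using (_≡_; _≢_)
import Relation.Binary.Reasoning.Setoid as SetoidReasoning
open import Relation.Binary.Structures using (IsStrictTotalOrder)
open import Relation.Nullary using (¬_; Dec; yes; no; does; contradiction)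
open import Relation.Nullary.Decidable using (_×-dec_; _⊎-dec_; decidable-stable)
open import Relation.Unary using (Decidable)

-- V is never decomposed into irreducible modules. If ψ were nonzero, T ψ would contain an
-- irreducible W. Each w in W equals B ψ with B in T, and T is closed under adjoints because its
-- generators are self-adjoint; so ⟨w , w⟩ is the product of ψ with the adjoint of B applied to w,
-- which again lies in W and is orthogonal to ψ. No eigenvalue is constructed either: D + 1
-- orthogonal nonzero idempotents in an algebra of dimension D + 1 form a basis, and the
-- coefficients of a matrix in that basis are its eigenvalues. Two facts about the E_j have to be
-- derived first: they are real, hence self-adjoint, and E_j A*_1 E_k = 0 for j > k + 1. The second
-- is the vanishing of a Krein parameter, turned into a matrix identity by a sum of squares. Both
-- rest on definiteness of the inner product. Invariance of a subspace has to be checked for A_1 and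
-- A*_1 only, since the metric and cometric properties generate the other A_i and A*_i from these.

IsLeast-exists : (∀ {ℓ} → ExcludedMiddle ℓ) → ∀ {m} (P : Fin m → Set) → ∃ P → ∃ (IsLeast P)
IsLeast-exists em {suc m} P (i , Pi) with em {P = P zero}
... | yes P0 = zero , P0 , λ _ _ → ℕ.z≤n
... | no ¬P0 with i
...   | zero  = contradiction Pi ¬P0
...   | suc i with j , Pj , least ← IsLeast-exists em (P ∘ suc) (i , Pi) =
  suc j , Pj , λ { zero P0 → contradiction P0 ¬P0 ; (suc k) Pk → ℕ.s≤s (least k Pk) }

-- Only as much order as is needed to make sums of squared norms anisotropic.
record ConjugationField : Set₁ where
  field
    commutativeRing : CommutativeRing 0ℓ 0ℓ
  open CommutativeRing commutativeRing public hiding (zero)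
  open Sum semiring public using (sum)
  field
    1≉0             : ¬ (1# ≈ 0#)
    inverse         : ∀ x → ¬ (x ≈ 0#) → ∃ λ y → x * y ≈ 1#
    conj            : Carrier → Carrier
    conj-cong       : ∀ {x y} → x ≈ y → conj x ≈ conj y
    conj-+          : ∀ x y → conj (x + y) ≈ conj x + conj y
    conj-*          : ∀ x y → conj (x * y) ≈ conj x * conj y
    conj-involutive : ∀ x → conj (conj x) ≈ x
    NonNegative     : Carrier → Set
    nonNegative-≈   : ∀ {x y} → x ≈ y → NonNegative x → NonNegative y
    nonNegative-0   : NonNegative 0#
    nonNegative-+   : ∀ {x y} → NonNegative x → NonNegative y → NonNegative (x + y)
    nonNegative-sq  : ∀ x → NonNegative (x * conj x)
    summand-zero    : ∀ {x y} → NonNegative x → NonNegative y → x + y ≈ 0# → x ≈ 0#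
    square-zero     : ∀ {x} → x * conj x ≈ 0# → x ≈ 0#

-- Linear algebra over a field with a definite conjugation.

module FieldTheory (em : ∀ {ℓ} → ExcludedMiddle ℓ) (K : ConjugationField) where

  open ConjugationField K public
  open RingProperties ring public
    using (+-cancelˡ; +-cancelʳ; -‿distribˡ-*; -‿distribʳ-*; -0#≈0#; -‿involutive; +-inverseʳ-unique)
  open Sum semiring public
    using (sum-cong-≋; sum-remove; ∑-distrib-+; ∑-comm; *-distribˡ-sum; *-distribʳ-sum;
           sum-replicate; sum-replicate-zero)
  open Exp semiring public using (_^_)
  open Mult semiring public using () renaming (_×_ to _·ℕ_)
  open NatSolver commutativeSemiring public using (solve; _:+_; _:*_; _:=_; con)
  open SetoidReasoning setoid public

  ⟦_⟧ : ∀ {P : Set} → Dec P → Carrier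
  ⟦ d ⟧ = if does d then 1# else 0#

  ⟦⟧-yes : ∀ {P : Set} (d : Dec P) → P → ⟦ d ⟧ ≈ 1#
  ⟦⟧-yes (yes _) _ = refl
  ⟦⟧-yes (no ¬p) p = contradiction p ¬p

  ⟦⟧-no : ∀ {P : Set} (d : Dec P) → ¬ P → ⟦ d ⟧ ≈ 0#
  ⟦⟧-no (yes p) ¬p = contradiction p ¬p
  ⟦⟧-no (no _)  _  = refl

  ⟦⟧-cong : ∀ {P Q : Set} (d : Dec P) (d′ : Dec Q) → (P → Q) → (Q → P) → ⟦ d ⟧ ≈ ⟦ d′ ⟧
  ⟦⟧-cong (yes p) d′ f g = sym (⟦⟧-yes d′ (f p))
  ⟦⟧-cong (no ¬p) d′ f g = sym (⟦⟧-no d′ (¬p ∘ g))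

  *-cancelˡ-nonzero : ∀ {a x y} → ¬ (a ≈ 0#) → a * x ≈ a * y → x ≈ y
  *-cancelˡ-nonzero {a} {x} {y} a≉0 ax≈ay with b , ab≈1 ← inverse a a≉0 = begin
    x           ≈⟨ lemma x ⟩
    b * (a * x) ≈⟨ *-congˡ ax≈ay ⟩
    b * (a * y) ≈⟨ lemma y ⟨
    y           ∎
    where
    lemma : ∀ z → z ≈ b * (a * z)
    lemma z = begin
      z           ≈⟨ *-identityˡ z ⟨
      1# * z      ≈⟨ *-congʳ ab≈1 ⟨
      a * b * z   ≈⟨ solve 3 (λ a b z → a :* b :* z := b :* (a :* z)) refl a b z ⟩
      b * (a * z) ∎

  zero-product : ∀ {a x} → ¬ (a ≈ 0#) → a * x ≈ 0# → x ≈ 0#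
  zero-product {a} a≉0 ax≈0 = *-cancelˡ-nonzero a≉0 (trans ax≈0 (sym (zeroʳ a)))

  conj-0 : conj 0# ≈ 0#
  conj-0 = +-cancelˡ (conj 0#) _ _
    (trans (sym (conj-+ 0# 0#)) (trans (conj-cong (+-identityˡ 0#)) (sym (+-identityʳ _))))

  conj-1 : conj 1# ≈ 1#
  conj-1 = begin
    conj 1#                  ≈⟨ *-identityʳ _ ⟨
    conj 1# * 1#             ≈⟨ *-congˡ (conj-involutive 1#) ⟨
    conj 1# * conj (conj 1#) ≈⟨ conj-* 1# (conj 1#) ⟨
    conj (1# * conj 1#)      ≈⟨ conj-cong (*-identityˡ _) ⟩
    conj (conj 1#)           ≈⟨ conj-involutive 1# ⟩
    1#                       ∎

  conj-⟦⟧ : ∀ {P : Set} (d : Dec P) → conj ⟦ d ⟧ ≈ ⟦ d ⟧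
  conj-⟦⟧ (yes _) = conj-1
  conj-⟦⟧ (no _)  = conj-0

  -- The length of a sum cannot be inferred from the sum itself, hence is explicit.
  module SumOver (m : ℕ) where

    cong : {f g : Fin m → Carrier} → (∀ i → f i ≈ g i) → sum f ≈ sum g
    cong = sum-cong-≋

    vanishing : {f : Fin m → Carrier} → (∀ i → f i ≈ 0#) → sum f ≈ 0#
    vanishing f≈0 = trans (cong f≈0) (sum-replicate-zero m)

    single : {f : Fin m → Carrier} → ∀ k → (∀ i → i ≢ k → f i ≈ 0#) → sum f ≈ f k
    single = go m
      where
      go : ∀ m {f : Fin m → Carrier} k → (∀ i → i ≢ k → f i ≈ 0#) → sum f ≈ f k
      go (suc m) {f} k f≈0 = begin
        sum f                      ≈⟨ sum-remove {i = k} f ⟩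
        f k + sum (removeAt f k)
          ≈⟨ +-congˡ (trans (sum-cong-≋ {m} λ i → f≈0 _ (Finₚ.punchInᵢ≢i k i)) (sum-replicate-zero m)) ⟩
        f k + 0#                   ≈⟨ +-identityʳ _ ⟩
        f k                        ∎

    pullˡ : ∀ c {f : Fin m → Carrier} → sum (λ i → c * f i) ≈ c * sum f
    pullˡ c {f} = sym (*-distribˡ-sum c f)

    pullʳ : ∀ c {f : Fin m → Carrier} → sum (λ i → f i * c) ≈ sum f * c
    pullʳ c {f} = sym (*-distribʳ-sum c f)

    split : {f g : Fin m → Carrier} → sum (λ i → f i + g i) ≈ sum f + sum g
    split {f} {g} = ∑-distrib-+ f g

    swap : ∀ {k} {f : Fin m → Fin k → Carrier} →
           sum (λ i → sum (λ j → f i j)) ≈ sum (λ j → sum (λ i → f i j))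
    swap {k} {f} = ∑-comm {m} {k} f

    conj-sum : (f : Fin m → Carrier) → conj (sum f) ≈ sum (λ i → conj (f i))
    conj-sum = go m
      where
      go : ∀ m (f : Fin m → Carrier) → conj (sum f) ≈ sum (λ i → conj (f i))
      go zero    f = conj-0
      go (suc m) f = trans (conj-+ _ _) (+-congˡ (go m (f ∘ suc)))

  sum-nonNegative : ∀ {m} {f : Fin m → Carrier} → (∀ i → NonNegative (f i)) → NonNegative (sum f)
  sum-nonNegative {zero}  f≥0 = nonNegative-0
  sum-nonNegative {suc m} f≥0 = nonNegative-+ (f≥0 zero) (sum-nonNegative (f≥0 ∘ suc))

  summands-zero : ∀ {m} {f : Fin m → Carrier} → (∀ i → NonNegative (f i)) →
                  sum f ≈ 0# → ∀ i → f i ≈ 0#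
  summands-zero {suc m} f≥0 f≈0 zero    = summand-zero (f≥0 zero) (sum-nonNegative (f≥0 ∘ suc)) f≈0
  summands-zero {suc m} f≥0 f≈0 (suc i) = summands-zero (f≥0 ∘ suc)
    (summand-zero (sum-nonNegative (f≥0 ∘ suc)) (f≥0 zero) (trans (+-comm _ _) f≈0)) i

  anisotropic : ∀ {m} (f : Fin m → Carrier) →
                sum (λ i → f i * conj (f i)) ≈ 0# → ∀ i → f i ≈ 0#
  anisotropic f f≈0 i = square-zero (summands-zero (λ i → nonNegative-sq (f i)) f≈0 i)

  -- Characteristic zero comes from definiteness: `m ·ℕ 1#` is the squared norm of the all-ones
  -- vector of length `m`.
  ·1-cancel : ∀ m → m ·ℕ 1# ≈ 0# → m ≡ 0
  ·1-cancel zero    _  = ≡.refl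
  ·1-cancel (suc m) eq = contradiction
    (anisotropic {suc m} (λ _ → 1#)
      (trans (SumOver.cong (suc m) λ _ → trans (*-identityˡ _) conj-1)
        (trans (sum-replicate (suc m)) eq)) zero)
    1≉0

  sum-⟦⟧ : ∀ {m} {P : Fin m → Set} (P? : Decidable P) →
           sum (λ z → ⟦ P? z ⟧) ≈ count P? ·ℕ 1#
  sum-⟦⟧ {m} P? = go m (λ i → i)
    where
    -- `count` runs over `allFin`, a `tabulate`; the induction needs an arbitrary reindexing `g`.
    go : ∀ k (g : Fin k → Fin m) → sum (λ z → ⟦ P? (g z) ⟧) ≈ Vec.count P? (Vec.tabulate g) ·ℕ 1#
    go zero    g = refl
    go (suc k) g with does (P? (g zero))
    ... | true  = +-congˡ (go k (g ∘ suc))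
    ... | false = trans (+-identityˡ _) (go k (g ∘ suc))

  sum-⟦⟧-* : ∀ {m} {P Q : Fin m → Set} (P? : Decidable P) (Q? : Decidable Q) →
             sum (λ z → ⟦ P? z ⟧ * ⟦ Q? z ⟧) ≈ count (λ z → P? z ×-dec Q? z) ·ℕ 1#
  sum-⟦⟧-* {m} P? Q? = trans (SumOver.cong m λ z → product (P? z) (Q? z)) (sum-⟦⟧ λ z → P? z ×-dec Q? z)
    where
    product : ∀ {P Q : Set} (d : Dec P) (d′ : Dec Q) → ⟦ d ⟧ * ⟦ d′ ⟧ ≈ ⟦ d ×-dec d′ ⟧
    product (yes _) d′ = *-identityˡ _
    product (no _)  d′ = zeroˡ _

  ·ℕ-scalar : ∀ m x → m ·ℕ x ≈ (m ·ℕ 1#) * x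
  ·ℕ-scalar zero    x = sym (zeroˡ x)
  ·ℕ-scalar (suc m) x = trans (+-cong (sym (*-identityˡ x)) (·ℕ-scalar m x)) (sym (distribʳ x 1# (m ·ℕ 1#)))

  conj-·ℕ : ∀ m {x} → conj x ≈ x → conj (m ·ℕ x) ≈ m ·ℕ x
  conj-·ℕ zero    real = conj-0
  conj-·ℕ (suc m) real = trans (conj-+ _ _) (+-cong real (conj-·ℕ m real))

  ·ℕ-nonzero : ∀ m → .{{_ : ℕ.NonZero m}} → ¬ (m ·ℕ 1# ≈ 0#)
  ·ℕ-nonzero m@(suc _) m≈0 = contradiction (·1-cancel m m≈0) λ ()

  ·ℕ-cancel : ∀ m {x y} → .{{_ : ℕ.NonZero m}} → m ·ℕ x ≈ m ·ℕ y → x ≈ y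
  ·ℕ-cancel m {x} {y} eq = *-cancelˡ-nonzero (·ℕ-nonzero m)
    (trans (sym (·ℕ-scalar m x)) (trans eq (·ℕ-scalar m y)))

  private
    eliminated : ∀ {l} (a : Carrier) (c w : Fin l → Carrier) →
      - sum (λ i → c i * w i) * a + sum (λ i → c i * a * w i) ≈ 0#
    eliminated {l} a c w = begin
      - sum (λ i → c i * w i) * a + sum (λ i → c i * a * w i)
        ≈⟨ +-congˡ (trans
             (cong λ i → solve 3 (λ a b c → a :* b :* c := a :* c :* b) refl (c i) a (w i))
             (pullʳ a)) ⟩
      - sum (λ i → c i * w i) * a + sum (λ i → c i * w i) * a  ≈⟨ distribʳ _ _ _ ⟨
      (- sum (λ i → c i * w i) + sum (λ i → c i * w i)) * a    ≈⟨ *-congʳ (-‿inverseˡ _) ⟩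
      0# * a                                                   ≈⟨ zeroˡ _ ⟩
      0#                                                       ∎
      where open SumOver l

    regroup : ∀ {l} (a b : Carrier) (c w u : Fin l → Carrier) →
      - sum (λ i → c i * w i) * b + sum (λ i → c i * a * u i) ≈
      sum (λ i → c i * (a * u i + - (w i * b)))
    regroup {l} a b c w u = begin
      - sum (λ i → c i * w i) * b + sum (λ i → c i * a * u i)
        ≈⟨ +-comm _ _ ⟩
      sum (λ i → c i * a * u i) + - sum (λ i → c i * w i) * b
        ≈⟨ +-congˡ (trans (sym (-‿distribˡ-* _ _)) (trans (-‿distribʳ-* _ _) (sym (pullʳ (- b))))) ⟩
      sum (λ i → c i * a * u i) + sum (λ i → c i * w i * - b)
        ≈⟨ split ⟨
      sum (λ i → c i * a * u i + c i * w i * - b)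
        ≈⟨ cong (λ i → sym (trans (*-congˡ (+-congˡ (-‿distribʳ-* _ _)))
             (solve 5 (λ a b c d e → a :* (b :* c :+ d :* e) := a :* b :* c :+ a :* d :* e)
               refl (c i) a (u i) (w i) (- b)))) ⟩
      sum (λ i → c i * (a * u i + - (w i * b)))
        ∎
        where open SumOver l

  -- Elimination without division: with a pivot `p` in the first column, every other vector is
  -- multiplied by `v p zero` and then reduced by its own first entry times `v p`. A dependence `c`
  -- of the reduced vectors lifts to weights `c i * v p zero` off the pivot and `- s` at it.
  -- `eliminated` checks the first column, `regroup` the others. If the first column is zero, it is
  -- discarded together with one vector.
  dependent : ∀ m (v : Fin (suc m) → Fin m → Carrier) →
    ∃ λ (c : Fin (suc m) → Carrier) → (∃ λ i → ¬ (c i ≈ 0#)) × (∀ k → sum (λ i → c i * v i k) ≈ 0#)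
  dependent zero    v = (λ _ → 1#) , (zero , 1≉0) , λ ()
  dependent (suc m) v with em {P = ∃ λ i → ¬ (v i zero ≈ 0#)}
  ... | no none with c , (i , cᵢ≉0) , rel ← dependent m (λ i k → v (suc i) (suc k)) =
    0# ∷ c , (suc i , cᵢ≉0) , λ k → trans (+-congʳ (zeroˡ _)) (trans (+-identityˡ _) (col k))
    where
    col : ∀ k → sum (λ i → c i * v (suc i) k) ≈ 0#
    col zero = SumOver.vanishing (suc m) λ i → vanish i (em {P = v (suc i) zero ≈ 0#})
      where
      vanish : ∀ i → Dec (v (suc i) zero ≈ 0#) → c i * v (suc i) zero ≈ 0#
      vanish i (yes p) = trans (*-congˡ p) (zeroʳ _)
      vanish i (no ¬p) = contradiction (suc i , ¬p) none
    col (suc k) = rel k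
  ... | yes (p , vₚ≉0) with c , (i , cᵢ≉0) , rel ← dependent m
          (λ i k → v p zero * v (punchIn p i) (suc k) + - (v (punchIn p i) zero * v p (suc k))) =
    c′ , (punchIn p i , nz) , col
    where
    s : Carrier
    s = sum (λ i → c i * v (punchIn p i) zero)
    c′ : Fin (suc (suc m)) → Carrier
    c′ = insertAt (λ i → c i * v p zero) p (- s)
    c′-p : c′ p ≈ - s
    c′-p = reflexive (insertAt-lookup _ p _)
    c′-other : ∀ i → c′ (punchIn p i) ≈ c i * v p zero
    c′-other i = reflexive (insertAt-punchIn _ p _ i)
    nz : ¬ (c′ (punchIn p i) ≈ 0#)
    nz eq = cᵢ≉0 (zero-product vₚ≉0 (trans (*-comm _ _) (trans (sym (c′-other i)) eq)))
    split : ∀ k → sum (λ i → c′ i * v i k) ≈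
            - s * v p k + sum (λ i → c i * v p zero * v (punchIn p i) k)
    split k = trans (sum-remove {i = p} (λ i → c′ i * v i k))
      (+-cong (*-congʳ c′-p)
        (SumOver.cong (suc m) {λ i → c′ (punchIn p i) * v (punchIn p i) k} λ i → *-congʳ (c′-other i)))
    col : ∀ k → sum (λ i → c′ i * v i k) ≈ 0#
    col zero = trans (split zero)
      (eliminated (v p zero) c (λ i → v (punchIn p i) zero))
    col (suc k) = trans (split (suc k))
      (trans (regroup (v p zero) (v p (suc k)) c (λ i → v (punchIn p i) zero)
                (λ i → v (punchIn p i) (suc k)))
        (rel k))

-- Idempotents, matrices and subspaces.

module _ (S : Semigroup 0ℓ 0ℓ) where

  open Semigroup S

  idempotent-absorbs : ∀ p q → p ∙ p ≈ p → p ∙ (p ∙ q) ≈ p ∙ q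
  idempotent-absorbs p q pp≈p = trans (sym (assoc p p q)) (∙-congʳ pp≈p)

  product-idempotent : ∀ p q → p ∙ p ≈ p → q ∙ q ≈ q → p ∙ q ≈ q ∙ p → (p ∙ q) ∙ (p ∙ q) ≈ p ∙ q
  product-idempotent p q pp≈p qq≈q pq≈qp =
    trans (assoc p q (p ∙ q)) (trans (∙-congˡ (trans (∙-congˡ pq≈qp)
      (trans (idempotent-absorbs q p qq≈q) (sym pq≈qp)))) (idempotent-absorbs p q pp≈p))

module MatrixAlgebra (em : ∀ {ℓ} → ExcludedMiddle ℓ) (K : ConjugationField) (n : ℕ) where

  open FieldTheory em K public
  module ΣX = SumOver n

  V : Set
  V = Fin n → Carrier

  Matrix : Set
  Matrix = Fin n → Fin n → Carrier

  infix 4 _≈ᵛ_ _≈ᵐ_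
  infixl 6 _+ᵛ_
  infixl 7 _*ᵐ_
  infixr 7 _∙ᵛ_ _$ᵛ_

  _≈ᵛ_ : V → V → Set
  u ≈ᵛ v = ∀ y → u y ≈ v y

  _≈ᵐ_ : Matrix → Matrix → Set
  B ≈ᵐ C = ∀ y z → B y z ≈ C y z

  0ᵛ : V
  0ᵛ _ = 0#

  0ᵐ : Matrix
  0ᵐ _ _ = 0#

  _+ᵛ_ : V → V → V
  (u +ᵛ v) y = u y + v y

  _∙ᵛ_ : Carrier → V → V
  (c ∙ᵛ v) y = c * v y

  _⊙_ : V → V → V
  (u ⊙ v) y = u y * v y

  _*ᵐ_ : Matrix → Matrix → Matrix
  (B *ᵐ C) y z = sum λ w → B y w * C w z

  _$ᵛ_ : Matrix → V → V
  (B $ᵛ v) y = sum λ z → B y z * v z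

  ⟨_,_⟩ : V → V → Carrier
  ⟨ u , v ⟩ = sum λ y → u y * conj (v y)

  _ᴴ : Matrix → Matrix
  (B ᴴ) y z = conj (B z y)

  *ᵐ-assoc : ∀ A B C → (A *ᵐ B) *ᵐ C ≈ᵐ A *ᵐ (B *ᵐ C)
  *ᵐ-assoc A B C y z = begin
    sum (λ w → sum (λ u → A y u * B u w) * C w z)
      ≈⟨ ΣX.cong (λ w → ΣX.pullʳ (C w z)) ⟨
    sum (λ w → sum (λ u → A y u * B u w * C w z))
      ≈⟨ ΣX.swap {n} ⟩
    sum (λ u → sum (λ w → A y u * B u w * C w z))
      ≈⟨ ΣX.cong (λ u → trans (ΣX.cong λ w → *-assoc _ _ _) (ΣX.pullˡ (A y u))) ⟩
    sum (λ u → A y u * sum (λ w → B u w * C w z)) ∎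

  *ᵐ-semigroup : Semigroup 0ℓ 0ℓ
  *ᵐ-semigroup = record
    { Carrier = Matrix
    ; _≈_ = _≈ᵐ_
    ; _∙_ = _*ᵐ_
    ; isSemigroup = record
      { isMagma = record
        { isEquivalence = record
          { refl  = λ _ _ → refl
          ; sym   = λ p y z → sym (p y z)
          ; trans = λ p q y z → trans (p y z) (q y z)
          }
        ; ∙-cong = λ p q y z → ΣX.cong λ w → *-cong (p y w) (q w z)
        }
      ; assoc = *ᵐ-assoc
      }
    }

  $ᵛ-*ᵐ : ∀ A B v → (A *ᵐ B) $ᵛ v ≈ᵛ A $ᵛ (B $ᵛ v)
  -- The vector `v` is read as the matrix all of whose columns are `v`.
  $ᵛ-*ᵐ A B v y = *ᵐ-assoc A B (λ w _ → v w) y y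

  *ᵐ-cong : ∀ {A A′ B B′} → A ≈ᵐ A′ → B ≈ᵐ B′ → A *ᵐ B ≈ᵐ A′ *ᵐ B′
  *ᵐ-cong p q y z = ΣX.cong λ w → *-cong (p y w) (q w z)

  $ᵛ-congˡ : ∀ {A B} v → A ≈ᵐ B → A $ᵛ v ≈ᵛ B $ᵛ v
  $ᵛ-congˡ v p y = ΣX.cong λ w → *-congʳ (p y w)

  $ᵛ-congʳ : ∀ B {u v} → u ≈ᵛ v → B $ᵛ u ≈ᵛ B $ᵛ v
  $ᵛ-congʳ B p y = ΣX.cong λ w → *-congˡ (p w)

  $ᵛ-+ : ∀ B u v → B $ᵛ (u +ᵛ v) ≈ᵛ (B $ᵛ u) +ᵛ (B $ᵛ v)
  $ᵛ-+ B u v y = trans (ΣX.cong λ w → distribˡ _ _ _) ΣX.split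

  $ᵛ-∙ : ∀ B c v → B $ᵛ (c ∙ᵛ v) ≈ᵛ c ∙ᵛ (B $ᵛ v)
  $ᵛ-∙ B c v y = trans
    (ΣX.cong λ w → solve 3 (λ b c v → b :* (c :* v) := c :* (b :* v)) refl (B y w) c (v w))
    (ΣX.pullˡ c)

  $ᵛ-0 : ∀ B {v} → v ≈ᵛ 0ᵛ → B $ᵛ v ≈ᵛ 0ᵛ
  $ᵛ-0 B v≈0 y = ΣX.vanishing λ w → trans (*-congˡ (v≈0 w)) (zeroʳ _)

  adjoint : ∀ B u v → ⟨ B $ᵛ u , v ⟩ ≈ ⟨ u , B ᴴ $ᵛ v ⟩
  adjoint B u v = begin
    sum (λ y → sum (λ z → B y z * u z) * conj (v y))
      ≈⟨ ΣX.cong (λ y → ΣX.pullʳ _) ⟨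
    sum (λ y → sum (λ z → B y z * u z * conj (v y)))
      ≈⟨ ΣX.swap {n} ⟩
    sum (λ z → sum (λ y → B y z * u z * conj (v y)))
      ≈⟨ ΣX.cong (λ z → trans (ΣX.cong λ y → term y z) (ΣX.pullˡ (u z))) ⟩
    sum (λ z → u z * sum (λ y → conj (conj (B y z) * v y)))
      ≈⟨ ΣX.cong (λ z → *-congˡ (ΣX.conj-sum _)) ⟨
    sum (λ z → u z * conj (sum (λ y → conj (B y z) * v y))) ∎
    where
    term : ∀ y z → B y z * u z * conj (v y) ≈ u z * conj (conj (B y z) * v y)
    term y z = begin
      B y z * u z * conj (v y)
        ≈⟨ solve 3 (λ b u v → b :* u :* v := u :* (b :* v)) refl (B y z) (u z) (conj (v y)) ⟩
      u z * (B y z * conj (v y))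
        ≈⟨ *-congˡ (trans (conj-* _ _) (*-congʳ (conj-involutive _))) ⟨
      u z * conj (conj (B y z) * v y) ∎

  ⟨⟩-cong : ∀ {u u′ v v′} → u ≈ᵛ u′ → v ≈ᵛ v′ → ⟨ u , v ⟩ ≈ ⟨ u′ , v′ ⟩
  ⟨⟩-cong p q = ΣX.cong λ y → *-cong (p y) (conj-cong (q y))

  ⟨⟩-+ʳ : ∀ u v w → ⟨ u , v +ᵛ w ⟩ ≈ ⟨ u , v ⟩ + ⟨ u , w ⟩
  ⟨⟩-+ʳ u v w = trans (ΣX.cong λ y → trans (*-congˡ (conj-+ _ _)) (distribˡ _ _ _)) ΣX.split

  ⟨⟩-definite : ∀ v → ⟨ v , v ⟩ ≈ 0# → v ≈ᵛ 0ᵛ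
  ⟨⟩-definite v = anisotropic v

  -- The hypothesis makes the sum of `f` its own squared norm.
  sum-zero-one : {f : V} → (∀ y → f y * conj (f y) ≈ f y) → sum f ≈ 0# → f ≈ᵛ 0ᵛ
  sum-zero-one {f} sq f≈0 = anisotropic f (trans (ΣX.cong sq) f≈0)

  diag : V → Matrix
  diag v y z = if does (y ≟ z) then v y else 0#

  diag-$ᵛ : ∀ u v → diag u $ᵛ v ≈ᵛ u ⊙ v
  diag-$ᵛ u v y = trans (ΣX.single y off) on
    where
    off : ∀ z → z ≢ y → diag u y z * v z ≈ 0#
    off z z≢y with y ≟ z
    ... | yes y≡z = contradiction (≡.sym y≡z) z≢y
    ... | no _    = zeroˡ _
    on : diag u y y * v y ≈ u y * v y
    on with y ≟ y
    ... | yes _  = refl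
    ... | no y≢y = contradiction ≡.refl y≢y

  diag-ᴴ : ∀ {u} → (∀ y → conj (u y) ≈ u y) → (diag u) ᴴ ≈ᵐ diag u
  diag-ᴴ real y z with z ≟ y | y ≟ z
  ... | yes ≡.refl | yes _  = real y
  ... | yes ≡.refl | no y≢y = contradiction ≡.refl y≢y
  ... | no z≢y | yes y≡z    = contradiction (≡.sym y≡z) z≢y
  ... | no _   | no _       = conj-0

  diag-multiple : ∀ m u v → diag (λ y → m ·ℕ u y) $ᵛ v ≈ᵛ (m ·ℕ 1#) ∙ᵛ (u ⊙ v)
  diag-multiple m u v y = trans (diag-$ᵛ (λ y → m ·ℕ u y) v y)
    (trans (*-congʳ (·ℕ-scalar m (u y))) (*-assoc _ _ _))

  diag-rescale : ∀ m {c} → c * (m ·ℕ 1#) ≈ 1# → ∀ u y z → c * diag (λ y → m ·ℕ u y) y z ≈ diag u y z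
  diag-rescale m {c} cm≈1 u y z with y ≟ z
  ... | yes _ = trans (*-congˡ (·ℕ-scalar m (u y))) (trans (sym (*-assoc _ _ _))
                  (trans (*-congʳ cm≈1) (*-identityˡ _)))
  ... | no _  = zeroʳ c

  ᴴ-*ᵐ : ∀ B C → (C ᴴ) *ᵐ (B ᴴ) ≈ᵐ (B *ᵐ C) ᴴ
  ᴴ-*ᵐ B C y z = sym (trans (ΣX.conj-sum _) (ΣX.cong λ w → trans (conj-* _ _) (*-comm _ _)))

  $ᵛ-+ˡ : ∀ B C v → (λ y z → B y z + C y z) $ᵛ v ≈ᵛ (B $ᵛ v) +ᵛ (C $ᵛ v)
  $ᵛ-+ˡ B C v y = trans (ΣX.cong λ w → distribʳ _ _ _) ΣX.split

  $ᵛ-∙ˡ : ∀ c B v → (λ y z → c * B y z) $ᵛ v ≈ᵛ c ∙ᵛ (B $ᵛ v)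
  $ᵛ-∙ˡ c B v y = trans (ΣX.cong λ w → *-assoc _ _ _) (ΣX.pullˡ c)

  infixl 6 _-ᵐ_

  _-ᵐ_ : Matrix → Matrix → Matrix
  (B -ᵐ C) y z = B y z + - C y z

  *ᵐ-distribˡ-- : ∀ B C F → B *ᵐ (C -ᵐ F) ≈ᵐ B *ᵐ C -ᵐ B *ᵐ F
  *ᵐ-distribˡ-- B C F y z = begin
    sum (λ w → B y w * (C w z + - F w z))
      ≈⟨ ΣX.cong (λ w → trans (distribˡ _ _ _) (+-congˡ (negate w))) ⟩
    sum (λ w → B y w * C w z + - 1# * (B y w * F w z))
      ≈⟨ trans ΣX.split (+-congˡ (ΣX.pullˡ (- 1#))) ⟩
    (B *ᵐ C) y z + - 1# * (B *ᵐ F) y z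
      ≈⟨ +-congˡ (trans (sym (-‿distribˡ-* _ _)) (-‿cong (*-identityˡ _))) ⟩
    (B *ᵐ C -ᵐ B *ᵐ F) y z ∎
    where
    negate : ∀ w → B y w * - F w z ≈ - 1# * (B y w * F w z)
    negate w = trans (sym (-‿distribʳ-* _ _)) (trans (-‿cong (sym (*-identityˡ _))) (-‿distribˡ-* _ _))

  record IsSubspace (P : V → Set) : Set where
    field
      resp-≈   : ∀ {u v} → u ≈ᵛ v → P u → P v
      0-closed : P 0ᵛ
      +-closed : ∀ {u v} → P u → P v → P (u +ᵛ v)
      ∙-closed : ∀ c {v} → P v → P (c ∙ᵛ v)

    Σ-closed : ∀ {m} {f : Fin m → V} → (∀ i → P (f i)) → P (λ y → sum (λ i → f i y))
    Σ-closed {zero}  f∈P = 0-closed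
    Σ-closed {suc m} f∈P = +-closed (f∈P zero) (Σ-closed (f∈P ∘ suc))

  -- The intersection numbers enter only through the equality of field-valued counts, so the algebra
  -- below never has to name them.
  IntersectionRegular : ∀ {d} → (Fin n → Fin n → Fin d) → Set
  IntersectionRegular rel = ∀ i j {x y x′ y′} → rel x y ≡ rel x′ y′ →
    sum (λ w → ⟦ rel x w ≟ i ⟧ * ⟦ rel w y ≟ j ⟧) ≈ sum (λ w → ⟦ rel x′ w ≟ i ⟧ * ⟦ rel w y′ ≟ j ⟧)

  -- There are as many idempotents as relations; that they span is not a field but is deduced by
  -- counting in `spanning`.
  record IsIdempotentBasis {d : ℕ} (rel : Fin n → Fin n → Fin d) (E : Fin d → Matrix) : Set where
    field
      E-constant   : ∀ j {x y x′ y′} → rel x y ≡ rel x′ y′ → E j x y ≈ E j x′ y′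
      E-idempotent : ∀ j → E j *ᵐ E j ≈ᵐ E j
      E-orthogonal : ∀ {j k} → j ≢ k → E j *ᵐ E k ≈ᵐ 0ᵐ
      E-nonzero    : ∀ j → ¬ (E j ≈ᵐ 0ᵐ)

-- The Bose-Mesner algebra as the matrices constant on relations.

module RelationAlgebra
  (em : ∀ {ℓ} → ExcludedMiddle ℓ) (K : ConjugationField) {n d : ℕ}
  (rel : Fin n → Fin n → Fin d)
  (rel-symmetric : ∀ x y → rel x y ≡ rel y x)
  (rel-nonempty : ∀ i → ∃₂ λ x y → rel x y ≡ i)
  (o : Fin d) (rel-diagonal : ∀ x → rel x x ≡ o) (rel-diagonal⁻¹ : ∀ x y → rel x y ≡ o → x ≡ y)
  (intersection : MatrixAlgebra.IntersectionRegular em K n rel)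
  where

  open MatrixAlgebra em K n public
  module ΣR = SumOver d

  A : Fin d → Matrix
  A i x y = ⟦ rel x y ≟ i ⟧

  -- Membership in the Bose-Mesner algebra without a choice of coefficients; `expand` recovers them
  -- as values at representatives.
  RelConstant : Matrix → Set
  RelConstant B = ∀ {x y x′ y′} → rel x y ≡ rel x′ y′ → B x y ≈ B x′ y′

  A-constant : ∀ i → RelConstant (A i)
  A-constant i eq = reflexive (≡.cong (λ k → ⟦ k ≟ i ⟧) eq)

  pt₁ pt₂ : Fin d → Fin n
  pt₁ i = proj₁ (rel-nonempty i)
  pt₂ i = proj₁ (proj₂ (rel-nonempty i))

  rel-pt : ∀ i → rel (pt₁ i) (pt₂ i) ≡ i
  rel-pt i = proj₂ (proj₂ (rel-nonempty i))

  value : Matrix → Fin d → Carrier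
  value B i = B (pt₁ i) (pt₂ i)

  value-≈ : ∀ {B} → RelConstant B → ∀ x y → B x y ≈ value B (rel x y)
  value-≈ B-const x y = B-const (≡.sym (rel-pt (rel x y)))

  symmetric : ∀ {B} → RelConstant B → ∀ x y → B x y ≈ B y x
  symmetric B-const x y = B-const (rel-symmetric x y)

  ⟦⟧-select : ∀ k (c : Fin d → Carrier) → sum (λ i → c i * ⟦ k ≟ i ⟧) ≈ c k
  ⟦⟧-select k c = trans
    (ΣR.single k λ i i≢k → trans (*-congˡ (⟦⟧-no (k ≟ i) (i≢k ∘ ≡.sym))) (zeroʳ _))
    (trans (*-congˡ (⟦⟧-yes (k ≟ k) ≡.refl)) (*-identityʳ _))

  expand : ∀ {B} → RelConstant B → ∀ x y → B x y ≈ sum (λ i → value B i * A i x y)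
  expand B-const x y = trans (value-≈ B-const x y) (sym (⟦⟧-select (rel x y) _))

  expand-$ᵛ : ∀ {B} → RelConstant B → ∀ v y → (B $ᵛ v) y ≈ sum (λ i → value B i * (A i $ᵛ v) y)
  expand-$ᵛ {B} B-const v y = begin
    sum (λ z → B y z * v z)
      ≈⟨ ΣX.cong (λ z → *-congʳ (expand B-const y z)) ⟩
    sum (λ z → sum (λ i → value B i * A i y z) * v z)
      ≈⟨ ΣX.cong (λ z → trans (sym (ΣR.pullʳ (v z))) (ΣR.cong λ i → *-assoc _ _ _)) ⟩
    sum (λ z → sum (λ i → value B i * (A i y z * v z)))
      ≈⟨ ΣX.swap {d} ⟩
    sum (λ i → sum (λ z → value B i * (A i y z * v z)))
      ≈⟨ ΣR.cong (λ i → ΣX.pullˡ _) ⟩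
    sum (λ i → value B i * sum (λ z → A i y z * v z)) ∎

  -- Expanding both factors in the A_i turns an entry of the product into a combination of
  -- intersection counts, and these depend on the relation alone.
  *ᵐ-constant : ∀ {B C} → RelConstant B → RelConstant C → RelConstant (B *ᵐ C)
  *ᵐ-constant {B} {C} B-const C-const {x} {y} {x′} {y′} eq = begin
    (B *ᵐ C) x y           ≈⟨ *ᵐ-expand x y ⟩
    expansion x y          ≈⟨ ΣR.cong (λ i → ΣR.cong λ j → *-congˡ (intersection i j eq)) ⟩
    expansion x′ y′        ≈⟨ *ᵐ-expand x′ y′ ⟨
    (B *ᵐ C) x′ y′         ∎
    where
    expansion : Fin n → Fin n → Carrier
    expansion x y = sum λ i → sum λ j →
      value B i * value C j * sum (λ w → A i x w * A j w y)
    *ᵐ-expand : ∀ x y → (B *ᵐ C) x y ≈ expansion x y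
    *ᵐ-expand x y = begin
      sum (λ w → B x w * C w y)
        ≈⟨ ΣX.cong (λ w → trans (*-cong (expand B-const x w) (expand C-const w y))
             (trans (sym (ΣR.pullʳ _)) (ΣR.cong λ i → sym (ΣR.pullˡ _)))) ⟩
      sum (λ w → sum (λ i → sum (λ j → value B i * A i x w * (value C j * A j w y))))
        ≈⟨ ΣX.swap {d} ⟩
      sum (λ i → sum (λ w → sum (λ j → value B i * A i x w * (value C j * A j w y))))
        ≈⟨ ΣR.cong (λ i → ΣX.swap {d}) ⟩
      sum (λ i → sum (λ j → sum (λ w → value B i * A i x w * (value C j * A j w y))))
        ≈⟨ ΣR.cong (λ i → ΣR.cong λ j → trans (ΣX.cong λ w →
             solve 4 (λ a b c d → a :* b :* (c :* d) := a :* c :* (b :* d)) refl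
               (value B i) (A i x w) (value C j) (A j w y)) (ΣX.pullˡ _)) ⟩
      expansion x y ∎

  -- All matrices of the algebra are symmetric, the product included, while transposition reverses
  -- the factors.
  *ᵐ-comm : ∀ {B C} → RelConstant B → RelConstant C → B *ᵐ C ≈ᵐ C *ᵐ B
  *ᵐ-comm {B} {C} B-const C-const y z = begin
    sum (λ w → B y w * C w z)
      ≈⟨ ΣX.cong (λ w → trans (*-comm _ _)
           (*-cong (symmetric {C} C-const w z) (symmetric {B} B-const y w))) ⟩
    sum (λ w → C z w * B w y)
      ≈⟨ symmetric {C *ᵐ B} (*ᵐ-constant {C} {B} C-const B-const) z y ⟩
    sum (λ w → C y w * B w z) ∎

  module IdempotentDifference {P F : Matrix} (P-const : RelConstant P) (F-const : RelConstant F)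
    (PP≈P : P *ᵐ P ≈ᵐ P) (PF≈F : P *ᵐ F ≈ᵐ F) (FF≈F : F *ᵐ F ≈ᵐ F) where

    difference-constant : RelConstant (P -ᵐ F)
    difference-constant eq = +-cong (P-const eq) (-‿cong (F-const eq))

    FP≈F : F *ᵐ P ≈ᵐ F
    FP≈F y z = trans (*ᵐ-comm {F} {P} F-const P-const y z) (PF≈F y z)

    orthogonal : F *ᵐ (P -ᵐ F) ≈ᵐ 0ᵐ
    orthogonal y z = trans (*ᵐ-distribˡ-- F P F y z)
      (trans (+-cong (FP≈F y z) (-‿cong (FF≈F y z))) (-‿inverseʳ _))

    difference-idempotent : (P -ᵐ F) *ᵐ (P -ᵐ F) ≈ᵐ P -ᵐ F
    difference-idempotent y z = begin
      ((P -ᵐ F) *ᵐ (P -ᵐ F)) y z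
        ≈⟨ *ᵐ-distribˡ-- (P -ᵐ F) P F y z ⟩
      ((P -ᵐ F) *ᵐ P) y z + - ((P -ᵐ F) *ᵐ F) y z
        ≈⟨ +-cong (*ᵐ-comm {P -ᵐ F} {P} difference-constant P-const y z)
             (-‿cong (trans (*ᵐ-comm {P -ᵐ F} {F} difference-constant F-const y z) (orthogonal y z))) ⟩
      (P *ᵐ (P -ᵐ F)) y z + - 0#
        ≈⟨ trans (+-congˡ -0#≈0#) (+-identityʳ _) ⟩
      (P *ᵐ (P -ᵐ F)) y z
        ≈⟨ trans (*ᵐ-distribˡ-- P P F y z) (+-cong (PP≈P y z) (-‿cong (PF≈F y z))) ⟩
      P y z + - F y z ∎

    recompose : ∀ y z → P y z ≈ F y z + (P -ᵐ F) y z
    recompose y z = sym (trans (+-comm _ _) (trans (+-assoc _ _ _)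
      (trans (+-congˡ (-‿inverseˡ _)) (+-identityʳ _))))

  IsMinimal : Matrix → Set
  IsMinimal P = ∀ F G → RelConstant F → F *ᵐ F ≈ᵐ F → RelConstant G → G *ᵐ G ≈ᵐ G →
    F *ᵐ G ≈ᵐ 0ᵐ → (∀ y z → P y z ≈ F y z + G y z) → F ≈ᵐ 0ᵐ ⊎ G ≈ᵐ 0ᵐ

  -- P is the orthogonal sum of the idempotents P Q and P - P Q, and minimality kills one of the
  -- two.
  minimal-below : ∀ {P Q} → RelConstant P → RelConstant Q → P *ᵐ P ≈ᵐ P → Q *ᵐ Q ≈ᵐ Q →
    IsMinimal P → P *ᵐ Q ≈ᵐ 0ᵐ ⊎ P ≈ᵐ P *ᵐ Q
  minimal-below {P} {Q} P-const Q-const PP≈P QQ≈Q P-minimal =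
    conclude (P-minimal F (P -ᵐ F) F-const FF≈F difference-constant difference-idempotent orthogonal recompose)
    where
    F : Matrix
    F = P *ᵐ Q
    F-const : RelConstant F
    F-const = *ᵐ-constant {P} {Q} P-const Q-const
    PQ≈QP : P *ᵐ Q ≈ᵐ Q *ᵐ P
    PQ≈QP = *ᵐ-comm {P} {Q} P-const Q-const
    PF≈F : P *ᵐ F ≈ᵐ F
    PF≈F = idempotent-absorbs *ᵐ-semigroup P Q PP≈P
    FF≈F : F *ᵐ F ≈ᵐ F
    FF≈F = product-idempotent *ᵐ-semigroup P Q PP≈P QQ≈Q PQ≈QP
    open IdempotentDifference {P} {F} P-const F-const PP≈P PF≈F FF≈F
    conclude : F ≈ᵐ 0ᵐ ⊎ (P -ᵐ F) ≈ᵐ 0ᵐ → F ≈ᵐ 0ᵐ ⊎ P ≈ᵐ F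
    conclude (inj₁ F≈0)  = inj₁ F≈0
    conclude (inj₂ PF≈0) = inj₂ λ y z → trans (recompose y z)
      (trans (+-congˡ (PF≈0 y z)) (+-identityʳ _))

  -- If `minimal-below` gave the second alternative both ways, then P = P Q = Q P = Q.
  minimal-orthogonal : ∀ {P Q} → RelConstant P → RelConstant Q → P *ᵐ P ≈ᵐ P → Q *ᵐ Q ≈ᵐ Q →
    IsMinimal P → IsMinimal Q → ¬ (P ≈ᵐ Q) → P *ᵐ Q ≈ᵐ 0ᵐ
  minimal-orthogonal {P} {Q} P-const Q-const PP≈P QQ≈Q P-minimal Q-minimal P≉Q = conclude
    (minimal-below {P} {Q} P-const Q-const PP≈P QQ≈Q P-minimal)
    (minimal-below {Q} {P} Q-const P-const QQ≈Q PP≈P Q-minimal)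
    where
    open Semigroup *ᵐ-semigroup using () renaming (trans to ≈ᵐ-trans; sym to ≈ᵐ-sym)
    PQ≈QP : P *ᵐ Q ≈ᵐ Q *ᵐ P
    PQ≈QP = *ᵐ-comm {P} {Q} P-const Q-const
    conclude : P *ᵐ Q ≈ᵐ 0ᵐ ⊎ P ≈ᵐ P *ᵐ Q → Q *ᵐ P ≈ᵐ 0ᵐ ⊎ Q ≈ᵐ Q *ᵐ P → P *ᵐ Q ≈ᵐ 0ᵐ
    conclude (inj₁ PQ≈0) _           = PQ≈0
    conclude (inj₂ _)    (inj₁ QP≈0) = ≈ᵐ-trans {P *ᵐ Q} {Q *ᵐ P} PQ≈QP QP≈0
    conclude (inj₂ P≈)   (inj₂ Q≈)   = contradiction
      (≈ᵐ-trans {P} {P *ᵐ Q} P≈ (≈ᵐ-trans {P *ᵐ Q} {Q *ᵐ P} PQ≈QP (≈ᵐ-sym {Q} {Q *ᵐ P} Q≈))) P≉Q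

  I : Matrix
  I x y = ⟦ x ≟ y ⟧

  I-constant : RelConstant I
  I-constant {x} {y} {x′} {y′} eq = ⟦⟧-cong (x ≟ y) (x′ ≟ y′) (transfer eq) (transfer (≡.sym eq))
    where
    transfer : ∀ {x y x′ y′} → rel x y ≡ rel x′ y′ → x ≡ y → x′ ≡ y′
    transfer eq ≡.refl = rel-diagonal⁻¹ _ _ (≡.trans (≡.sym eq) (rel-diagonal _))

  I-$ᵛ : ∀ v → I $ᵛ v ≈ᵛ v
  I-$ᵛ v y = trans
    (ΣX.single y λ z z≢y → trans (*-congʳ (⟦⟧-no (y ≟ z) (z≢y ∘ ≡.sym))) (zeroˡ _))
    (trans (*-congʳ (⟦⟧-yes (y ≟ y) ≡.refl)) (*-identityˡ _))

  A-zero-one : ∀ i x y → A i x y * conj (A i x y) ≈ A i x y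
  A-zero-one i x y with rel x y ≟ i
  ... | yes _ = trans (*-identityˡ _) conj-1
  ... | no _  = zeroˡ _

  indicator : ∀ {P : Fin n → Set} → Decidable P → V
  indicator P? y = ⟦ P? y ⟧

  distance-occurs : ∀ {P : Fin n → Set} (P? : Decidable P) i →
    ¬ (⟨ indicator P? , A i $ᵛ indicator P? ⟩ ≈ 0#) → ∃₂ λ y z → P y × P z × rel y z ≡ i
  distance-occurs {P} P? i nonzero with em {P = ∃₂ λ y z → P y × P z × rel y z ≡ i}
  ... | yes found = found
  ... | no none = contradiction (ΣX.vanishing λ y → outer y (P? y)) nonzero
    where
    inner : ∀ y → P y → ∀ z (d : Dec (rel y z ≡ i)) (e : Dec (P z)) → ⟦ d ⟧ * ⟦ e ⟧ ≈ 0#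
    inner y Py z (yes yz) (yes Pz) = contradiction (y , z , Py , Pz , yz) none
    inner y Py z (yes _)  (no _)   = zeroʳ _
    inner y Py z (no _)   e        = zeroˡ _
    outer : ∀ y (d : Dec (P y)) → ⟦ d ⟧ * conj ((A i $ᵛ indicator P?) y) ≈ 0#
    outer y (no _)   = zeroˡ _
    outer y (yes Py) = trans (*-congˡ (trans (conj-cong (ΣX.vanishing λ z → inner y Py z (rel y z ≟ i) (P? z))) conj-0))
      (zeroʳ _)

  -- The form expands into a double sum of zero-one products; these are nonnegative, so the nonzero
  -- term at `y`, `z` cannot be cancelled.
  occurring-distance : ∀ {P : Fin n → Set} (P? : Decidable P) i {y z} → P y → P z → rel y z ≡ i →
    ¬ (⟨ indicator P? , A i $ᵛ indicator P? ⟩ ≈ 0#)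
  occurring-distance {P} P? i {y} {z} Py Pz yz vanishes = 1≉0 (begin
    1#
      ≈⟨ trans (*-cong (⟦⟧-yes (P? y) Py) (trans (*-cong (trans (conj-⟦⟧ (rel y z ≟ i)) (⟦⟧-yes (rel y z ≟ i) yz))
           (trans (conj-⟦⟧ (P? z)) (⟦⟧-yes (P? z) Pz))) (*-identityˡ _))) (*-identityˡ _) ⟨
    term y z
      ≈⟨ summands-zero (λ z → term-nonNegative y z)
           (summands-zero (λ y → sum-nonNegative λ z → term-nonNegative y z) (trans (sym expanded) vanishes) y) z ⟩
    0# ∎)
    where
    term : Fin n → Fin n → Carrier
    term y z = ⟦ P? y ⟧ * (conj ⟦ rel y z ≟ i ⟧ * conj ⟦ P? z ⟧)
    expanded : ⟨ indicator P? , A i $ᵛ indicator P? ⟩ ≈ sum (λ y → sum (λ z → term y z))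
    expanded = ΣX.cong λ y → trans (*-congˡ (trans (ΣX.conj-sum _) (ΣX.cong λ z → conj-* _ _))) (sym (ΣX.pullˡ _))
    product-nonNegative : ∀ {Q R S : Set} (a : Dec Q) (b : Dec R) (c : Dec S) →
      NonNegative (⟦ a ⟧ * (conj ⟦ b ⟧ * conj ⟦ c ⟧))
    product-nonNegative (no _) _ _ = nonNegative-≈ (sym (zeroˡ _)) nonNegative-0
    product-nonNegative (yes _) (no _) _ =
      nonNegative-≈ (sym (trans (*-congˡ (trans (*-congʳ conj-0) (zeroˡ _))) (zeroʳ _))) nonNegative-0
    product-nonNegative (yes _) (yes _) (no _) =
      nonNegative-≈ (sym (trans (*-congˡ (trans (*-congˡ conj-0) (zeroʳ _))) (zeroʳ _))) nonNegative-0
    product-nonNegative (yes _) (yes _) (yes _) =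
      nonNegative-≈ (*-congˡ (sym (trans (*-congʳ conj-1) (*-identityˡ _)))) (nonNegative-sq 1#)
    term-nonNegative : ∀ y z → NonNegative (term y z)
    term-nonNegative y z = product-nonNegative (P? y) (rel y z ≟ i) (P? z)

  RelConstant-closed : ∀ {P} → IsSubspace P → (∀ i {v} → P v → P (A i $ᵛ v)) →
                       ∀ {B} → RelConstant B → ∀ {v} → P v → P (B $ᵛ v)
  RelConstant-closed subspace A-closed B-const v∈P = resp-≈ (λ y → sym (expand-$ᵛ B-const _ y))
    (Σ-closed λ i → ∙-closed _ (A-closed i v∈P))
    where open IsSubspace subspace

-- Spectral theory from the basis of idempotents.

module IdempotentBasis
  (em : ∀ {ℓ} → ExcludedMiddle ℓ) (K : ConjugationField) {n d : ℕ}
  (rel : Fin n → Fin n → Fin d)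
  (rel-symmetric : ∀ x y → rel x y ≡ rel y x)
  (rel-nonempty : ∀ i → ∃₂ λ x y → rel x y ≡ i)
  (o : Fin d) (rel-diagonal : ∀ x → rel x x ≡ o) (rel-diagonal⁻¹ : ∀ x y → rel x y ≡ o → x ≡ y)
  (intersection : MatrixAlgebra.IntersectionRegular em K n rel)
  (E : Fin d → MatrixAlgebra.Matrix em K n) (basis : MatrixAlgebra.IsIdempotentBasis em K n rel E)
  where

  open RelationAlgebra em K rel rel-symmetric rel-nonempty o rel-diagonal rel-diagonal⁻¹ intersection public
  open IsIdempotentBasis basis

  combination : (Fin d → Carrier) → Matrix
  combination c x y = sum λ j → c j * E j x y

  E-*-combination : ∀ c k → E k *ᵐ combination c ≈ᵐ λ y z → c k * E k y z
  E-*-combination c k y z = begin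
    sum (λ w → E k y w * sum (λ j → c j * E j w z))
      ≈⟨ ΣX.cong (λ w → trans (sym (ΣR.pullˡ _)) (ΣR.cong λ j →
           solve 3 (λ a b c → a :* (b :* c) := b :* (a :* c)) refl (E k y w) (c j) (E j w z))) ⟩
    sum (λ w → sum (λ j → c j * (E k y w * E j w z)))
      ≈⟨ ΣX.swap {d} ⟩
    sum (λ j → sum (λ w → c j * (E k y w * E j w z)))
      ≈⟨ ΣR.cong (λ j → ΣX.pullˡ _) ⟩
    sum (λ j → c j * (E k *ᵐ E j) y z)
      ≈⟨ ΣR.single k (λ j j≢k → trans (*-congˡ (E-orthogonal (j≢k ∘ ≡.sym) y z)) (zeroʳ _)) ⟩
    c k * (E k *ᵐ E k) y z
      ≈⟨ *-congˡ (E-idempotent k y z) ⟩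
    c k * E k y z ∎

  scalar-zero : ∀ k {c} → (∀ y z → c * E k y z ≈ 0#) → c ≈ 0#
  scalar-zero k {c} cE≈0 with em {P = c ≈ 0#}
  ... | yes c≈0 = c≈0
  ... | no  c≉0 = contradiction (λ y z → zero-product c≉0 (cE≈0 y z)) (E-nonzero k)

  scalar-cancel : ∀ k {a b} → (∀ y z → a * E k y z ≈ b * E k y z) → a ≈ b
  scalar-cancel k {a} {b} eq with em {P = ∃₂ λ y z → ¬ (E k y z ≈ 0#)}
  ... | yes (y , z , E≉0) = *-cancelˡ-nonzero E≉0 (trans (*-comm _ _) (trans (eq y z) (*-comm _ _)))
  ... | no none = contradiction (λ y z → entry y z em) (E-nonzero k)
    where
    entry : ∀ y z → Dec (E k y z ≈ 0#) → E k y z ≈ 0#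
    entry y z (yes p) = p
    entry y z (no ¬p) = contradiction (y , z , ¬p) none

  independent : ∀ c → combination c ≈ᵐ 0ᵐ → ∀ k → c k ≈ 0#
  independent c ≈0 k = scalar-zero k λ y z →
    trans (sym (E-*-combination c k y z)) (ΣX.vanishing λ w → trans (*-congˡ (≈0 w z)) (zeroʳ _))

  -- d + 1 elements of a d-dimensional space are dependent.
  spanning : ∀ {B} → RelConstant B → ∃ λ c → B ≈ᵐ combination c
  spanning {B} B-const
    with a , (i , aᵢ≉0) , dep ← dependent d (λ i k → (value B ∷ (λ j → value (E j))) i k)
    with em {P = a zero ≈ 0#}
  ... | yes a₀≈0 = contradiction (all-zero i) aᵢ≉0
    where
    all-zero : ∀ i → a i ≈ 0#
    all-zero zero    = a₀≈0
    all-zero (suc j) = independent (a ∘ suc) (λ x y → begin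
      sum (λ j → a (suc j) * E j x y)
        ≈⟨ ΣR.cong (λ j → *-congˡ (value-≈ (E-constant j) x y)) ⟩
      sum (λ j → a (suc j) * value (E j) (rel x y))
        ≈⟨ trans (+-congʳ (trans (*-congʳ a₀≈0) (zeroˡ _))) (+-identityˡ _) ⟨
      a zero * value B (rel x y) + sum (λ j → a (suc j) * value (E j) (rel x y))
        ≈⟨ dep (rel x y) ⟩
      0# ∎) j
  ... | no a₀≉0 with b , a₀b≈1 ← inverse (a zero) a₀≉0 =
    (λ j → - b * a (suc j)) , λ x y → sym (begin
      sum (λ j → - b * a (suc j) * E j x y)
        ≈⟨ trans (ΣR.cong λ j → *-assoc _ _ _) (ΣR.pullˡ _) ⟩
      - b * sum (λ j → a (suc j) * E j x y)
        ≈⟨ *-congˡ (ΣR.cong λ j → *-congˡ (value-≈ (E-constant j) x y)) ⟩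
      - b * sum (λ j → a (suc j) * value (E j) (rel x y))
        ≈⟨ *-congˡ (+-inverseʳ-unique _ _ (dep (rel x y))) ⟩
      - b * - (a zero * value B (rel x y))
        ≈⟨ trans (sym (-‿distribˡ-* _ _)) (trans (-‿cong (sym (-‿distribʳ-* _ _))) (-‿involutive _)) ⟩
      b * (a zero * value B (rel x y))
        ≈⟨ solve 3 (λ a b v → b :* (a :* v) := a :* b :* v) refl (a zero) b _ ⟩
      a zero * b * value B (rel x y)
        ≈⟨ trans (*-congʳ a₀b≈1) (*-identityˡ _) ⟩
      value B (rel x y)
        ≈⟨ value-≈ B-const x y ⟨
      B x y ∎)

  -- The coefficients of B in the basis E serve as eigenvalues, by orthogonality of the E_j.
  eigenvalues : ∀ {B} → RelConstant B →
    ∃ λ θ → ∀ j → E j *ᵐ B ≈ᵐ λ y z → θ j * E j y z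
  eigenvalues B-const with θ , B≈ ← spanning B-const =
    θ , λ j y z → trans (*ᵐ-cong {E j} (λ _ _ → refl) B≈ y z) (E-*-combination θ j y z)

  eigenvalues-$ᵛ : ∀ {B} → RelConstant B →
    ∃ λ θ → ∀ j v → E j $ᵛ (B $ᵛ v) ≈ᵛ θ j ∙ᵛ (E j $ᵛ v)
  eigenvalues-$ᵛ {B} B-const with θ , EB≈ ← eigenvalues B-const = θ , λ j v y → begin
    (E j $ᵛ (B $ᵛ v)) y               ≈⟨ $ᵛ-*ᵐ (E j) B v y ⟨
    ((E j *ᵐ B) $ᵛ v) y               ≈⟨ $ᵛ-congˡ v (EB≈ j) y ⟩
    sum (λ z → θ j * E j y z * v z)   ≈⟨ trans (ΣX.cong λ z → *-assoc _ _ _) (ΣX.pullˡ _) ⟩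
    θ j * (E j $ᵛ v) y                ∎

  -- The identity matrix is expanded in the E_j. The coefficients stay abstract: recovering `v` from
  -- its components E_j v is all that they serve for.
  resolution : ∃ λ c → ∀ v y → v y ≈ sum (λ j → c j * (E j $ᵛ v) y)
  resolution with c , I≈ ← spanning I-constant = c , λ v y → begin
    v y                                           ≈⟨ I-$ᵛ v y ⟨
    (I $ᵛ v) y                                    ≈⟨ $ᵛ-congˡ v I≈ y ⟩
    sum (λ z → sum (λ j → c j * E j y z) * v z)
      ≈⟨ ΣX.cong (λ z → trans (sym (ΣR.pullʳ (v z))) (ΣR.cong λ j → *-assoc _ _ _)) ⟩
    sum (λ z → sum (λ j → c j * (E j y z * v z)))  ≈⟨ ΣX.swap {d} ⟩
    sum (λ j → sum (λ z → c j * (E j y z * v z)))  ≈⟨ ΣR.cong (λ j → ΣX.pullˡ _) ⟩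
    sum (λ j → c j * (E j $ᵛ v) y)                ∎

  separating : ∀ {v} → (∀ j → E j $ᵛ v ≈ᵛ 0ᵛ) → v ≈ᵛ 0ᵛ
  separating {v} Ev≈0 y with c , v≈ ← resolution =
    trans (v≈ v y) (ΣR.vanishing λ j → trans (*-congˡ (Ev≈0 j y)) (zeroʳ _))

  conj-matrix : Matrix → Matrix
  conj-matrix B y z = conj (B y z)

  -- E and its conjugate C satisfy E C = β E = β̄ C with β = β² ≠ 0.
  E-real : ∀ j y z → conj (E j y z) ≈ E j y z
  E-real j y z with β , EC≈ ← eigenvalues {conj-matrix (E j)} (λ eq → conj-cong (E-constant j eq)) =
    sym (begin
      E j y z              ≈⟨ *-identityˡ _ ⟨
      1# * E j y z         ≈⟨ *-congʳ β≈1 ⟨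
      β j * E j y z        ≈⟨ EC≈ j y z ⟨
      (E j *ᵐ C) y z       ≈⟨ *ᵐ-comm {E j} {C} (E-constant j) C-const y z ⟩
      (C *ᵐ E j) y z       ≈⟨ CE≈ y z ⟩
      conj (β j) * C y z   ≈⟨ *-congʳ (trans (conj-cong β≈1) conj-1) ⟩
      1# * C y z           ≈⟨ *-identityˡ _ ⟩
      C y z                ∎)
    where
    C : Matrix
    C = conj-matrix (E j)
    C-const : RelConstant C
    C-const eq = conj-cong (E-constant j eq)
    CE≈ : ∀ y z → (C *ᵐ E j) y z ≈ conj (β j) * C y z
    CE≈ y z = begin
      sum (λ w → conj (E j y w) * E j w z)
        ≈⟨ ΣX.cong (λ w → trans (conj-* _ _) (*-congˡ (conj-involutive _))) ⟨
      sum (λ w → conj (E j y w * conj (E j w z)))  ≈⟨ ΣX.conj-sum _ ⟨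
      conj ((E j *ᵐ C) y z)                        ≈⟨ conj-cong (EC≈ j y z) ⟩
      conj (β j * E j y z)                         ≈⟨ conj-* _ _ ⟩
      conj (β j) * C y z                           ∎
    C-idempotent : C *ᵐ C ≈ᵐ C
    C-idempotent y z = trans (ΣX.cong λ w → sym (conj-* _ _))
      (trans (sym (ΣX.conj-sum _)) (conj-cong (E-idempotent j y z)))
    β≉0 : ¬ (β j ≈ 0#)
    β≉0 β≈0 = E-nonzero j λ y → anisotropic (E j y) (begin
      sum (λ w → E j y w * conj (E j y w))
        ≈⟨ ΣX.cong (λ w → *-congˡ (conj-cong (symmetric (E-constant j) y w))) ⟩
      (E j *ᵐ C) y y                        ≈⟨ EC≈ j y y ⟩
      β j * E j y y                         ≈⟨ *-congʳ β≈0 ⟩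
      0# * E j y y                          ≈⟨ zeroˡ _ ⟩
      0#                                    ∎)
    β≈1 : β j ≈ 1#
    β≈1 = *-cancelˡ-nonzero β≉0 (trans (scalar-cancel j λ y z → begin
      β j * β j * E j y z          ≈⟨ *-assoc _ _ _ ⟩
      β j * (β j * E j y z)        ≈⟨ *-congˡ (EC≈ j y z) ⟨
      β j * (E j *ᵐ C) y z         ≈⟨ trans (ΣX.cong λ w → *-assoc _ _ _) (ΣX.pullˡ _) ⟨
      ((λ y z → β j * E j y z) *ᵐ C) y z
        ≈⟨ *ᵐ-cong (λ y z → sym (EC≈ j y z)) (λ y z → refl {x = C y z}) y z ⟩
      ((E j *ᵐ C) *ᵐ C) y z        ≈⟨ *ᵐ-assoc (E j) C C y z ⟩
      (E j *ᵐ (C *ᵐ C)) y z        ≈⟨ *ᵐ-cong {E j} (λ _ _ → refl) C-idempotent y z ⟩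
      (E j *ᵐ C) y z               ≈⟨ EC≈ j y z ⟩
      β j * E j y z                ∎) (sym (*-identityʳ _)))

  E-symmetric : ∀ j x y → E j x y ≈ E j y x
  E-symmetric j = symmetric (E-constant j)

  E-self-adjoint : ∀ j u v → ⟨ E j $ᵛ u , v ⟩ ≈ ⟨ u , E j $ᵛ v ⟩
  E-self-adjoint j u v = trans (adjoint (E j) u v) (⟨⟩-cong (λ _ → refl)
    ($ᵛ-congˡ v λ y z → trans (E-real j z y) (E-symmetric j z y)))

  -- The entrywise pairing of two symmetric matrices is the trace of their product.
  trace-orthogonal : ∀ {j k} → j ≢ k → sum (λ x → sum (λ y → E j x y * E k x y)) ≈ 0#
  trace-orthogonal {j} {k} j≢k = ΣX.vanishing λ x →
    trans (ΣX.cong λ y → *-congˡ (E-symmetric k x y)) (E-orthogonal j≢k x x)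

  -- A symmetric idempotent is the Gram matrix of its own columns, so the sum over `y` collapses to
  -- one entry of E_j.
  gram-sum : ∀ j (H : Matrix) →
    sum (λ y → sum (λ w → sum (λ u → E j y w * E j y u * H w u))) ≈
    sum (λ w → sum (λ u → E j w u * H w u))
  gram-sum j H = begin
    sum (λ y → sum (λ w → sum (λ u → E j y w * E j y u * H w u)))
      ≈⟨ ΣX.swap {n} ⟩
    sum (λ w → sum (λ y → sum (λ u → E j y w * E j y u * H w u)))
      ≈⟨ ΣX.cong (λ w → trans (ΣX.swap {n}) (ΣX.cong λ u → ΣX.pullʳ (H w u))) ⟩
    sum (λ w → sum (λ u → sum (λ y → E j y w * E j y u) * H w u))
      ≈⟨ ΣX.cong (λ w → ΣX.cong λ u → *-congʳ
           (trans (ΣX.cong λ y → *-congʳ (E-symmetric j y w)) (E-idempotent j w u))) ⟩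
    sum (λ w → sum (λ u → E j w u * H w u)) ∎

  -- The sum of the squared norms of all the left-hand sides equals the hypothesis.
  krein : ∀ i j k → sum (λ w → sum (λ u → E i w u * (E j w u * E k w u))) ≈ 0# →
          ∀ x y z → sum (λ w → E j y w * (E i x w * E k w z)) ≈ 0#
  krein i j k hyp x y z =
    square-zero (summands-zero (λ z → nonNegative-sq (N x y z))
      (summands-zero (λ y → sum-nonNegative λ z → nonNegative-sq (N x y z))
        (summands-zero (λ x → sum-nonNegative λ y → sum-nonNegative λ z → nonNegative-sq (N x y z))
          total x) y) z)
    where
    N : Fin n → Fin n → Fin n → Carrier
    N x y z = sum (λ w → E j y w * (E i x w * E k w z))
    N-real : ∀ x y z → conj (N x y z) ≈ N x y z
    N-real x y z = trans (ΣX.conj-sum _) (ΣX.cong λ w → trans (conj-* _ _)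
      (*-cong (E-real j y w) (trans (conj-* _ _) (*-cong (E-real i x w) (E-real k w z)))))
    expanded : ∀ x y z → N x y z * conj (N x y z) ≈
      sum (λ w → sum (λ u → E k z w * E k z u * (E j y w * E j y u * (E i x w * E i x u))))
    expanded x y z = begin
      N x y z * conj (N x y z) ≈⟨ *-congˡ (N-real x y z) ⟩
      N x y z * N x y z
        ≈⟨ trans (sym (ΣX.pullʳ _)) (ΣX.cong λ w → sym (ΣX.pullˡ _)) ⟩
      sum (λ w → sum (λ u → E j y w * (E i x w * E k w z) * (E j y u * (E i x u * E k u z))))
        ≈⟨ ΣX.cong (λ w → ΣX.cong λ u → trans
             (*-cong (*-congˡ (*-congˡ (E-symmetric k w z))) (*-congˡ (*-congˡ (E-symmetric k u z))))
             (solve 6 (λ a b c a′ b′ c′ → a :* (b :* c) :* (a′ :* (b′ :* c′)) :=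
                c :* c′ :* (a :* a′ :* (b :* b′))) refl
                (E j y w) (E i x w) (E k z w) (E j y u) (E i x u) (E k z u))) ⟩
      sum (λ w → sum (λ u → E k z w * E k z u * (E j y w * E j y u * (E i x w * E i x u)))) ∎
    total : sum (λ x → sum (λ y → sum (λ z → N x y z * conj (N x y z)))) ≈ 0#
    total = begin
      sum (λ x → sum (λ y → sum (λ z → N x y z * conj (N x y z))))
        ≈⟨ ΣX.cong (λ x → ΣX.cong λ y → trans (ΣX.cong λ z → expanded x y z)
             (trans (gram-sum k _) (ΣX.cong λ w → ΣX.cong λ u →
               solve 3 (λ a b c → a :* (b :* c) := b :* (a :* c)) refl
                 (E k w u) (E j y w * E j y u) (E i x w * E i x u)))) ⟩
      sum (λ x → sum (λ y → sum (λ w → sum (λ u →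
        E j y w * E j y u * (E k w u * (E i x w * E i x u))))))
        ≈⟨ ΣX.cong (λ x → trans (gram-sum j _) (ΣX.cong λ w → ΣX.cong λ u →
             solve 3 (λ a b c → a :* (b :* c) := c :* (a :* b)) refl
               (E j w u) (E k w u) (E i x w * E i x u))) ⟩
      sum (λ x → sum (λ w → sum (λ u → E i x w * E i x u * (E j w u * E k w u))))
        ≈⟨ gram-sum i _ ⟩
      sum (λ w → sum (λ u → E i w u * (E j w u * E k w u)))
        ≈⟨ hyp ⟩
      0# ∎

  -- The primary module M x̂: columns at `x` of Bose-Mesner matrices, equivalently vectors constant
  -- on the spheres around `x`. Carrying the matrix makes closure under products, ordinary and
  -- entrywise, immediate.
  record Radial (x : Fin n) (v : V) : Set where
    field
      matrix   : Matrix
      constant : RelConstant matrix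
      agrees   : ∀ z → v z ≈ matrix z x

    radial : ∀ {y z} → rel x y ≡ rel x z → v y ≈ v z
    radial {y} {z} eq = trans (agrees y) (trans
      (constant (≡.trans (rel-symmetric y x) (≡.trans eq (rel-symmetric x z)))) (sym (agrees z)))

  open Radial using (radial)

  Radial-subspace : ∀ x → IsSubspace (Radial x)
  Radial-subspace x = record
    { resp-≈   = λ u≈v u∈ → let open Radial u∈ in record
        { matrix = matrix ; constant = constant ; agrees = λ z → trans (sym (u≈v z)) (agrees z) }
    ; 0-closed = record { matrix = 0ᵐ ; constant = λ _ → refl ; agrees = λ _ → refl }
    ; +-closed = sum-closed
    ; ∙-closed = λ c v∈ → let open Radial v∈ in record
        { matrix = λ y z → c * matrix y z
        ; constant = λ eq → *-congˡ (constant eq)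
        ; agrees = λ z → *-congˡ (agrees z) }
    }
    where
    sum-closed : ∀ {u v} → Radial x u → Radial x v → Radial x (u +ᵛ v)
    sum-closed u∈ v∈ = record
      { matrix   = λ y z → Radial.matrix u∈ y z + Radial.matrix v∈ y z
      ; constant = λ eq → +-cong (Radial.constant u∈ eq) (Radial.constant v∈ eq)
      ; agrees   = λ z → +-cong (Radial.agrees u∈ z) (Radial.agrees v∈ z)
      }

  Radial-$ᵛ : ∀ {x B v} → RelConstant B → Radial x v → Radial x (B $ᵛ v)
  Radial-$ᵛ {x} {B} B-const v∈ = record
    { matrix   = B *ᵐ matrix
    ; constant = *ᵐ-constant {B} {matrix} B-const constant
    ; agrees   = λ z → ΣX.cong λ w → *-congˡ (agrees w)
    }
    where open Radial v∈

  Radial-⊙ : ∀ {x B v} → RelConstant B → Radial x v → Radial x (B x ⊙ v)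
  Radial-⊙ {x} {B} B-const v∈ = record
    { matrix   = λ y z → B y z * matrix y z
    ; constant = λ eq → *-cong (B-const eq) (constant eq)
    ; agrees   = λ z → *-cong (symmetric {B} B-const x z) (agrees z)
    }
    where open Radial v∈

  Radial-column : ∀ {B} x c → RelConstant B → Radial x (λ y → c * B y x)
  Radial-column {B} x c B-const = record
    { matrix = λ y z → c * B y z ; constant = λ eq → *-congˡ (B-const eq) ; agrees = λ _ → refl }

  -- The diagonal of E_j is constant, and each diagonal entry is the squared norm of its row.
  E-diagonal : ∀ j x → ¬ (E j x x ≈ 0#)
  E-diagonal j x Exx≈0 = E-nonzero j λ y → anisotropic (E j y) (begin
    sum (λ w → E j y w * conj (E j y w))
      ≈⟨ ΣX.cong (λ w → *-congˡ (trans (E-real j y w) (E-symmetric j y w))) ⟩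
    (E j *ᵐ E j) y y  ≈⟨ E-idempotent j y y ⟩
    E j y y           ≈⟨ E-constant j (≡.trans (rel-diagonal y) (≡.sym (rel-diagonal x))) ⟩
    E j x x           ≈⟨ Exx≈0 ⟩
    0#                ∎)

  $ᵛ-unit : ∀ B x y → (B $ᵛ I x) y ≈ B y x
  $ᵛ-unit B x y = trans
    (ΣX.single x λ z z≢x → trans (*-congˡ (⟦⟧-no (x ≟ z) (z≢x ∘ ≡.sym))) (zeroʳ _))
    (trans (*-congˡ (⟦⟧-yes (x ≟ x) ≡.refl)) (*-identityʳ _))

  -- ψ is k times the component of χ restricted to the sphere of y₀ around x
  -- that is orthogonal to the radial vectors.
  module SphereComponent (x y₀ : Fin n) (χ : V) where

    sphere shell ψ : V
    sphere = A (rel x y₀) x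
    shell  = sphere ⊙ χ

    k s : Carrier
    k = sum sphere
    s = sum shell

    ψ y = k * shell y + - s * sphere y

    ψ-support : ∀ y → rel x y ≢ rel x y₀ → ψ y ≈ 0#
    ψ-support y y∉ = trans (+-cong
      (trans (*-congˡ (trans (*-congʳ a≈0) (zeroˡ _))) (zeroʳ _))
      (trans (*-congˡ a≈0) (zeroʳ _))) (+-identityˡ _)
      where
      a≈0 : sphere y ≈ 0#
      a≈0 = ⟦⟧-no (rel x y ≟ rel x y₀) y∉

    sum-ψ : sum ψ ≈ 0#
    sum-ψ = begin
      sum ψ                  ≈⟨ trans ΣX.split (+-cong (ΣX.pullˡ k) (ΣX.pullˡ (- s))) ⟩
      k * s + - s * k        ≈⟨ +-cong (*-comm k s) (sym (-‿distribˡ-* s k)) ⟩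
      s * k + - (s * k)      ≈⟨ -‿inverseʳ _ ⟩
      0#                     ∎

    -- Radial vectors are constant on the sphere that supports ψ, and ψ sums to zero there.
    ψ-⊥-radial : ∀ {v} → Radial x v → ⟨ ψ , v ⟩ ≈ 0#
    ψ-⊥-radial {v} v∈ = begin
      sum (λ y → ψ y * conj (v y))   ≈⟨ ΣX.cong (λ y → term y (rel x y ≟ rel x y₀)) ⟩
      sum (λ y → ψ y * conj (v y₀))  ≈⟨ ΣX.pullʳ _ ⟩
      sum ψ * conj (v y₀)            ≈⟨ trans (*-congʳ sum-ψ) (zeroˡ _) ⟩
      0#                             ∎
      where
      term : ∀ y → Dec (rel x y ≡ rel x y₀) → ψ y * conj (v y) ≈ ψ y * conj (v y₀)
      term y (yes eq) = *-congˡ (conj-cong (radial v∈ eq))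
      term y (no ≢)   = trans (trans (*-congʳ (ψ-support y ≢)) (zeroˡ _))
                          (sym (trans (*-congʳ (ψ-support y ≢)) (zeroˡ _)))

    -- Under this hypothesis E_j ψ is itself radial, so ⟨E_j ψ , E_j ψ⟩ = ⟨ψ , E_j E_j ψ⟩ pairs ψ
    -- with a radial vector.
    Eψ-zero : ∀ j c → (∀ y → (E j $ᵛ ψ) y ≈ c * E j y x) → E j $ᵛ ψ ≈ᵛ 0ᵛ
    Eψ-zero j c Eψ≈ = ⟨⟩-definite (E j $ᵛ ψ) (trans (E-self-adjoint j ψ (E j $ᵛ ψ))
      (ψ-⊥-radial (Radial-$ᵛ {B = E j} (E-constant j)
        (IsSubspace.resp-≈ (Radial-subspace x) (λ y → sym (Eψ≈ y)) (Radial-column x c (E-constant j))))))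

    Eψ-zero-constant : ∀ j → (∀ y z → E j y z ≈ E j y y) → E j $ᵛ ψ ≈ᵛ 0ᵛ
    Eψ-zero-constant j E≈ y = trans (ΣX.cong λ z → *-congʳ (E≈ y z))
      (trans (ΣX.pullˡ _) (trans (*-congˡ sum-ψ) (zeroʳ _)))

    -- The entry of `E j $ᵛ I x` at `x` is `E j x x`, which is nonzero; so `α` cannot vanish and
    -- `E j $ᵛ shell` is a multiple of the column of E_j at `x`. So is `E j $ᵛ sphere`, because E_j
    -- A_i = θ_j E_j, and `Eψ-zero` applies to the combination ψ.
    Eψ-zero-dependent : ∀ j α β → ¬ (α ≈ 0# × β ≈ 0#) →
      (α ∙ᵛ (E j $ᵛ shell)) +ᵛ (β ∙ᵛ (E j $ᵛ I x)) ≈ᵛ 0ᵛ → E j $ᵛ ψ ≈ᵛ 0ᵛ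
    Eψ-zero-dependent j α β nontrivial dep =
      Eψ-zero j (α⁻¹ * (k * - β + - s * (α * θ j))) λ y → begin
        (E j $ᵛ ψ) y
          ≈⟨ trans ($ᵛ-+ (E j) (k ∙ᵛ shell) ((- s) ∙ᵛ sphere) y)
               (+-cong ($ᵛ-∙ (E j) k shell y) ($ᵛ-∙ (E j) (- s) sphere y)) ⟩
        k * (E j $ᵛ shell) y + - s * (E j $ᵛ sphere) y
          ≈⟨ +-congˡ (*-congˡ (trans (ΣX.cong λ z → *-congˡ (symmetric (A-constant (rel x y₀)) x z)) (EA≈ j y x))) ⟩
        k * (E j $ᵛ shell) y + - s * (θ j * E j y x)
          ≈⟨ trans (*-congʳ (trans (*-comm _ _) αα⁻¹≈1)) (*-identityˡ _) ⟨
        α⁻¹ * α * (k * (E j $ᵛ shell) y + - s * (θ j * E j y x))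
          ≈⟨ solve 7 (λ i a k S m t e → i :* a :* (k :* S :+ m :* (t :* e)) :=
               i :* (k :* (a :* S) :+ m :* (a :* t) :* e)) refl α⁻¹ α k ((E j $ᵛ shell) y) (- s) (θ j) (E j y x) ⟩
        α⁻¹ * (k * (α * (E j $ᵛ shell) y) + - s * (α * θ j) * E j y x)
          ≈⟨ *-congˡ (+-congʳ (*-congˡ (S≈ y))) ⟩
        α⁻¹ * (k * (- β * E j y x) + - s * (α * θ j) * E j y x)
          ≈⟨ solve 5 (λ i k b m e → i :* (k :* (b :* e) :+ m :* e) := i :* (k :* b :+ m) :* e) refl
               α⁻¹ k (- β) (- s * (α * θ j)) (E j y x) ⟩
        α⁻¹ * (k * - β + - s * (α * θ j)) * E j y x ∎
      where
      α≉0 : ¬ (α ≈ 0#)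
      α≉0 α≈0 = nontrivial (α≈0 , β≈0)
        where
        β≈0 : β ≈ 0#
        β≈0 = zero-product (E-diagonal j x) (begin
          E j x x * β                                           ≈⟨ *-comm _ _ ⟩
          β * E j x x                                           ≈⟨ *-congˡ ($ᵛ-unit (E j) x x) ⟨
          β * (E j $ᵛ I x) x                                    ≈⟨ +-identityˡ _ ⟨
          0# + β * (E j $ᵛ I x) x
            ≈⟨ +-congʳ (trans (*-congʳ α≈0) (zeroˡ _)) ⟨
          α * (E j $ᵛ shell) x + β * (E j $ᵛ I x) x             ≈⟨ dep x ⟩
          0#                                                    ∎)
      α⁻¹ : Carrier
      α⁻¹ = proj₁ (inverse α α≉0)
      αα⁻¹≈1 : α * α⁻¹ ≈ 1#
      αα⁻¹≈1 = proj₂ (inverse α α≉0)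
      spectrum : ∃ λ θ → ∀ j → E j *ᵐ A (rel x y₀) ≈ᵐ λ y z → θ j * E j y z
      spectrum = eigenvalues {A (rel x y₀)} (A-constant _)
      θ : Fin d → Carrier
      θ = proj₁ spectrum
      EA≈ : ∀ j → E j *ᵐ A (rel x y₀) ≈ᵐ λ y z → θ j * E j y z
      EA≈ = proj₂ spectrum
      S≈ : ∀ y → α * (E j $ᵛ shell) y ≈ - β * E j y x
      S≈ y = trans (+-inverseʳ-unique _ _ (trans (+-comm _ _) (dep y)))
        (trans (-‿cong (*-congˡ ($ᵛ-unit (E j) x y))) (-‿distribˡ-* _ _))

    -- Vanishing of ψ reads k χ = s on the whole sphere, and the sphere size k is nonzero because
    -- `y₀` lies on it.
    all-or-none : ψ ≈ᵛ 0ᵛ → ∀ {y z} → rel x y ≡ rel x y₀ → rel x z ≡ rel x y₀ → χ y ≈ χ z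
    all-or-none ψ≈0 {y} {z} xy xz = *-cancelˡ-nonzero k≉0 (trans (level y xy) (sym (level z xz)))
      where
      k≉0 : ¬ (k ≈ 0#)
      k≉0 k≈0 = 1≉0 (trans (sym (⟦⟧-yes (rel x y₀ ≟ rel x y₀) ≡.refl))
        (sum-zero-one (A-zero-one (rel x y₀) x) k≈0 y₀))
      level : ∀ y → rel x y ≡ rel x y₀ → k * χ y ≈ s
      level y xy = begin
        k * χ y                                ≈⟨ *-congˡ (trans (*-congʳ a≈1) (*-identityˡ _)) ⟨
        k * shell y                            ≈⟨ +-inverseʳ-unique _ _ (trans (+-comm _ _) (ψ≈0 y)) ⟩
        - (- s * sphere y)                     ≈⟨ -‿cong (trans (*-congˡ a≈1) (*-identityʳ _)) ⟩
        - - s                                  ≈⟨ -‿involutive s ⟩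
        s                                      ∎
        where
        a≈1 : sphere y ≈ 1#
        a≈1 = ⟦⟧-yes (rel x y ≟ rel x y₀) xy

  -- The cometric property: Krein parameters, dual tridiagonality, antipodal classes.

  module CometricTheory (ι : Fin d)
    (cometric : ∀ j → ∃ λ (c : Fin (suc (toℕ j)) → Carrier) → ¬ (c (fromℕ (toℕ j)) ≈ 0#) ×
                (∀ x y → E j x y ≈ sum (λ l → c l * (E ι x y ^ toℕ l))))
    where

    moment : ℕ → Fin d → Carrier
    moment m j = sum λ x → sum λ y → (E ι x y ^ m) * E j x y

    weighted-sum : ∀ m (c : Fin m → Carrier) (g : Fin m → Matrix) (h : Matrix) →
      sum (λ x → sum (λ y → sum (λ l → c l * g l x y) * h x y)) ≈
      sum (λ l → c l * sum (λ x → sum (λ y → g l x y * h x y)))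
    weighted-sum m c g h = begin
      sum (λ x → sum (λ y → sum (λ l → c l * g l x y) * h x y))
        ≈⟨ ΣX.cong (λ x → trans (ΣX.cong λ y →
             trans (sym (SumOver.pullʳ m _)) (SumOver.cong m λ l → *-assoc _ _ _)) (ΣX.swap {m})) ⟩
      sum (λ x → sum (λ l → sum (λ y → c l * (g l x y * h x y))))
        ≈⟨ ΣX.swap {m} ⟩
      sum (λ l → sum (λ x → sum (λ y → c l * (g l x y * h x y))))
        ≈⟨ SumOver.cong m (λ l → trans (ΣX.cong λ x → ΣX.pullˡ _) (ΣX.pullˡ _)) ⟩
      sum (λ l → c l * sum (λ x → sum (λ y → g l x y * h x y))) ∎

    -- Strong induction on the exponent: E_k is a polynomial in E_1 with nonzero coefficient at
    -- degree k, its pairing with E_j vanishes, and the lower powers contribute zero already. `at`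
    -- turns an exponent below `toℕ j` into an index to which `cometric` can be applied.
    moment-zero : ∀ m j → m ℕ.< toℕ j → moment m j ≈ 0#
    moment-zero m j m<j = at m m<j (go (suc m))
      where
      at : ∀ m → m ℕ.< toℕ j → (∀ (k : Fin d) → toℕ k ℕ.< suc m → toℕ k ℕ.< toℕ j → moment (toℕ k) j ≈ 0#) →
           moment m j ≈ 0#
      at m m<j below = ≡.subst (λ e → moment e j ≈ 0#) k≡m
        (below (fromℕ< m<d) (ℕ.s≤s (ℕₚ.≤-reflexive k≡m)) (≡.subst (ℕ._< toℕ j) (≡.sym k≡m) m<j))
        where
        m<d : m ℕ.< d
        m<d = ℕₚ.<-trans m<j (Finₚ.toℕ<n j)
        k≡m : toℕ (fromℕ< m<d) ≡ m
        k≡m = Finₚ.toℕ-fromℕ< m<d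
      go : ∀ N (k : Fin d) → toℕ k ℕ.< N → toℕ k ℕ.< toℕ j → moment (toℕ k) j ≈ 0#
      go (suc N) k (ℕ.s≤s k≤N) k<j = main
        where
        main : moment (toℕ k) j ≈ 0#
        main with c , top≉0 , E≈ ← cometric k = zero-product top≉0 (begin
          c top * moment (toℕ k) j
            ≡⟨ ≡.cong (λ e → c top * moment e j) (Finₚ.toℕ-fromℕ (toℕ k)) ⟨
          c top * moment (toℕ top) j
            ≈⟨ SumOver.single (suc (toℕ k)) {λ l → c l * moment (toℕ l) j} top lower ⟨
          sum (λ l → c l * moment (toℕ l) j)
            ≈⟨ weighted-sum (suc (toℕ k)) c (λ l x y → E ι x y ^ toℕ l) (E j) ⟨
          sum (λ x → sum (λ y → sum (λ l → c l * (E ι x y ^ toℕ l)) * E j x y))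
            ≈⟨ ΣX.cong (λ x → ΣX.cong λ y → *-congʳ (sym (E≈ x y))) ⟩
          sum (λ x → sum (λ y → E k x y * E j x y))
            ≈⟨ trace-orthogonal (λ k≡j → ℕₚ.<⇒≢ k<j (≡.cong toℕ k≡j)) ⟩
          0# ∎)
          where
          top : Fin (suc (toℕ k))
          top = fromℕ (toℕ k)
          lower : ∀ l → l ≢ top → c l * moment (toℕ l) j ≈ 0#
          lower l l≢top = trans (*-congˡ (at (toℕ l) (ℕₚ.<-trans l<k k<j)
            λ i i≤l → go N i (ℕₚ.≤-<-trans (ℕₚ.≤-pred i≤l) (ℕₚ.<-≤-trans l<k k≤N)))) (zeroʳ _)
            where
            l<k : toℕ l ℕ.< toℕ k
            l<k = ℕₚ.≤∧≢⇒< (ℕₚ.≤-pred (Finₚ.toℕ<n l))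
              (λ eq → l≢top (Finₚ.toℕ-injective (≡.trans eq (≡.sym (Finₚ.toℕ-fromℕ (toℕ k))))))

    -- The entrywise product of E_1 and E_k is a polynomial in E_1 of degree at most k + 1 < j, so
    -- E_j is orthogonal to it: the Krein parameter of 1, k, j vanishes.
    krein-zero : ∀ j k → suc (toℕ k) ℕ.< toℕ j →
      sum (λ w → sum (λ u → E ι w u * (E j w u * E k w u))) ≈ 0#
    krein-zero j k k<j with c , _ , E≈ ← cometric k = begin
      sum (λ w → sum (λ u → E ι w u * (E j w u * E k w u)))
        ≈⟨ ΣX.cong (λ w → ΣX.cong λ u → trans
             (solve 3 (λ a b c → a :* (b :* c) := c :* (a :* b)) refl (E ι w u) (E j w u) (E k w u))
             (*-congʳ (E≈ w u))) ⟩
      sum (λ w → sum (λ u → sum (λ l → c l * (E ι w u ^ toℕ l)) * (E ι w u * E j w u)))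
        ≈⟨ weighted-sum (suc (toℕ k)) c (λ l x y → E ι x y ^ toℕ l) (λ w u → E ι w u * E j w u) ⟩
      sum (λ l → c l * sum (λ w → sum (λ u → (E ι w u ^ toℕ l) * (E ι w u * E j w u))))
        ≈⟨ SumOver.vanishing (suc (toℕ k)) {λ l → c l * _} (λ l → trans (*-congˡ (trans
             (ΣX.cong λ w → ΣX.cong λ u → solve 3 (λ a b c → a :* (b :* c) := b :* a :* c) refl
               (E ι w u ^ toℕ l) (E ι w u) (E j w u))
             (moment-zero (suc (toℕ l)) j (ℕₚ.≤-<-trans (Finₚ.toℕ<n l) k<j)))) (zeroʳ _)) ⟩
      0# ∎

    -- The entries of E_j A*_1 E_k are, up to scale, the sums that `krein` annihilates. Only the
    -- bound on raising is stated; it is the one that the filtration by the E_l requires.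
    dual-tridiagonal : ∀ x j k → suc (toℕ k) ℕ.< toℕ j →
      ∀ v → E j $ᵛ (E ι x ⊙ (E k $ᵛ v)) ≈ᵛ 0ᵛ
    dual-tridiagonal x j k k<j v y = begin
      sum (λ w → E j y w * (E ι x w * sum (λ z → E k w z * v z)))
        ≈⟨ ΣX.cong (λ w → trans (sym (*-assoc _ _ _)) (trans (sym (ΣX.pullˡ _)) (ΣX.cong λ z →
             solve 4 (λ a b c d → a :* b :* (c :* d) := a :* (b :* c) :* d) refl
               (E j y w) (E ι x w) (E k w z) (v z)))) ⟩
      sum (λ w → sum (λ z → E j y w * (E ι x w * E k w z) * v z))
        ≈⟨ ΣX.swap {n} ⟩
      sum (λ z → sum (λ w → E j y w * (E ι x w * E k w z) * v z))
        ≈⟨ ΣX.vanishing (λ z → trans (ΣX.pullʳ (v z)) (trans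
             (*-congʳ (krein ι j k (krein-zero j k k<j) x y z)) (zeroˡ _))) ⟩
      0# ∎

    -- Each E_j is a polynomial in E_1, so an equal entry of E_1 makes all the E_j agree, hence also
    -- the A_i, which they span.
    ι-injective : ∀ {x y x′ y′} → E ι x y ≈ E ι x′ y′ → rel x y ≡ rel x′ y′
    ι-injective {x} {y} {x′} {y′} eq with rel x′ y′ ≟ rel x y | spanning (A-constant (rel x y))
    ... | yes same | _ = ≡.sym same
    ... | no ≢     | c , A≈ = contradiction (begin
      1#                                   ≈⟨ ⟦⟧-yes (rel x y ≟ rel x y) ≡.refl ⟨
      A (rel x y) x y                      ≈⟨ A≈ x y ⟩
      sum (λ j → c j * E j x y)            ≈⟨ ΣR.cong (λ j → *-congˡ (E-equal j (cometric j))) ⟩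
      sum (λ j → c j * E j x′ y′)          ≈⟨ A≈ x′ y′ ⟨
      A (rel x y) x′ y′                    ≈⟨ ⟦⟧-no (rel x′ y′ ≟ rel x y) ≢ ⟩
      0#                                   ∎) 1≉0
      where
      ^-congˡ : ∀ m {a b} → a ≈ b → a ^ m ≈ b ^ m
      ^-congˡ zero    a≈b = refl
      ^-congˡ (suc m) a≈b = *-cong a≈b (^-congˡ m a≈b)
      E-equal : ∀ j → (∃ λ (c : Fin (suc (toℕ j)) → Carrier) → ¬ (c (fromℕ (toℕ j)) ≈ 0#) ×
                (∀ x y → E j x y ≈ sum (λ l → c l * (E ι x y ^ toℕ l)))) → E j x y ≈ E j x′ y′
      E-equal j (c , _ , E≈) = trans (E≈ x y)
        (trans (SumOver.cong (suc (toℕ j)) λ l → *-congˡ {c l} (^-congˡ (toℕ l) eq)) (sym (E≈ x′ y′)))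

    -- On the classes of an antipodal relation every E j is either constant or
    -- sums to zero; comparing E ι with the quadratic polynomial E two in it
    -- leaves no room for classes of size at least three.
    module AntipodalClasses (top far one two : Fin d) (toℕ-two : toℕ two ≡ 2)
      (o≢one : o ≢ one) (o≢top : o ≢ top) (one≢far : one ≢ far)
      (transitive : ∀ {x y z} → rel x y ≡ top → rel x z ≡ top → y ≡ z ⊎ rel y z ≡ top)
      (opposite : ∀ {x y w} → rel x y ≡ top → rel x w ≡ one → rel w y ≡ far)
      {x y w w′ : Fin n} (xy : rel x y ≡ top) (xw : rel x w ≡ one) (xw′ : rel x w′ ≡ one) (w≢w′ : w ≢ w′)
      (m : ℕ) (valency : sum (A top x) ≈ (2 ℕ.+ m) ·ℕ 1#)
      where

      -- The block matrix of the antipodal equivalence; columns of equivalent points coincide.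
      classSum : Matrix
      classSum y z = I y z + A top y z

      classSum-constant : RelConstant classSum
      classSum-constant eq = +-cong (I-constant eq) (A-constant top eq)

      *-classSum : ∀ j u v → (E j *ᵐ classSum) u v ≈ E j u v + sum (λ z → E j u z * A top z v)
      *-classSum j u v = begin
        sum (λ z → E j u z * (I z v + A top z v))
          ≈⟨ trans (ΣX.cong λ z → distribˡ _ _ _) ΣX.split ⟩
        sum (λ z → E j u z * I z v) + sum (λ z → E j u z * A top z v)
          ≈⟨ +-congʳ (trans (ΣX.cong λ z → *-congˡ (symmetric I-constant z v)) ($ᵛ-unit (E j) v u)) ⟩
        E j u v + sum (λ z → E j u z * A top z v) ∎

      classSum-shift : ∀ j u → (E j *ᵐ classSum) u x ≈ (E j *ᵐ classSum) u y
      classSum-shift j u = ΣX.cong λ z → *-congˡ (same z (z ≟ x) (rel z x ≟ top) (z ≟ y) (rel z y ≟ top))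
        where
        yx : rel y x ≡ top
        yx = ≡.trans (rel-symmetric y x) xy
        top≢o : ∀ {z} → rel z z ≢ top
        top≢o eq = o≢top (≡.trans (≡.sym (rel-diagonal _)) eq)
        same : ∀ z (p : Dec (z ≡ x)) (q : Dec (rel z x ≡ top)) (p′ : Dec (z ≡ y)) (q′ : Dec (rel z y ≡ top)) →
               ⟦ p ⟧ + ⟦ q ⟧ ≈ ⟦ p′ ⟧ + ⟦ q′ ⟧
        same z (yes ≡.refl) (yes q) _ _ = contradiction q top≢o
        same z _ _ (yes ≡.refl) (yes q) = contradiction q top≢o
        same z (yes ≡.refl) (no _) (yes ≡.refl) (no _) = refl
        same z (yes ≡.refl) (no _) (no _) (yes _) = +-comm _ _
        same z (yes ≡.refl) (no _) (no _) (no ¬q) = contradiction xy ¬q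
        same z (no _) (yes _) (yes _) (no _) = +-comm _ _
        same z (no _) (yes _) (no _) (yes _) = refl
        same z (no _) (yes zx) (no z≢y) (no ¬zy)
          with transitive (≡.trans (rel-symmetric x z) zx) xy
        ... | inj₁ z≡y = contradiction z≡y z≢y
        ... | inj₂ zy  = contradiction zy ¬zy
        same z (no _) (no ¬q) (yes ≡.refl) (no _) = contradiction yx ¬q
        same z (no z≢x) (no ¬zx) (no _) (yes zy)
          with transitive (≡.trans (rel-symmetric y z) zy) yx
        ... | inj₁ z≡x = contradiction z≡x z≢x
        ... | inj₂ zx  = contradiction zx ¬zx
        same z (no _) (no _) (no _) (no _) = refl

      κ : Carrier
      κ = (2 ℕ.+ m) ·ℕ 1#

      sphere-sum : ∀ j u {i} → (∀ z → rel x z ≡ top → rel u z ≡ i) → rel u y ≡ i →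
        sum (λ z → E j u z * A top z x) ≈ κ * E j u y
      sphere-sum j u {i} all-i uy = begin
        sum (λ z → E j u z * A top z x)
          ≈⟨ ΣX.cong (λ z → trans (*-congˡ (symmetric (A-constant top) z x)) (term z (rel x z ≟ top))) ⟩
        sum (λ z → E j u y * A top x z)
          ≈⟨ trans (ΣX.pullˡ _) (trans (*-congˡ valency) (*-comm _ _)) ⟩
        κ * E j u y ∎
        where
        term : ∀ z (d : Dec (rel x z ≡ top)) → E j u z * ⟦ d ⟧ ≈ E j u y * ⟦ d ⟧
        term z (yes xz) = *-congʳ (E-constant j (≡.trans (all-i z xz) (≡.sym uy)))
        term z (no _)   = trans (zeroʳ _) (sym (zeroʳ _))

      -- The class of `x` consists of `x` and κ antipodes. It is seen once from `x` and once from
      -- the neighbour `w`, from which `x` is in relation `one` and every antipode in relation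
      -- `far`.
      ZeroSum ClassConstant : Fin d → Set
      ZeroSum j = E j x x + κ * E j x y ≈ 0# × E j w x + κ * E j w y ≈ 0#
      ClassConstant j = E j x x ≈ E j x y × E j w x ≈ E j w y

      -- E_j times the class matrix is λ E_j. If λ = 0, row sums over the class vanish; otherwise
      -- E_j inherits the equality of the columns at `x` and `y`.
      dichotomy : ∀ j → ZeroSum j ⊎ ClassConstant j
      dichotomy j with eigenvalues classSum-constant
      ... | λs , E≈ with em {P = λs j ≈ 0#}
      ...   | yes λ≈0 = inj₁
        ( zero-sum x (λ z xz → xz) xy
        , zero-sum w (λ z xz → opposite xz xw) (opposite xy xw) )
        where
        zero-sum : ∀ u {i} → (∀ z → rel x z ≡ top → rel u z ≡ i) → rel u y ≡ i → E j u x + κ * E j u y ≈ 0#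
        zero-sum u all-i uy = begin
          E j u x + κ * E j u y            ≈⟨ +-congˡ (sphere-sum j u all-i uy) ⟨
          E j u x + sum (λ z → E j u z * A top z x)  ≈⟨ *-classSum j u x ⟨
          (E j *ᵐ classSum) u x            ≈⟨ E≈ j u x ⟩
          λs j * E j u x                   ≈⟨ trans (*-congʳ λ≈0) (zeroˡ _) ⟩
          0#                               ∎
      ...   | no λ≉0 = inj₂ (constant x , constant w)
        where
        constant : ∀ u → E j u x ≈ E j u y
        constant u = *-cancelˡ-nonzero λ≉0
          (trans (sym (E≈ j u x)) (trans (classSum-shift j u) (E≈ j u y)))

      -- Values of E_1 on the diagonal and on the relations `one`, `top` and `far`; the application
      -- takes distances 0, 1, D and D - 1.
      e₀ e₁ eₜ e₋ : Carrier
      e₀ = E ι x x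
      e₁ = E ι w x
      eₜ = E ι x y
      e₋ = E ι w y

      wx : rel w x ≡ one
      wx = ≡.trans (rel-symmetric w x) xw

      e₀≉eₜ : ¬ (e₀ ≈ eₜ)
      e₀≉eₜ eq = o≢top (≡.trans (≡.sym (rel-diagonal x)) (≡.trans (ι-injective eq) xy))

      e₀≉e₁ : ¬ (e₀ ≈ e₁)
      e₀≉e₁ eq = o≢one (≡.trans (≡.sym (rel-diagonal x)) (≡.trans (ι-injective eq) wx))

      e₁≉e₋ : ¬ (e₁ ≈ e₋)
      e₁≉e₋ eq = one≢far (≡.trans (≡.sym wx) (≡.trans (ι-injective eq) (opposite xy xw)))

      ι-zero-sum : ZeroSum ι
      ι-zero-sum with dichotomy ι
      ... | inj₁ zs = zs
      ... | inj₂ (e₀≈eₜ , _) = contradiction e₀≈eₜ e₀≉eₜ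

      difference-of-squares : ∀ {b c a a′} → b * a + c * (a * a) ≈ b * a′ + c * (a′ * a′) → ¬ (a ≈ a′) →
        b + c * (a + a′) ≈ 0#
      difference-of-squares {b} {c} {a} {a′} eq a≉a′ = zero-product a-a′≉0 (begin
        (a + - a′) * (b + c * (a + a′))
          -- The solver handles semirings, so - a′ enters as the indeterminate m, and a′ + m is
          -- cancelled by hand.
          ≈⟨ solve 5 (λ a a′ m b c → (a :+ m) :* (b :+ c :* (a :+ a′)) :=
               (b :* a :+ c :* (a :* a)) :+ (m :* (b :+ c :* a′) :+ (a′ :+ m) :* (c :* a))) refl a a′ (- a′) b c ⟩
        (b * a + c * (a * a)) + (- a′ * (b + c * a′) + (a′ + - a′) * (c * a))
          ≈⟨ +-cong eq (+-congˡ (trans (*-congʳ (-‿inverseʳ a′)) (zeroˡ _))) ⟩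
        (b * a′ + c * (a′ * a′)) + (- a′ * (b + c * a′) + 0#)
          ≈⟨ solve 4 (λ a′ m b c → (b :* a′ :+ c :* (a′ :* a′)) :+ (m :* (b :+ c :* a′) :+ con 0) :=
               (a′ :+ m) :* (b :+ c :* a′)) refl a′ (- a′) b c ⟩
        (a′ + - a′) * (b + c * a′)
          ≈⟨ trans (*-congʳ (-‿inverseʳ a′)) (zeroˡ _) ⟩
        0# ∎)
        where
        a-a′≉0 : ¬ (a + - a′ ≈ 0#)
        a-a′≉0 eq = a≉a′ (+-cancelʳ (- a′) a a′ (trans eq (sym (-‿inverseʳ a′))))

      Quadratic : Set
      Quadratic = ∃ λ c₀ → ∃ λ c₁ → ∃ λ c₂ → ¬ (c₂ ≈ 0#) ×
        (∀ u v → E two u v ≈ c₀ + (c₁ * E ι u v + c₂ * (E ι u v * E ι u v)))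

      quadratic : Quadratic
      quadratic = extract (toℕ two) toℕ-two (cometric two)
        where
        extract : ∀ k → k ≡ 2 → (∃ λ (c : Fin (suc k) → Carrier) → ¬ (c (fromℕ k) ≈ 0#) ×
                    (∀ u v → E two u v ≈ sum (λ l → c l * (E ι u v ^ toℕ l)))) → Quadratic
        extract _ ≡.refl (c , c₂≉0 , E≈) = c zero , c (suc zero) , c (suc (suc zero)) , c₂≉0 , λ u v →
          trans (E≈ u v) (solve 4 (λ a b c e →
            a :* con 1 :+ (b :* (e :* con 1) :+ (c :* (e :* (e :* con 1)) :+ con 0)) := a :+ (b :* e :+ c :* (e :* e)))
            refl (c zero) (c (suc zero)) (c (suc (suc zero))) (E ι u v))

      -- The quadratic would take equal values at e₀, eₜ and at e₁, e₋, so both pairs have the same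
      -- sum. By the zero-sum relations of E_1, κ times these sums are (κ - 1) e₀ and (κ - 1) e₁; as
      -- κ - 1 is `suc m`, nonzero, e₀ = e₁ follows.
      no-class-constant : ¬ ClassConstant two
      no-class-constant (at-x , at-w) with quadratic
      ... | c₀ , c₁ , c₂ , c₂≉0 , E≈ = e₀≉e₁
        (*-cancelˡ-nonzero (·ℕ-nonzero (suc m)) (trans (sym (multiple (proj₁ ι-zero-sum)))
          (trans (*-congˡ sums) (multiple (proj₂ ι-zero-sum)))))
        where
        vanishing : ∀ {u v u′ v′} → E two u v ≈ E two u′ v′ → ¬ (E ι u v ≈ E ι u′ v′) →
                    c₁ + c₂ * (E ι u v + E ι u′ v′) ≈ 0#
        vanishing eq = difference-of-squares
          (+-cancelˡ c₀ _ _ (trans (sym (E≈ _ _)) (trans eq (E≈ _ _))))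
        sums : e₀ + eₜ ≈ e₁ + e₋
        sums = *-cancelˡ-nonzero c₂≉0 (+-cancelˡ c₁ _ _
          (trans (vanishing at-x e₀≉eₜ) (sym (vanishing at-w e₁≉e₋))))
        multiple : ∀ {a b} → a + κ * b ≈ 0# → κ * (a + b) ≈ (suc m ·ℕ 1#) * a
        multiple {a} {b} eq = begin
          κ * (a + b)
            ≈⟨ solve 3 (λ k a b → (con 1 :+ k) :* (a :+ b) := k :* a :+ (a :+ (con 1 :+ k) :* b)) refl (suc m ·ℕ 1#) a b ⟩
          (suc m ·ℕ 1#) * a + (a + κ * b)
            ≈⟨ trans (+-congˡ eq) (+-identityʳ _) ⟩
          (suc m ·ℕ 1#) * a ∎

      -- Summing the quadratic over the class removes its linear term, so a² + κ b² is the same for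
      -- the pairs e₀, eₜ and e₁, e₋. Since κ b = - a, κ times it equals (κ + 1) a²; hence e₀² =
      -- e₁², while e₀ and e₁ differ.
      e₀+e₁≈0 : ZeroSum two → e₀ + e₁ ≈ 0#
      e₀+e₁≈0 (at-x , at-w) with quadratic
      ... | c₀ , c₁ , c₂ , c₂≉0 , E≈ = begin
        e₀ + e₁                  ≈⟨ solve 2 (λ a b → a :+ b := con 0 :+ con 1 :* (a :+ b)) refl e₀ e₁ ⟩
        0# + 1# * (e₀ + e₁)      ≈⟨ difference-of-squares squares e₀≉e₁ ⟩
        0#                       ∎
        where
        reduced : ∀ {u v u′ v′} → E two u v + κ * E two u′ v′ ≈ 0# → E ι u v + κ * E ι u′ v′ ≈ 0# →
          (1# + κ) * c₀ + c₂ * (E ι u v * E ι u v + κ * (E ι u′ v′ * E ι u′ v′)) ≈ 0#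
        reduced {u} {v} {u′} {v′} sum₂ sum₁ = begin
          (1# + κ) * c₀ + c₂ * (a * a + κ * (b * b))
            ≈⟨ trans (+-congˡ (trans (*-congˡ sum₁) (zeroʳ c₁))) (+-identityʳ _) ⟨
          (1# + κ) * c₀ + c₂ * (a * a + κ * (b * b)) + c₁ * (a + κ * b)
            ≈⟨ +-congʳ (+-congʳ (trans (distribʳ _ _ _) (+-congʳ (*-identityˡ c₀)))) ⟩
          c₀ + κ * c₀ + c₂ * (a * a + κ * (b * b)) + c₁ * (a + κ * b)
            ≈⟨ solve 6 (λ k c₀ c₁ c₂ a b →
                 c₀ :+ k :* c₀ :+ c₂ :* (a :* a :+ k :* (b :* b)) :+ c₁ :* (a :+ k :* b) :=
                 (c₀ :+ (c₁ :* a :+ c₂ :* (a :* a))) :+ k :* (c₀ :+ (c₁ :* b :+ c₂ :* (b :* b)))) refl κ c₀ c₁ c₂ a b ⟩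
          (c₀ + (c₁ * a + c₂ * (a * a))) + κ * (c₀ + (c₁ * b + c₂ * (b * b)))
            ≈⟨ +-cong (E≈ u v) (*-congˡ (E≈ u′ v′)) ⟨
          E two u v + κ * E two u′ v′
            ≈⟨ sum₂ ⟩
          0# ∎
          where
          a b : Carrier
          a = E ι u v
          b = E ι u′ v′
        scaled : ∀ {a b} → a + κ * b ≈ 0# → κ * (a * a + κ * (b * b)) ≈ ((3 ℕ.+ m) ·ℕ 1#) * (a * a)
        scaled {a} {b} eq = begin
          κ * (a * a + κ * (b * b))
            ≈⟨ solve 3 (λ k a b → k :* (a :* a :+ k :* (b :* b)) := k :* (a :* a) :+ (k :* b) :* (k :* b)) refl κ a b ⟩
          κ * (a * a) + (κ * b) * (κ * b)
            ≈⟨ +-congˡ (trans (*-cong κb≈-a κb≈-a) (trans (sym (-‿distribˡ-* _ _))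
                 (trans (-‿cong (sym (-‿distribʳ-* _ _))) (-‿involutive _)))) ⟩
          κ * (a * a) + a * a
            ≈⟨ trans (+-comm _ _) (+-congʳ (sym (*-identityˡ _))) ⟩
          1# * (a * a) + κ * (a * a)
            ≈⟨ distribʳ _ _ _ ⟨
          ((3 ℕ.+ m) ·ℕ 1#) * (a * a) ∎
          where
          κb≈-a : κ * b ≈ - a
          κb≈-a = +-inverseʳ-unique a (κ * b) eq
        squares : 0# * e₀ + 1# * (e₀ * e₀) ≈ 0# * e₁ + 1# * (e₁ * e₁)
        squares = +-cong (trans (zeroˡ _) (sym (zeroˡ _))) (*-congˡ (*-cancelˡ-nonzero (·ℕ-nonzero (3 ℕ.+ m))
          (trans (sym (scaled (proj₁ ι-zero-sum))) (trans
            (*-congˡ (*-cancelˡ-nonzero c₂≉0 (+-cancelˡ ((1# + κ) * c₀) _ _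
              (trans (reduced at-x (proj₁ ι-zero-sum)) (sym (reduced at-w (proj₂ ι-zero-sum)))))))
            (scaled (proj₂ ι-zero-sum))))))

      -- E_1 is a real symmetric idempotent, so the squared norm of the sum of its rows at `x` and
      -- `w` is e₀ + e₁ + e₁ + e₀.
      rows-opposite : e₀ + e₁ ≈ 0# → ∀ z → E ι x z + E ι w z ≈ 0#
      rows-opposite e₀+e₁≈0 = anisotropic (λ z → E ι x z + E ι w z) (begin
        sum (λ z → (E ι x z + E ι w z) * conj (E ι x z + E ι w z))
          ≈⟨ ΣX.cong (λ z → trans (*-congˡ (trans (conj-+ _ _) (+-cong (trans (E-real ι x z) (E-symmetric ι x z))
               (trans (E-real ι w z) (E-symmetric ι w z)))))
               (solve 4 (λ a b a′ b′ → (a :+ b) :* (a′ :+ b′) := (a :* a′ :+ b :* a′) :+ (a :* b′ :+ b :* b′)) refl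
                 (E ι x z) (E ι w z) (E ι z x) (E ι z w))) ⟩
        sum (λ z → (E ι x z * E ι z x + E ι w z * E ι z x) + (E ι x z * E ι z w + E ι w z * E ι z w))
          ≈⟨ trans ΣX.split (+-cong (trans ΣX.split (+-cong (E-idempotent ι x x) (E-idempotent ι w x)))
               (trans ΣX.split (+-cong (E-idempotent ι x w) (E-idempotent ι w w)))) ⟩
        (E ι x x + E ι w x) + (E ι x w + E ι w w)
          ≈⟨ +-cong e₀+e₁≈0 (trans (+-cong (E-symmetric ι x w)
               (E-constant ι (≡.trans (rel-diagonal w) (≡.sym (rel-diagonal x)))))
               (trans (+-comm _ _) e₀+e₁≈0)) ⟩
        0# + 0#
          ≈⟨ +-identityˡ _ ⟩
        0# ∎)

      -- For the second neighbour `w′` of `x`, opposite rows give E_1(w , w′) = - E_1(x , w′) = - e₁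
      -- = e₀, a value that `ι-injective` allows only on the diagonal.
      impossible : ⊥
      impossible with dichotomy two
      ... | inj₂ const = no-class-constant const
      ... | inj₁ zs = w≢w′ (rel-diagonal⁻¹ w w′ (≡.trans (ι-injective (sym e₀≈)) (rel-diagonal x)))
        where
        e₀≈ : E ι x x ≈ E ι w w′
        e₀≈ = +-cancelˡ e₁ _ _ (begin
          e₁ + e₀                  ≈⟨ trans (+-comm _ _) (e₀+e₁≈0 zs) ⟩
          0#                       ≈⟨ rows-opposite (e₀+e₁≈0 zs) w′ ⟨
          E ι x w′ + E ι w w′      ≈⟨ +-congʳ (E-constant ι (≡.trans xw′ (≡.sym wx))) ⟩
          e₁ + E ι w w′            ∎)

    -- The metric property: generation by A_1 and the split filtrations.

    module MetricTheory (one : Fin d) (toℕ-o : toℕ o ≡ 0)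
      (triangle : ∀ x {y z} → rel y z ≡ one → toℕ (rel x z) ℕ.≤ suc (toℕ (rel x y)))
      (geodesic : ∀ x y {m} → toℕ (rel x y) ≡ suc m →
                  ∃ λ z → rel x z ≡ one × toℕ (rel z y) ≡ m)
      where

      sum-isolate : ∀ (f : Fin d → Carrier) i →
        sum f ≈ f i + sum (λ k → if does (k ≟ i) then 0# else f k)
      sum-isolate f i = begin
        sum f                                ≈⟨ ΣR.cong pointwise ⟩
        sum (λ k → g k + h k)                ≈⟨ ΣR.split ⟩
        sum g + sum h                        ≈⟨ +-congʳ (trans (ΣR.single i off-i) at-i) ⟩
        f i + sum h                          ∎
        where
        g h : Fin d → Carrier
        g k = if does (k ≟ i) then f k else 0#
        h k = if does (k ≟ i) then 0# else f k
        pointwise : ∀ k → f k ≈ g k + h k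
        pointwise k with k ≟ i
        ... | yes _ = sym (+-identityʳ _)
        ... | no _  = sym (+-identityˡ _)
        off-i : ∀ k → k ≢ i → g k ≈ 0#
        off-i k k≢i with k ≟ i
        ... | yes k≡i = contradiction k≡i k≢i
        ... | no _    = refl
        at-i : g i ≈ f i
        at-i with i ≟ i
        ... | yes _   = refl
        ... | no i≢i  = contradiction ≡.refl i≢i

      -- For j = i - 1 the product A_1 A_j has no term beyond A_i by the triangle inequality, and
      -- its coefficient at A_i is nonzero because geodesics exist. Solving for A_i leaves smaller
      -- indices only.
      A-generated : ∀ {P} → IsSubspace P → (∀ {v} → P v → P (A one $ᵛ v)) →
                    ∀ i {v} → P v → P (A i $ᵛ v)
      A-generated {P} subspace one-closed i = go (suc (toℕ i)) i ℕₚ.≤-refl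
        where
        open IsSubspace subspace
        go : ∀ N i → toℕ i ℕ.< N → ∀ {v} → P v → P (A i $ᵛ v)
        go (suc N) i (ℕ.s≤s i≤N) {v} v∈P = by-level (toℕ i) ≡.refl
          where
          by-level : ∀ m → toℕ i ≡ m → P (A i $ᵛ v)
          by-level zero i≡0 = resp-≈ (λ y → sym (trans (A≈I y) (I-$ᵛ v y))) v∈P
            where
            i≡o : i ≡ o
            i≡o = Finₚ.toℕ-injective (≡.trans i≡0 (≡.sym toℕ-o))
            A≈I : A i $ᵛ v ≈ᵛ I $ᵛ v
            A≈I = $ᵛ-congˡ v λ y z → ⟦⟧-cong (rel y z ≟ i) (y ≟ z)
              (λ eq → rel-diagonal⁻¹ y z (≡.trans eq i≡o))
              (λ { ≡.refl → ≡.trans (rel-diagonal y) (≡.sym i≡o) })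
          by-level (suc m) i≡1+m =
            resp-≈ recover (∙-closed b (+-closed (one-closed (go N j (ℕₚ.<-≤-trans j<i i≤N) v∈P))
              (∙-closed (- 1#) (Σ-closed rest-closed))))
            where
            m<d : m ℕ.< d
            m<d = ℕₚ.<-trans (≡.subst (m ℕ.<_) (≡.sym i≡1+m) ℕₚ.≤-refl) (Finₚ.toℕ<n i)
            j : Fin d
            j = fromℕ< m<d
            j≡m : toℕ j ≡ m
            j≡m = Finₚ.toℕ-fromℕ< m<d
            j<i : toℕ j ℕ.< toℕ i
            j<i = ℕₚ.≤-reflexive (≡.trans (≡.cong suc j≡m) (≡.sym i≡1+m))
            AA-constant : RelConstant (A one *ᵐ A j)
            AA-constant = *ᵐ-constant {A one} {A j} (A-constant one) (A-constant j)
            c : Fin d → Carrier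
            c = value (A one *ᵐ A j)
            product-zero-one : ∀ x w y → A one x w * A j w y * conj (A one x w * A j w y) ≈ A one x w * A j w y
            product-zero-one x w y = begin
              A one x w * A j w y * conj (A one x w * A j w y)
                ≈⟨ trans (*-congˡ (conj-* _ _))
                     (solve 4 (λ a b a′ b′ → a :* b :* (a′ :* b′) := a :* a′ :* (b :* b′)) refl _ _ _ _) ⟩
              A one x w * conj (A one x w) * (A j w y * conj (A j w y))
                ≈⟨ *-cong (A-zero-one one x w) (A-zero-one j w y) ⟩
              A one x w * A j w y ∎
            c≉0 : ¬ (c i ≈ 0#)
            c≉0 c≈0 with w , xw , wy ← geodesic (pt₁ i) (pt₂ i)
                           (≡.trans (≡.cong toℕ (rel-pt i)) i≡1+m) =
              1≉0 (begin
                1#       ≈⟨ *-identityˡ 1# ⟨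
                1# * 1#
                  ≈⟨ *-cong (⟦⟧-yes (rel (pt₁ i) w ≟ one) xw)
                       (⟦⟧-yes (rel w (pt₂ i) ≟ j) (Finₚ.toℕ-injective (≡.trans wy (≡.sym j≡m)))) ⟨
                A one (pt₁ i) w * A j w (pt₂ i)
                  ≈⟨ sum-zero-one (λ w → product-zero-one (pt₁ i) w (pt₂ i)) c≈0 w ⟩
                0# ∎)
            c-high : ∀ k → toℕ i ℕ.< toℕ k → c k ≈ 0#
            c-high k i<k = ΣX.vanishing λ w → term w (rel (pt₁ k) w ≟ one) (rel w (pt₂ k) ≟ j)
              where
              term : ∀ w → Dec (rel (pt₁ k) w ≡ one) → Dec (rel w (pt₂ k) ≡ j) →
                     A one (pt₁ k) w * A j w (pt₂ k) ≈ 0#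
              term w (no xw) _ = trans (*-congʳ (⟦⟧-no (rel (pt₁ k) w ≟ one) xw)) (zeroˡ _)
              term w (yes _) (no wy) = trans (*-congˡ (⟦⟧-no (rel w (pt₂ k) ≟ j) wy)) (zeroʳ _)
              term w (yes xw) (yes wy) = contradiction
                (triangle (pt₂ k) (≡.trans (rel-symmetric _ _) xw))
                (ℕₚ.<⇒≱ (≡.subst₂ (λ p q → suc p ℕ.< q)
                  (≡.trans (≡.cong toℕ (≡.sym wy)) (≡.cong toℕ (rel-symmetric w (pt₂ k))))
                  (≡.trans (≡.cong toℕ (≡.sym (rel-pt k))) (≡.cong toℕ (rel-symmetric (pt₁ k) (pt₂ k))))
                  (ℕₚ.≤-<-trans j<i i<k)))
            b : Carrier
            b = proj₁ (inverse (c i) c≉0)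
            cb≈1 : c i * b ≈ 1#
            cb≈1 = proj₂ (inverse (c i) c≉0)
            rest : Fin d → V
            rest k y = if does (k ≟ i) then 0# else c k * (A k $ᵛ v) y
            rest-closed : ∀ k → P (rest k)
            rest-closed k with k ≟ i
            ... | yes _  = 0-closed
            ... | no k≢i with ℕₚ.<-cmp (toℕ k) (toℕ i)
            ...   | tri< k<i _ _ = ∙-closed (c k) (go N k (ℕₚ.<-≤-trans k<i i≤N) v∈P)
            ...   | tri≈ _ k≡i _ = contradiction (Finₚ.toℕ-injective k≡i) k≢i
            ...   | tri> _ _ i<k = resp-≈ (λ y → sym (trans (*-congʳ (c-high k i<k)) (zeroˡ _))) 0-closed
            recover : b ∙ᵛ ((A one $ᵛ (A j $ᵛ v)) +ᵛ ((- 1#) ∙ᵛ λ y → sum (λ k → rest k y))) ≈ᵛ A i $ᵛ v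
            recover y = begin
              b * ((A one $ᵛ (A j $ᵛ v)) y + - 1# * r)
                ≈⟨ *-congˡ (+-congʳ (trans (sym ($ᵛ-*ᵐ (A one) (A j) v y))
                     (trans (expand-$ᵛ {A one *ᵐ A j} AA-constant v y)
                       (sum-isolate (λ k → c k * (A k $ᵛ v) y) i)))) ⟩
              b * (c i * (A i $ᵛ v) y + r + - 1# * r)
                ≈⟨ *-congˡ (trans (+-assoc _ _ _) (trans (+-congˡ cancel) (+-identityʳ _))) ⟩
              b * (c i * (A i $ᵛ v) y)
                ≈⟨ solve 3 (λ b c a → b :* (c :* a) := c :* b :* a) refl b (c i) _ ⟩
              c i * b * (A i $ᵛ v) y
                ≈⟨ trans (*-congʳ cb≈1) (*-identityˡ _) ⟩
              (A i $ᵛ v) y ∎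
              where
              r : Carrier
              r = sum (λ k → rest k y)
              cancel : r + - 1# * r ≈ 0#
              cancel = trans (+-congˡ (trans (sym (-‿distribˡ-* _ _)) (-‿cong (*-identityˡ _)))) (-‿inverseʳ r)

      E-closed : ∀ {P} → IsSubspace P → (∀ {v} → P v → P (A one $ᵛ v)) →
                 ∀ j {v} → P v → P (E j $ᵛ v)
      E-closed subspace one-closed j =
        RelConstant-closed subspace (A-generated subspace one-closed) (E-constant j)

      dual-generated : ∀ x {P} → IsSubspace P → (∀ {v} → P v → P (E ι x ⊙ v)) →
                       ∀ j {v} → P v → P (E j x ⊙ v)
      dual-generated x {P} subspace ι-closed j {v} v∈P with c , _ , E≈ ← cometric j =
        resp-≈ (λ y → sym (trans (*-congʳ (E≈ x y))
          (trans (sym (SumOver.pullʳ (suc (toℕ j)) (v y) {λ l → c l * (E ι x y ^ toℕ l)}))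
            (SumOver.cong (suc (toℕ j)) λ l → *-assoc (c l) (E ι x y ^ toℕ l) (v y)))))
          (Σ-closed λ l → ∙-closed (c l) (power (toℕ l)))
        where
        open IsSubspace subspace
        power : ∀ m → P (λ y → (E ι x y ^ m) * v y)
        power zero    = resp-≈ (λ y → sym (*-identityˡ _)) v∈P
        power (suc m) = resp-≈ (λ y → sym (*-assoc _ _ _)) (ι-closed (power m))

      -- With θ an eigenvalue of F, both F a − θ a and F b − θ b lie one step
      -- further along their filtrations; θ v is restored by a second splitting.
      module Splitting (x : Fin n) {P : V → Set} (subspace : IsSubspace P)
        (one-closed : ∀ {v} → P v → P (A one $ᵛ v))
        (ι-closed : ∀ {v} → P v → P (E ι x ⊙ v))
        where

        open IsSubspace subspace

        Beyond : ℕ → V → Set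
        Beyond i v = ∀ y → toℕ (rel x y) ℕ.≤ i → v y ≈ 0#

        Below : ℕ → V → Set
        Below i v = ∀ l → i ℕ.< toℕ l → E l $ᵛ v ≈ᵛ 0ᵛ

        Split : V → Set
        Split v = ∀ i → ∃₂ λ a b → P a × P b × v ≈ᵛ a +ᵛ b × Beyond i a × Below i b

        Beyond-subspace : ∀ i → IsSubspace (Beyond i)
        Beyond-subspace i = record
          { resp-≈   = λ u≈v u∈ y le → trans (sym (u≈v y)) (u∈ y le)
          ; 0-closed = λ _ _ → refl
          ; +-closed = λ u∈ v∈ y le → trans (+-cong (u∈ y le) (v∈ y le)) (+-identityˡ _)
          ; ∙-closed = λ c v∈ y le → trans (*-congˡ (v∈ y le)) (zeroʳ c)
          }

        kernel-subspace : ∀ B → IsSubspace (λ v → B $ᵛ v ≈ᵛ 0ᵛ)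
        kernel-subspace B = record
          { resp-≈   = λ u≈v u∈ y → trans (sym ($ᵛ-congʳ B u≈v y)) (u∈ y)
          ; 0-closed = $ᵛ-0 B (λ _ → refl)
          ; +-closed = λ u∈ v∈ y → trans ($ᵛ-+ B _ _ y) (trans (+-cong (u∈ y) (v∈ y)) (+-identityˡ _))
          ; ∙-closed = λ c v∈ y → trans ($ᵛ-∙ B c _ y) (trans (*-congˡ (v∈ y)) (zeroʳ c))
          }

        Below-subspace : ∀ i → IsSubspace (Below i)
        Below-subspace i = record
          { resp-≈   = λ u≈v u∈ l lt → IsSubspace.resp-≈ (kernel-subspace (E l)) u≈v (u∈ l lt)
          ; 0-closed = λ l lt → IsSubspace.0-closed (kernel-subspace (E l))
          ; +-closed = λ u∈ v∈ l lt → IsSubspace.+-closed (kernel-subspace (E l)) (u∈ l lt) (v∈ l lt)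
          ; ∙-closed = λ c v∈ l lt → IsSubspace.∙-closed (kernel-subspace (E l)) c (v∈ l lt)
          }

        private
          module Be i = IsSubspace (Beyond-subspace i)
          module Lo i = IsSubspace (Below-subspace i)

        Split-subspace : IsSubspace Split
        Split-subspace = record
          { resp-≈   = λ u≈v u∈ i → let a , b , a∈ , b∈ , eq , be , lo = u∈ i in
              a , b , a∈ , b∈ , (λ y → trans (sym (u≈v y)) (eq y)) , be , lo
          ; 0-closed = λ i → 0ᵛ , 0ᵛ , 0-closed , 0-closed , (λ _ → sym (+-identityˡ _)) , Be.0-closed i , Lo.0-closed i
          ; +-closed = λ u∈ v∈ i →
              let a , b , a∈ , b∈ , eq , be , lo = u∈ i
                  a′ , b′ , a′∈ , b′∈ , eq′ , be′ , lo′ = v∈ i in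
              a +ᵛ a′ , b +ᵛ b′ , +-closed a∈ a′∈ , +-closed b∈ b′∈ ,
              (λ y → trans (+-cong (eq y) (eq′ y))
                (solve 4 (λ a b a′ b′ → (a :+ b) :+ (a′ :+ b′) := (a :+ a′) :+ (b :+ b′)) refl
                  (a y) (b y) (a′ y) (b′ y))) ,
              Be.+-closed i be be′ , Lo.+-closed i lo lo′
          ; ∙-closed = λ c u∈ i → let a , b , a∈ , b∈ , eq , be , lo = u∈ i in
              c ∙ᵛ a , c ∙ᵛ b , ∙-closed c a∈ , ∙-closed c b∈ ,
              (λ y → trans (*-congˡ (eq y)) (distribˡ _ _ _)) , Be.∙-closed i c be , Lo.∙-closed i c lo
          }

        shift : (F : V → V) (θ : Carrier) → V → V
        shift F θ v = F v +ᵛ ((- θ) ∙ᵛ v)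

        shift-split : ∀ (F : V → V) (θ : Carrier) {v a b a′ b′} →
          F v ≈ᵛ F a +ᵛ F b → v ≈ᵛ a +ᵛ b → v ≈ᵛ a′ +ᵛ b′ →
          F v ≈ᵛ (shift F θ a +ᵛ (θ ∙ᵛ a′)) +ᵛ (shift F θ b +ᵛ (θ ∙ᵛ b′))
        shift-split F θ {v} {a} {b} {a′} {b′} F+ eq eq′ y = sym (begin
          F a y + - θ * a y + θ * a′ y + (F b y + - θ * b y + θ * b′ y)
            ≈⟨ solve 8 (λ fa fb a b a′ b′ θ m →
                 fa :+ m :* a :+ θ :* a′ :+ (fb :+ m :* b :+ θ :* b′) :=
                 fa :+ fb :+ (m :* (a :+ b) :+ θ :* (a′ :+ b′))) refl
                 (F a y) (F b y) (a y) (b y) (a′ y) (b′ y) θ (- θ) ⟩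
          F a y + F b y + (- θ * (a y + b y) + θ * (a′ y + b′ y))
            ≈⟨ +-cong (sym (F+ y)) (+-cong (*-congˡ (sym (eq y))) (*-congˡ (sym (eq′ y)))) ⟩
          F v y + (- θ * v y + θ * v y)
            ≈⟨ +-congˡ (trans (sym (distribʳ _ _ _)) (trans (*-congʳ (-‿inverseˡ θ)) (zeroˡ _))) ⟩
          F v y + 0#
            ≈⟨ +-identityʳ _ ⟩
          F v y ∎)

        -- `suc i` may exceed the last index; the filtration conditions at that level are then
        -- empty, so any default works.
        extend : (Fin d → Carrier) → ℕ → Carrier
        extend f i with i ℕₚ.<? d
        ... | yes i<d = f (fromℕ< i<d)
        ... | no _    = 0#

        extend-toℕ : ∀ f k → extend f (toℕ k) ≈ f k
        extend-toℕ f k with toℕ k ℕₚ.<? d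
        ... | yes k<d = reflexive (≡.cong f (Finₚ.fromℕ<-toℕ k k<d))
        ... | no k≮d  = contradiction (Finₚ.toℕ<n k) k≮d

        shift-zero : ∀ {f θ v} → f ≈ θ → f * v + - θ * v ≈ 0#
        shift-zero {f} {θ} {v} f≈θ = begin
          f * v + - θ * v  ≈⟨ distribʳ _ _ _ ⟨
          (f + - θ) * v    ≈⟨ *-congʳ (trans (+-congʳ f≈θ) (-‿inverseʳ θ)) ⟩
          0# * v           ≈⟨ zeroˡ _ ⟩
          0#               ∎

        -- The first splitting is taken at `suc i`: A_1 moves the support of `a` inwards by at most
        -- one step, and subtracting the eigenvalue of index `suc i` removes the top component of
        -- `b`. The splitting at `i` absorbs the remaining multiple of `v`.
        Split-one-closed : ∀ {v} → Split v → Split (A one $ᵛ v)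
        Split-one-closed {v} v∈ i
          with a , b , a∈ , b∈ , eq , be , lo ← v∈ (suc i)
             | a′ , b′ , a′∈ , b′∈ , eq′ , be′ , lo′ ← v∈ i
             | θ , EA≈ ← eigenvalues-$ᵛ (A-constant one) =
          _ , _ ,
          +-closed (+-closed (one-closed a∈) (∙-closed _ a∈)) (∙-closed _ a′∈) ,
          +-closed (+-closed (one-closed b∈) (∙-closed _ b∈)) (∙-closed _ b′∈) ,
          shift-split (A one $ᵛ_) t
            (λ y → trans ($ᵛ-congʳ (A one) eq y) ($ᵛ-+ (A one) a b y)) eq eq′ ,
          Be.+-closed i (Be.+-closed i beyond (Be.∙-closed i _ λ y le → be y (ℕₚ.m≤n⇒m≤1+n le)))
            (Be.∙-closed i _ be′) ,
          Lo.+-closed i below (Lo.∙-closed i _ lo′)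
          where
          t : Carrier
          t = extend θ (suc i)
          beyond : Beyond i (A one $ᵛ a)
          beyond y le = ΣX.vanishing λ z → term z (rel y z ≟ one)
            where
            term : ∀ z → Dec (rel y z ≡ one) → A one y z * a z ≈ 0#
            term z (yes yz) = trans (*-congˡ (be z (ℕₚ.≤-trans (triangle x yz) (ℕ.s≤s le)))) (zeroʳ _)
            term z (no ¬yz) = trans (*-congʳ (⟦⟧-no (rel y z ≟ one) ¬yz)) (zeroˡ _)
          below : Below i (shift (A one $ᵛ_) t b)
          below l i<l y = begin
            (E l $ᵛ shift (A one $ᵛ_) t b) y
              ≈⟨ trans ($ᵛ-+ (E l) _ _ y) (+-cong (EA≈ l b y) ($ᵛ-∙ (E l) _ b y)) ⟩
            θ l * (E l $ᵛ b) y + - t * (E l $ᵛ b) y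
              ≈⟨ at-level (suc i ℕₚ.<? toℕ l) ⟩
            0# ∎
            where
            at-level : Dec (suc i ℕ.< toℕ l) → θ l * (E l $ᵛ b) y + - t * (E l $ᵛ b) y ≈ 0#
            at-level (yes lt) = trans (+-cong (trans (*-congˡ (lo l lt y)) (zeroʳ _))
              (trans (*-congˡ (lo l lt y)) (zeroʳ _))) (+-identityˡ _)
            at-level (no ≮) = shift-zero (trans (sym (extend-toℕ θ l))
              (reflexive (≡.cong (extend θ) (ℕₚ.≤-antisym (ℕₚ.≮⇒≥ ≮) i<l))))

        -- This is the splitting at `i - 1`, stated with strict bounds so that `i = 0` makes sense,
        -- where it is v + 0.
        lower-split : ∀ {v} → Split v → P v → ∀ i → ∃₂ λ a b → P a × P b × v ≈ᵛ a +ᵛ b ×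
          (∀ y → toℕ (rel x y) ℕ.< i → a y ≈ 0#) × (∀ l → i ℕ.≤ toℕ l → E l $ᵛ b ≈ᵛ 0ᵛ)
        lower-split {v} v∈ v∈P zero =
          v , 0ᵛ , v∈P , 0-closed , (λ _ → sym (+-identityʳ _)) , (λ _ ()) , λ l _ → $ᵛ-0 (E l) (λ _ → refl)
        lower-split v∈ v∈P (suc i) with a , b , a∈ , b∈ , eq , be , lo ← v∈ i =
          a , b , a∈ , b∈ , eq , (λ y lt → be y (ℕₚ.≤-pred lt)) , lo

        Split⊆P : ∀ {v} → Split v → P v
        Split⊆P v∈ with a , b , a∈ , b∈ , eq , _ ← v∈ 0 =
          resp-≈ (λ y → sym (eq y)) (+-closed a∈ b∈)

        -- The mirror image, starting one level lower: subtracting the value of E_1 at distance `i`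
        -- clears that sphere from `a`, and dual tridiagonality lets `b` rise by at most one level.
        Split-ι-closed : ∀ {v} → Split v → Split (E ι x ⊙ v)
        Split-ι-closed {v} v∈ i
          with a , b , a∈ , b∈ , eq , be , lo ← lower-split v∈ (Split⊆P v∈) i
             | a′ , b′ , a′∈ , b′∈ , eq′ , be′ , lo′ ← v∈ i =
          _ , _ ,
          +-closed (+-closed (ι-closed a∈) (∙-closed _ a∈)) (∙-closed _ a′∈) ,
          +-closed (+-closed (ι-closed b∈) (∙-closed _ b∈)) (∙-closed _ b′∈) ,
          shift-split (E ι x ⊙_) t
            (λ y → trans (*-congˡ (eq y)) (distribˡ _ _ _)) eq eq′ ,
          Be.+-closed i beyond (Be.∙-closed i _ be′) ,
          Lo.+-closed i (Lo.+-closed i below (Lo.∙-closed i _ λ l i<l → lo l (ℕₚ.<⇒≤ i<l)))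
            (Lo.∙-closed i _ lo′)
          where
          t : Carrier
          t = extend (value (E ι)) i
          beyond : Beyond i (shift (E ι x ⊙_) t a)
          beyond y le with toℕ (rel x y) ℕₚ.<? i
          ... | yes lt = trans (+-cong (trans (*-congˡ (be y lt)) (zeroʳ _))
                           (trans (*-congˡ (be y lt)) (zeroʳ _))) (+-identityˡ _)
          ... | no ≮   = shift-zero (trans (value-≈ (E-constant ι) x y)
                           (trans (sym (extend-toℕ (value (E ι)) (rel x y)))
                             (reflexive (≡.cong (extend (value (E ι))) (ℕₚ.≤-antisym le (ℕₚ.≮⇒≥ ≮))))))
          below : Below i (E ι x ⊙ b)
          below l i<l with c , b≈ ← resolution =
            Ker.resp-≈ (λ y → sym (trans (*-congˡ (b≈ b y)) (trans (sym (ΣR.pullˡ _))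
                (ΣR.cong λ k → solve 3 (λ e c b → e :* (c :* b) := c :* (e :* b)) refl
                  (E ι x y) (c k) _))))
              (Ker.Σ-closed {f = λ k → c k ∙ᵛ (E ι x ⊙ (E k $ᵛ b))} λ k → Ker.∙-closed (c k) (component k (i ℕₚ.≤? toℕ k)))
            where
            module Ker = IsSubspace (kernel-subspace (E l))
            component : ∀ k → Dec (i ℕ.≤ toℕ k) → E l $ᵛ (E ι x ⊙ (E k $ᵛ b)) ≈ᵛ 0ᵛ
            component k (yes le) = $ᵛ-0 (E l) λ y → trans (*-congˡ (lo k le y)) (zeroʳ _)
            component k (no ≰)   = dual-tridiagonal x l k (ℕₚ.≤-<-trans (ℕₚ.≰⇒> ≰) i<l) b

        -- One summand can always be zero: for i ≥ r* the vector lies in the span of the first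
        -- components, and for i < r* ≤ r it vanishes up to distance i, being a member of W. This is
        -- where r* ≤ r enters.
        dual-endpoint-split : ∀ r* {r : ℕ} → toℕ r* ℕ.≤ r →
          (∀ {v} → P v → ∀ y → toℕ (rel x y) ℕ.< r → v y ≈ 0#) →
          ∀ {w} → P w → Split (E r* $ᵛ w)
        dual-endpoint-split r* r*≤r endpoint {w} w∈P i with toℕ r* ℕₚ.≤? i
        ... | yes r*≤i = 0ᵛ , E r* $ᵛ w , 0-closed , Ew∈P , (λ _ → sym (+-identityˡ _)) , Be.0-closed i ,
              λ l i<l y → trans (sym ($ᵛ-*ᵐ (E l) (E r*) w y)) (ΣX.vanishing λ z → trans (*-congʳ
                (E-orthogonal (λ l≡r* → ℕₚ.<⇒≱ i<l (≡.subst (λ k → toℕ k ℕ.≤ i) (≡.sym l≡r*) r*≤i)) y z)) (zeroˡ _))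
          where
          Ew∈P : P (E r* $ᵛ w)
          Ew∈P = E-closed subspace one-closed r* w∈P
        ... | no r*≰i = E r* $ᵛ w , 0ᵛ , Ew∈P , 0-closed , (λ _ → sym (+-identityʳ _)) ,
              (λ y le → endpoint Ew∈P y (ℕₚ.≤-<-trans le (ℕₚ.<-≤-trans (ℕₚ.≰⇒> r*≰i) r*≤r))) , Lo.0-closed i
          where
          Ew∈P : P (E r* $ᵛ w)
          Ew∈P = E-closed subspace one-closed r* w∈P

        -- In the splitting at δ, `a` vanishes on the support of ψ, and `b` has only components E_j
        -- b with j ≤ δ, which are the ones that ψ annihilates.
        Split-orthogonal : ∀ δ {ψ} → (∀ y → toℕ (rel x y) ≢ δ → ψ y ≈ 0#) →
          (∀ j → toℕ j ℕ.≤ δ → E j $ᵛ ψ ≈ᵛ 0ᵛ) → ∀ {v} → Split v → ⟨ ψ , v ⟩ ≈ 0#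
        Split-orthogonal δ {ψ} support design v∈ with a , b , _ , _ , eq , be , lo ← v∈ δ = begin
          ⟨ ψ , _ ⟩              ≈⟨ ⟨⟩-cong (λ _ → refl) eq ⟩
          ⟨ ψ , a +ᵛ b ⟩         ≈⟨ ⟨⟩-+ʳ ψ a b ⟩
          ⟨ ψ , a ⟩ + ⟨ ψ , b ⟩  ≈⟨ +-cong (ΣX.vanishing λ y → term y (toℕ (rel x y) ℕₚ.≟ δ)) ψ⊥b ⟩
          0# + 0#                ≈⟨ +-identityˡ _ ⟩
          0#                     ∎
          where
          term : ∀ y → Dec (toℕ (rel x y) ≡ δ) → ψ y * conj (a y) ≈ 0#
          term y (yes eq) = trans (*-congˡ (trans (conj-cong (be y (ℕₚ.≤-reflexive eq))) conj-0)) (zeroʳ _)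
          term y (no ≢)   = trans (*-congʳ (support y ≢)) (zeroˡ _)
          component : ∀ j → Dec (toℕ j ℕ.≤ δ) → ⟨ ψ , E j $ᵛ b ⟩ ≈ 0#
          component j (yes le) = trans (sym (E-self-adjoint j ψ b))
            (ΣX.vanishing λ y → trans (*-congʳ (design j le y)) (zeroˡ _))
          component j (no ≰)   = ΣX.vanishing λ y →
            trans (*-congˡ (trans (conj-cong (lo j (ℕₚ.≰⇒> ≰) y)) conj-0)) (zeroʳ _)
          ψ⊥b : ⟨ ψ , b ⟩ ≈ 0#
          ψ⊥b with c , b≈ ← resolution = begin
            sum (λ y → ψ y * conj (b y))
              ≈⟨ ΣX.cong (λ y → *-congˡ (trans (conj-cong (b≈ b y)) (ΣR.conj-sum _))) ⟩
            sum (λ y → ψ y * sum (λ j → conj (c j * (E j $ᵛ b) y)))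
              ≈⟨ ΣX.cong (λ y → trans (sym (ΣR.pullˡ _)) (ΣR.cong λ j → trans (*-congˡ (conj-* _ _))
                   (solve 3 (λ p c e → p :* (c :* e) := c :* (p :* e)) refl
                     (ψ y) (conj (c j)) (conj ((E j $ᵛ b) y))))) ⟩
            sum (λ y → sum (λ j → conj (c j) * (ψ y * conj ((E j $ᵛ b) y))))
              ≈⟨ ΣX.swap {d} ⟩
            sum (λ j → sum (λ y → conj (c j) * (ψ y * conj ((E j $ᵛ b) y))))
              ≈⟨ ΣR.vanishing (λ j → trans (ΣX.pullˡ _)
                   (trans (*-congˡ (component j (toℕ j ℕₚ.≤? δ))) (zeroʳ _))) ⟩
            0# ∎

      -- Invariant subspaces and the vanishing of ψ.

      data Word (x : Fin n) : Matrix → Set where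
        unit      : Word x I
        adjacency : Word x (A one)
        dual      : Word x (diag (E ι x))
        resp      : ∀ {B C} → B ≈ᵐ C → Word x B → Word x C
        add       : ∀ {B C} → Word x B → Word x C → Word x (λ y z → B y z + C y z)
        scale     : ∀ c {B} → Word x B → Word x (λ y z → c * B y z)
        mult      : ∀ {B C} → Word x B → Word x C → Word x (B *ᵐ C)

      -- A T(x)-module tested on A_1 and on A*_1 up to scale; `T-invariant` extends the invariance
      -- to all of T(x).
      record Invariant (x : Fin n) : Set₁ where
        field
          Mem      : V → Set
          subspace : IsSubspace Mem
          A-closed : ∀ {v} → Mem v → Mem (A one $ᵛ v)
          ι-closed : ∀ {v} → Mem v → Mem (E ι x ⊙ v)
        open IsSubspace subspace public

      open Invariant

      Word-closed : ∀ {x} (W : Invariant x) → ∀ {B} → Word x B → ∀ {v} → Mem W v → Mem W (B $ᵛ v)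
      Word-closed W unit {v} v∈ = resp-≈ W (λ y → sym (I-$ᵛ v y)) v∈
      Word-closed W adjacency v∈ = A-closed W v∈
      Word-closed {x} W dual {v} v∈ = resp-≈ W (λ y → sym (diag-$ᵛ (E ι x) v y)) (ι-closed W v∈)
      Word-closed W (resp {B} {C} B≈C B∈) {v} v∈ = resp-≈ W ($ᵛ-congˡ {B} {C} v B≈C) (Word-closed W B∈ v∈)
      Word-closed W (add {B} {C} B∈ C∈) {v} v∈ =
        resp-≈ W (λ y → sym ($ᵛ-+ˡ B C v y)) (+-closed W (Word-closed W B∈ v∈) (Word-closed W C∈ v∈))
      Word-closed W (scale c {B} B∈) {v} v∈ =
        resp-≈ W (λ y → sym ($ᵛ-∙ˡ c B v y)) (∙-closed W c (Word-closed W B∈ v∈))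
      Word-closed W (mult {B} {C} B∈ C∈) {v} v∈ =
        resp-≈ W (λ y → sym ($ᵛ-*ᵐ B C v y)) (Word-closed W B∈ (Word-closed W C∈ v∈))

      Word-adjoint : ∀ {x B} → Word x B → Word x (B ᴴ)
      Word-adjoint unit = resp (λ y z → sym (trans (conj-⟦⟧ (z ≟ y)) (symmetric I-constant z y))) unit
      Word-adjoint adjacency =
        resp (λ y z → sym (trans (conj-⟦⟧ (rel z y ≟ one)) (symmetric (A-constant one) z y))) adjacency
      Word-adjoint {x} dual = resp (λ y z → sym (diag-ᴴ (E-real ι x) y z)) dual
      Word-adjoint (resp B≈C B∈) = resp (λ y z → conj-cong (B≈C z y)) (Word-adjoint B∈)
      Word-adjoint (add {B} {C} B∈ C∈) =
        resp (λ y z → sym (conj-+ (B z y) (C z y))) (add (Word-adjoint B∈) (Word-adjoint C∈))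
      Word-adjoint (scale c {B} B∈) = resp (λ y z → sym (conj-* c (B z y))) (scale (conj c) (Word-adjoint B∈))
      Word-adjoint (mult {B} {C} B∈ C∈) = resp (ᴴ-*ᵐ B C) (mult (Word-adjoint C∈) (Word-adjoint B∈))

      E* : Fin d → Fin n → Matrix
      E* i x = diag (A i x)

      Irreducible : ∀ {x} → Invariant x → Set₁
      Irreducible {x} W = (∃ λ w → Mem W w × ¬ (w ≈ᵛ 0ᵛ)) ×
        ((U : Invariant x) → (∀ {v} → Mem U v → Mem W v) →
          (∀ {v} → Mem U v → v ≈ᵛ 0ᵛ) ⊎ (∀ {v} → Mem W v → Mem U v))

      NonzeroOn : ∀ {x} → Matrix → Invariant x → Set
      NonzeroOn B W = ∃ λ w → Mem W w × ¬ (B $ᵛ w ≈ᵛ 0ᵛ)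

      IsEndpoint : ∀ {x} → Invariant x → Fin d → Set
      IsEndpoint {x} W = IsLeast λ i → NonzeroOn (E* i x) W

      IsDualEndpoint : ∀ {x} → Invariant x → Fin d → Set
      IsDualEndpoint W = IsLeast λ j → NonzeroOn (E j) W

      RadialInvariant : ∀ x → Invariant x
      RadialInvariant x = record
        { Mem = Radial x
        ; subspace = Radial-subspace x
        ; A-closed = Radial-$ᵛ {B = A one} (A-constant one)
        ; ι-closed = Radial-⊙ {B = E ι} (E-constant ι)
        }

      -- The module T(x) ψ. Recording the word B with each vector B ψ is what makes the adjoint
      -- argument of `cyclic-⊥` possible.
      cyclic : ∀ x → V → Invariant x
      cyclic x ψ = record
        { Mem      = InCyclic
        ; subspace = record
          { resp-≈   = λ u≈v (B , B∈ , u≈) → B , B∈ , λ y → trans (sym (u≈v y)) (u≈ y)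
          ; 0-closed = _ , scale 0# unit , λ y → sym (trans ($ᵛ-∙ˡ 0# I ψ y) (zeroˡ _))
          ; +-closed = λ (B , B∈ , u≈) (C , C∈ , v≈) → _ , add B∈ C∈ , λ y →
              trans (+-cong (u≈ y) (v≈ y)) (sym ($ᵛ-+ˡ B C ψ y))
          ; ∙-closed = λ c (B , B∈ , v≈) → _ , scale c B∈ , λ y →
              trans (*-congˡ (v≈ y)) (sym ($ᵛ-∙ˡ c B ψ y))
          }
        ; A-closed = λ (C , C∈ , v≈) → _ , mult adjacency C∈ , λ y →
            trans ($ᵛ-congʳ (A one) v≈ y) (sym ($ᵛ-*ᵐ (A one) C ψ y))
        ; ι-closed = λ {v} (C , C∈ , v≈) → _ , mult dual C∈ , λ y →
            trans (sym (diag-$ᵛ (E ι x) v y))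
              (trans ($ᵛ-congʳ (diag (E ι x)) v≈ y) (sym ($ᵛ-*ᵐ (diag (E ι x)) C ψ y)))
        }
        where
        InCyclic : V → Set
        InCyclic v = ∃ λ B → Word x B × v ≈ᵛ B $ᵛ ψ

      -- Dimension is bounded through dependence, so that no basis of a subspace has to be chosen.
      DimensionAtMost : ∀ {x} → ℕ → Invariant x → Set
      DimensionAtMost m U = ∀ (v : Fin (suc m) → V) → (∀ i → Mem U (v i)) →
        ∃ λ (c : Fin (suc m) → Carrier) → (∃ λ i → ¬ (c i ≈ 0#)) × (∀ y → sum (λ i → c i * v i y) ≈ 0#)

      _⊆ᵐ_ : ∀ {x} → Invariant x → Invariant x → Set
      U ⊆ᵐ W = ∀ {v} → Mem U v → Mem W v

      -- A vector of W outside U is adjoined to m + 1 vectors of U. In the resulting dependence its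
      -- coefficient vanishes, since otherwise it would lie in U.
      proper-dimension : ∀ {x m} (U W : Invariant x) → U ⊆ᵐ W → (∃ λ v → Mem W v × ¬ Mem U v) →
        DimensionAtMost (suc m) W → DimensionAtMost m U
      proper-dimension {x} {m} U W U⊆W (w , w∈W , w∉U) dim v v∈U
        with c , (i , cᵢ≉0) , dep ← dim (w ∷ v) (λ { zero → w∈W ; (suc i) → U⊆W (v∈U i) })
        with em {P = c zero ≈ 0#}
      ... | no c₀≉0 with b , c₀b≈1 ← inverse (c zero) c₀≉0 = contradiction
        (resp-≈ U recover (∙-closed U (- b) (Σ-closed U λ i → ∙-closed U (c (suc i)) (v∈U i)))) w∉U
        where
        recover : ∀ y → - b * sum (λ i → c (suc i) * v i y) ≈ w y
        recover y = trans (*-congˡ { - b} (+-inverseʳ-unique (c zero * w y) _ (dep y)))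
          (trans (sym (-‿distribˡ-* b _)) (trans (-‿cong (sym (-‿distribʳ-* b (c zero * w y))))
            (trans (-‿involutive _) (trans (sym (*-assoc b (c zero) (w y)))
              (trans (*-congʳ {w y} (trans (*-comm b (c zero)) c₀b≈1)) (*-identityˡ (w y)))))))
      ... | yes c₀≈0 = c ∘ suc , nonzero i cᵢ≉0 , λ y → trans
        (sym (trans (+-congʳ {sum (λ i → c (suc i) * v i y)} (trans (*-congʳ {w y} c₀≈0) (zeroˡ (w y))))
          (+-identityˡ _)))
        (dep y)
        where
        nonzero : ∀ i → ¬ (c i ≈ 0#) → ∃ λ i → ¬ (c (suc i) ≈ 0#)
        nonzero zero    cᵢ≉0 = contradiction c₀≈0 cᵢ≉0
        nonzero (suc i) cᵢ≉0 = i , cᵢ≉0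

      dimension-zero : ∀ {x} (U : Invariant x) → DimensionAtMost 0 U → ∀ {w} → Mem U w → w ≈ᵛ 0ᵛ
      dimension-zero U dim {w} w∈ y with c , (zero , c≉0) , dep ← dim (λ _ → w) (λ _ → w∈) =
        zero-product {c zero} c≉0 (trans (sym (+-identityʳ (c zero * w y))) (dep y))

      -- Descent on the dimension bound: a nonzero module that is not irreducible contains a nonzero
      -- proper invariant subspace, for which the bound drops by one.
      irreducible-submodule : ∀ {x} m (U : Invariant x) → DimensionAtMost m U →
        (∃ λ w → Mem U w × ¬ (w ≈ᵛ 0ᵛ)) → ∃ λ W → Irreducible W × W ⊆ᵐ U
      irreducible-submodule zero U dim (w , w∈ , w≉0) = contradiction (dimension-zero U dim w∈) w≉0
      irreducible-submodule {x} (suc m) U dim nonzero with em {P = Irreducible U}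
      ... | yes irr = U , irr , λ v∈ → v∈
      ... | no ¬irr
        with em {P = ∃ λ (U′ : Invariant x) → U′ ⊆ᵐ U × (∃ λ w → Mem U′ w × ¬ (w ≈ᵛ 0ᵛ)) × (∃ λ v → Mem U v × ¬ Mem U′ v)}
      ...   | yes (U′ , U′⊆U , nonzero′ , proper)
        with W , irr , W⊆U′ ← irreducible-submodule m U′ (proper-dimension U′ U U′⊆U proper dim) nonzero′ =
        W , irr , λ v∈ → U′⊆U (W⊆U′ v∈)
      ...   | no none = contradiction (nonzero , dichotomy) ¬irr
        where
        dichotomy : (U′ : Invariant x) → U′ ⊆ᵐ U → (∀ {v} → Mem U′ v → v ≈ᵛ 0ᵛ) ⊎ U ⊆ᵐ U′
        dichotomy U′ U′⊆U with em {P = ∃ λ w → Mem U′ w × ¬ (w ≈ᵛ 0ᵛ)}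
        ... | no zero′ = inj₁ λ {v} v∈ → decidable-stable em λ v≉0 → zero′ (v , v∈ , v≉0)
        ... | yes nonzero′ = inj₂ λ {v} v∈ → decidable-stable em λ v∉ → none (U′ , U′⊆U , nonzero′ , v , v∈ , v∉)

      E*-nonzero : ∀ {x} (W : Invariant x) {w} → Mem W w → ∀ {y} → ¬ (w y ≈ 0#) →
        NonzeroOn (E* (rel x y) x) W
      E*-nonzero {x} W {w} w∈ {y} wy≉0 = w , w∈ , λ E*w≈0 → wy≉0 (trans
        (sym (trans (*-congʳ {w y} (⟦⟧-yes (rel x y ≟ rel x y) ≡.refl)) (*-identityˡ (w y))))
        (trans (sym (diag-$ᵛ (A (rel x y) x) w y)) (E*w≈0 y)))

      -- For w = B ψ, moving B across gives ⟨w , w⟩ as the product of ψ with the adjoint word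
      -- applied to w, which stays in W.
      cyclic-⊥ : ∀ {x ψ} (W : Invariant x) → W ⊆ᵐ cyclic x ψ → (∀ {w} → Mem W w → ⟨ ψ , w ⟩ ≈ 0#) →
        ∀ {w} → Mem W w → w ≈ᵛ 0ᵛ
      cyclic-⊥ {x} {ψ} W W⊆ ψ⊥W {w} w∈ with B , B∈ , w≈ ← W⊆ w∈ = ⟨⟩-definite w
        (trans (⟨⟩-cong {v = w} w≈ (λ _ → refl))
          (trans (adjoint B ψ w) (ψ⊥W (Word-closed W (Word-adjoint B∈) w∈))))

      module SphereDesign (x y₀ : Fin n) (χ : V) (E-o : ∀ y z → E o y z ≈ E o y y)
        (design : ∀ j → 1 ℕ.≤ toℕ j → toℕ j ℕ.≤ toℕ (rel x y₀) → ∃₂ λ α β → ¬ (α ≈ 0# × β ≈ 0#) ×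
          ((α ∙ᵛ (E j $ᵛ (E* (rel x y₀) x $ᵛ χ))) +ᵛ (β ∙ᵛ (E j $ᵛ I x)) ≈ᵛ 0ᵛ))
        (endpoints : ∀ (W : Invariant x) → Irreducible W → ∀ r r* →
          IsEndpoint W r → IsDualEndpoint W r* →
          1 ℕ.≤ toℕ r → toℕ r ℕ.≤ toℕ (rel x y₀) → toℕ r* ℕ.≤ toℕ r)
        where

        open SphereComponent x y₀ χ

        -- The design condition starts at j = 1; for j = 0, E_0 ψ is a multiple of the sum of ψ.
        Eψ≈0 : ∀ j → toℕ j ℕ.≤ toℕ (rel x y₀) → E j $ᵛ ψ ≈ᵛ 0ᵛ
        Eψ≈0 j j≤δ = by-level (toℕ j) ≡.refl
          where
          by-level : ∀ m → toℕ j ≡ m → E j $ᵛ ψ ≈ᵛ 0ᵛ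
          by-level zero    eq = ≡.subst (λ i → E i $ᵛ ψ ≈ᵛ 0ᵛ)
            (Finₚ.toℕ-injective (≡.trans toℕ-o (≡.sym eq))) (Eψ-zero-constant o E-o)
          by-level (suc m) eq
            with α , β , nontrivial , dep ← design j (≡.subst (1 ℕ.≤_) (≡.sym eq) (ℕ.s≤s ℕ.z≤n)) j≤δ =
            Eψ-zero-dependent j α β nontrivial λ y → trans
              (+-congʳ (*-congˡ ($ᵛ-congʳ (E j) (λ z → sym (diag-$ᵛ sphere χ z)) y))) (dep y)

        module _ (W : Invariant x) (irr : Irreducible W) (W⊆ : W ⊆ᵐ cyclic x ψ) where

          -- The coordinate at `x` is ⟨B ψ , x̂⟩, and the adjoint of B maps x̂ to a radial vector,
          -- orthogonal to ψ. This forces r(W) ≥ 1.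
          at-x : ∀ {w} → Mem W w → w x ≈ 0#
          at-x {w} w∈ with B , B∈ , w≈ ← W⊆ w∈ = begin
            w x
              ≈⟨ trans (ΣX.single {λ y → w y * conj (I x y)} x λ y y≢x → trans
                   (*-congˡ {w y} (trans (conj-⟦⟧ (x ≟ y)) (⟦⟧-no (x ≟ y) (y≢x ∘ ≡.sym)))) (zeroʳ (w y)))
                   (trans (*-congˡ {w x} (trans (conj-⟦⟧ (x ≟ x)) (⟦⟧-yes (x ≟ x) ≡.refl))) (*-identityʳ (w x))) ⟨
            ⟨ w , I x ⟩         ≈⟨ ⟨⟩-cong {v = I x} w≈ (λ _ → refl) ⟩
            ⟨ B $ᵛ ψ , I x ⟩    ≈⟨ adjoint B ψ (I x) ⟩
            ⟨ ψ , B ᴴ $ᵛ I x ⟩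
              ≈⟨ ψ-⊥-radial (Word-closed (RadialInvariant x) (Word-adjoint B∈) unit-radial) ⟩
            0#                  ∎
            where
            unit-radial : Radial x (I x)
            unit-radial = record
              { matrix = I ; constant = I-constant ; agrees = λ z → symmetric I-constant x z }

          low-level : ∀ {w} → Mem W w → ∀ {r} → IsEndpoint W r → ∀ y → toℕ (rel x y) ℕ.< toℕ r → w y ≈ 0#
          low-level {w} w∈ (_ , least) y lt with em {P = w y ≈ 0#}
          ... | yes wy≈0 = wy≈0
          ... | no wy≉0  = contradiction (least (rel x y) (E*-nonzero W w∈ wy≉0)) (ℕₚ.<⇒≱ lt)

          positive-endpoint : ∀ r → IsEndpoint W r → 1 ℕ.≤ toℕ r
          positive-endpoint r ((w , w∈ , E*w≉0) , _) = by-level (toℕ r) ≡.refl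
            where
            by-level : ∀ m → toℕ r ≡ m → 1 ℕ.≤ m
            by-level (suc m) eq = ℕ.s≤s ℕ.z≤n
            by-level zero    eq = contradiction
              (λ y → trans (diag-$ᵛ (A r x) w y) (term y (rel x y ≟ r))) E*w≉0
              where
              term : ∀ y → Dec (rel x y ≡ r) → A r x y * w y ≈ 0#
              term y (no ≢)   = trans (*-congʳ (⟦⟧-no (rel x y ≟ r) ≢)) (zeroˡ _)
              term y (yes xy) = trans (*-congˡ (≡.subst (λ z → w z ≈ 0#)
                (rel-diagonal⁻¹ x y (≡.trans xy (Finₚ.toℕ-injective (≡.trans eq (≡.sym toℕ-o))))) (at-x w∈))) (zeroʳ _)

          open Splitting x (subspace W) (A-closed W) (ι-closed W)

          SplitInvariant : Invariant x
          SplitInvariant = record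
            { Mem = Split ; subspace = Split-subspace ; A-closed = Split-one-closed ; ι-closed = Split-ι-closed }


          -- A component on the sphere through `y₀` bounds r(W) by δ, so the hypothesis gives r* ≤
          -- r. The split vectors then include E_{r*} u ≠ 0, and irreducibility leaves only the
          -- whole of W.
          all-split : NonzeroOn (E* (rel x y₀) x) W → W ⊆ᵐ SplitInvariant
          all-split shell-nonzero
            with r , end@(_ , r-least) ← IsLeast-exists em (λ i → NonzeroOn (E* i x) W) (_ , shell-nonzero)
            with w , w∈ , w≉0 ← proj₁ irr
            with em {P = ∃ λ j → ¬ (E j $ᵛ w ≈ᵛ 0ᵛ)}
          ... | no none = contradiction (separating λ j → decidable-stable em λ Ew≉0 → none (j , Ew≉0)) w≉0
          ... | yes (j , Ew≉0)
            with r* , end*@((u , u∈ , Eu≉0) , _) ← IsLeast-exists em (λ j → NonzeroOn (E j) W) (j , w , w∈ , Ew≉0)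
            with proj₂ irr (SplitInvariant) Split⊆P
          ... | inj₂ W⊆Split = W⊆Split
          ... | inj₁ Split-zero = contradiction (Split-zero (dual-endpoint-split r*
                  (endpoints W irr r r* end end* (positive-endpoint r end) (r-least _ shell-nonzero))
                  (λ v∈ y lt → low-level v∈ {r} end y lt) u∈)) Eu≉0

          -- If W has a component on the sphere through `y₀`, `all-split` applies; if not, W
          -- vanishes on the support of ψ.
          ψ-⊥ : ∀ {w} → Mem W w → ⟨ ψ , w ⟩ ≈ 0#
          ψ-⊥ {w} w∈ with em {P = NonzeroOn (E* (rel x y₀) x) W}
          ... | yes shell-nonzero = Split-orthogonal (toℕ (rel x y₀))
                  (λ y ≢ → ψ-support y λ eq → ≢ (≡.cong toℕ eq)) Eψ≈0 (all-split shell-nonzero w∈)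
          ... | no shell-zero = ΣX.vanishing λ y → term y (rel x y ≟ rel x y₀)
            where
            term : ∀ y → Dec (rel x y ≡ rel x y₀) → ψ y * conj (w y) ≈ 0#
            term y (no ≢)   = trans (*-congʳ {conj (w y)} (ψ-support y ≢)) (zeroˡ (conj (w y)))
            term y (yes eq) with em {P = w y ≈ 0#}
            ... | yes wy≈0 = trans (*-congˡ {ψ y} (trans (conj-cong wy≈0) conj-0)) (zeroʳ (ψ y))
            ... | no wy≉0  = contradiction
                    (≡.subst (λ i → NonzeroOn (E* i x) W) eq (E*-nonzero W w∈ wy≉0)) shell-zero

        ψ≈0 : ψ ≈ᵛ 0ᵛ
        ψ≈0 with em {P = ψ ≈ᵛ 0ᵛ}
        ... | yes p = p
        ... | no ψ≉0
          with W , irr , W⊆ ← irreducible-submodule n (cyclic x ψ) (λ v _ → dependent n v)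
                 (ψ , (I , unit , λ y → sym (I-$ᵛ ψ y)) , ψ≉0)
          with w , w∈ , w≉0 ← proj₁ irr =
          contradiction (cyclic-⊥ W W⊆ (ψ-⊥ W irr W⊆) w∈) w≉0

        sphere-constant : ∀ {y z} → rel x y ≡ rel x y₀ → rel x z ≡ rel x y₀ → χ y ≈ χ z
        sphere-constant = all-or-none ψ≈0

-- Distances in a metric scheme.

module MetricScheme {n D : ℕ} (𝔛 : SymmetricAssociationScheme n D) (metric : Scheme.Metric 𝔛) where

  open SymmetricAssociationScheme 𝔛
  open Scheme 𝔛

  dist : Fin n → Fin n → ℕ
  dist x y = toℕ (rel x y)

  dist≤D : ∀ x y → dist x y ℕ.≤ D
  dist≤D x y = ℕₚ.≤-pred (Finₚ.toℕ<n (rel x y))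

  distance : ∀ x y → Distance x y (dist x y)
  distance x y = Equivalence.to (proj₂ metric (rel x y) x y) ≡.refl

  walk-dist : ∀ {k x y} → Walk k x y → dist x y ℕ.≤ k
  walk-dist {k} {x} {y} walk = ℕₚ.≮⇒≥ λ k<dist →
    proj₂ (distance x y) (fromℕ< k<dist) (≡.subst (λ l → Walk l x y) (≡.sym (Finₚ.toℕ-fromℕ< k<dist)) walk)

  walk-++ : ∀ {k l x y z} → Walk k x y → Walk l y z → Walk (k ℕ.+ l) x z
  walk-++ {zero}  ≡.refl          walk  = walk
  walk-++ {suc k} (w , xw , walk) walk′ = w , xw , walk-++ {k} walk walk′

  triangle : ∀ x y z → dist x z ℕ.≤ dist x y ℕ.+ dist y z
  triangle x y z = walk-dist (walk-++ (proj₁ (distance x y)) (proj₁ (distance y z)))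

  dist-sym : ∀ x y → dist x y ≡ dist y x
  dist-sym x y = ≡.cong toℕ (rel-symmetric x y)

  dist-refl : ∀ x → dist x x ≡ 0
  dist-refl x = ≡.cong toℕ (Equivalence.from (rel-diagonal x x) ≡.refl)

  dist-zero : ∀ {x y} → dist x y ≡ 0 → x ≡ y
  dist-zero {x} {y} eq = Equivalence.to (rel-diagonal x y) (Finₚ.toℕ-injective eq)

  Adj-sym : ∀ {x y} → Adj x y → Adj y x
  Adj-sym {x} {y} xy = ≡.trans (dist-sym y x) xy

  triangle-Adj : ∀ x {y z} → Adj y z → dist x z ℕ.≤ suc (dist x y)
  triangle-Adj x {y} {z} yz = ℕₚ.≤-trans (triangle x y z)
    (ℕₚ.≤-reflexive (≡.trans (≡.cong (dist x y ℕ.+_) yz) (ℕₚ.+-comm _ 1)))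

  geodesic : ∀ x y {m} → dist x y ≡ suc m → ∃ λ z → Adj x z × dist z y ≡ m
  geodesic x y {m} eq with z , xz , walk ← ≡.subst (λ l → Walk l x y) eq (proj₁ (distance x y)) =
    z , xz , ℕₚ.≤-antisym (walk-dist walk) (ℕₚ.≤-pred (≡.subst₂ ℕ._≤_ (≡.trans (dist-sym y x) eq)
      (≡.cong suc (dist-sym y z)) (triangle-Adj y (Adj-sym xz))))

-- The complex numbers as a field with definite conjugation.

module ComplexField (ℝ : RealNumbers) where

  open ComplexNumbers ℝ
  private
    module ℝ = RealNumbers ℝ
    module ℂ = CommutativeRing ℂ-commutativeRing
    open RingProperties ℝ.ring
    open IsStrictTotalOrder ℝ.isStrictTotalOrder using (compare; irrefl; <-respˡ-≈; <-respʳ-≈)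
      renaming (trans to <-trans)
    open SetoidReasoning ℝ.setoid

    0≤ : ℝ.Carrier → Set
    0≤ a = ℝ._≤_ ℝ.0# a

    0≤-≈ : ∀ {a b} → a ℝ.≈ b → 0≤ a → 0≤ b
    0≤-≈ a≈b 0≤a b<0 = 0≤a (<-respˡ-≈ (ℝ.sym a≈b) b<0)

    0≤0 : 0≤ ℝ.0#
    0≤0 = irrefl ℝ.refl

    pos⇒0≤ : ∀ {a} → ℝ.0# ℝ.< a → 0≤ a
    pos⇒0≤ 0<a a<0 = irrefl ℝ.refl (<-trans 0<a a<0)

    shift : ∀ {a b} → ℝ.0# ℝ.< a → b ℝ.< a ℝ.+ b
    shift {b = b} 0<a = <-respˡ-≈ (ℝ.+-identityˡ b) (ℝ.+-monoˡ-< b 0<a)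

    0≤-+ : ∀ {a b} → 0≤ a → 0≤ b → 0≤ (a ℝ.+ b)
    0≤-+ {a} {b} 0≤a 0≤b a+b<0 with compare ℝ.0# a
    ... | tri< 0<a _ _ = 0≤b (<-trans (shift 0<a) a+b<0)
    ... | tri≈ _ 0≈a _ = 0≤b (<-respˡ-≈ (ℝ.trans (ℝ.+-congʳ (ℝ.sym 0≈a)) (ℝ.+-identityˡ b)) a+b<0)
    ... | tri> _ _ a<0 = 0≤a a<0

    +-zeroˡ : ∀ {a b} → 0≤ a → 0≤ b → a ℝ.+ b ℝ.≈ ℝ.0# → a ℝ.≈ ℝ.0#
    +-zeroˡ {a} {b} 0≤a 0≤b eq with compare ℝ.0# a
    ... | tri< 0<a _ _ = contradiction (<-respʳ-≈ eq (shift 0<a)) 0≤b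
    ... | tri≈ _ 0≈a _ = ℝ.sym 0≈a
    ... | tri> _ _ a<0 = contradiction a<0 0≤a

    neg-mul : ∀ a b → ℝ.- a ℝ.* ℝ.- b ℝ.≈ a ℝ.* b
    neg-mul a b = begin
      ℝ.- a ℝ.* ℝ.- b        ≈⟨ -‿distribˡ-* a (ℝ.- b) ⟨
      ℝ.- (a ℝ.* ℝ.- b)      ≈⟨ ℝ.-‿cong (-‿distribʳ-* a b) ⟨
      ℝ.- (ℝ.- (a ℝ.* b))    ≈⟨ -‿involutive _ ⟩
      a ℝ.* b                ∎

    sq-cases : ∀ a → a ℝ.≈ ℝ.0# ⊎ ℝ.0# ℝ.< a ℝ.* a
    sq-cases a with compare ℝ.0# a
    ... | tri< 0<a _ _ = inj₂ (ℝ.*-pos 0<a 0<a)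
    ... | tri≈ _ 0≈a _ = inj₁ (ℝ.sym 0≈a)
    ... | tri> _ _ a<0 = inj₂ (<-respʳ-≈ (neg-mul a a) (ℝ.*-pos 0<-a 0<-a))
      where
      0<-a : ℝ.0# ℝ.< ℝ.- a
      0<-a = <-respʳ-≈ (ℝ.+-identityˡ _) (<-respˡ-≈ (ℝ.-‿inverseʳ a) (ℝ.+-monoˡ-< (ℝ.- a) a<0))

    0≤-sq : ∀ a → 0≤ (a ℝ.* a)
    0≤-sq a with sq-cases a
    ... | inj₁ a≈0 = 0≤-≈ (ℝ.sym (ℝ.trans (ℝ.*-congʳ a≈0) (ℝ.zeroˡ a))) 0≤0
    ... | inj₂ pos = pos⇒0≤ pos

    sq-zero : ∀ a → a ℝ.* a ℝ.≈ ℝ.0# → a ℝ.≈ ℝ.0#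
    sq-zero a eq with sq-cases a
    ... | inj₁ a≈0 = a≈0
    ... | inj₂ pos = contradiction (ℝ.sym eq) (λ 0≈aa → irrefl 0≈aa pos)

    norm : ℂ → ℝ.Carrier
    norm (a , b) = a ℝ.* a ℝ.+ b ℝ.* b

    mul-conj : ∀ z → mul z (conj z) ℂ.≈ (norm z , ℝ.0#)
    mul-conj (a , b) =
      ℝ.+-congˡ (ℝ.trans (ℝ.-‿cong (ℝ.sym (-‿distribʳ-* b b))) (-‿involutive _)) ,
      (begin
        a ℝ.* ℝ.- b ℝ.+ b ℝ.* a      ≈⟨ ℝ.+-cong (ℝ.sym (-‿distribʳ-* a b)) (ℝ.*-comm b a) ⟩
        ℝ.- (a ℝ.* b) ℝ.+ a ℝ.* b    ≈⟨ ℝ.-‿inverseˡ _ ⟩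
        ℝ.0#                         ∎)

    norm-zero : ∀ z → norm z ℝ.≈ ℝ.0# → z ℂ.≈ ℂ.0#
    norm-zero (a , b) eq =
      sq-zero a (+-zeroˡ (0≤-sq a) (0≤-sq b) eq) ,
      sq-zero b (+-zeroˡ (0≤-sq b) (0≤-sq a) (ℝ.trans (ℝ.+-comm _ _) eq))

    conj-mul : ∀ z w → conj (mul z w) ℂ.≈ mul (conj z) (conj w)
    conj-mul (a , b) (c , d) =
      ℝ.+-congˡ (ℝ.-‿cong (ℝ.sym (neg-mul b d))) ,
      (begin
        ℝ.- (a ℝ.* d ℝ.+ b ℝ.* c)            ≈⟨ -‿+-comm _ _ ⟨
        ℝ.- (a ℝ.* d) ℝ.+ ℝ.- (b ℝ.* c)      ≈⟨ ℝ.+-cong (-‿distribʳ-* a d) (-‿distribˡ-* b c) ⟩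
        a ℝ.* ℝ.- d ℝ.+ ℝ.- b ℝ.* c          ∎)

    reciprocal : ∀ z → ¬ (z ℂ.≈ ℂ.0#) → ∃ λ w → mul z w ℂ.≈ ℂ.1#
    reciprocal z z≉0 with y , Ny≈1 ← ℝ.inverse (norm z) (λ N≈0 → z≉0 (norm-zero z N≈0)) =
      mul (conj z) (y , ℝ.0#) ,
      ℂ.trans (ℂ.sym (ℂ.*-assoc z (conj z) (y , ℝ.0#)))
        (ℂ.trans (ℂ.*-congʳ {y , ℝ.0#} (mul-conj z))
          ( (begin
              norm z ℝ.* y ℝ.+ ℝ.- (ℝ.0# ℝ.* ℝ.0#)
                ≈⟨ ℝ.+-cong Ny≈1 (ℝ.trans (ℝ.-‿cong (ℝ.zeroˡ _)) -0#≈0#) ⟩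
              ℝ.1# ℝ.+ ℝ.0#   ≈⟨ ℝ.+-identityʳ _ ⟩
              ℝ.1#            ∎)
          , (begin
              norm z ℝ.* ℝ.0# ℝ.+ ℝ.0# ℝ.* y   ≈⟨ ℝ.+-cong (ℝ.zeroʳ _) (ℝ.zeroˡ _) ⟩
              ℝ.0# ℝ.+ ℝ.0#                    ≈⟨ ℝ.+-identityˡ _ ⟩
              ℝ.0#                             ∎)))

  ℂ-conjugationField : ConjugationField
  ℂ-conjugationField = record
    { commutativeRing = ℂ-commutativeRing
    ; 1≉0             = λ 1≈0 → irrefl (ℝ.sym (proj₁ 1≈0)) ℝ.0<1
    ; inverse         = reciprocal
    ; conj            = conj
    ; conj-cong       = λ (p , q) → p , ℝ.-‿cong q
    ; conj-+          = λ (a , b) (c , d) → ℝ.refl , ℝ.sym (-‿+-comm b d)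
    ; conj-*          = conj-mul
    ; conj-involutive = λ (a , b) → ℝ.refl , -‿involutive b
    ; NonNegative     = λ (a , b) → 0≤ a × b ℝ.≈ ℝ.0#
    ; nonNegative-≈   = λ (p , q) (r , s) → 0≤-≈ p r , ℝ.trans (ℝ.sym q) s
    ; nonNegative-0   = 0≤0 , ℝ.refl
    ; nonNegative-+   = λ (p , q) (r , s) → 0≤-+ p r , ℝ.trans (ℝ.+-cong q s) (ℝ.+-identityˡ _)
    ; nonNegative-sq  = λ z@(a , b) →
        0≤-≈ (ℝ.sym (proj₁ (mul-conj z))) (0≤-+ (0≤-sq a) (0≤-sq b)) , proj₂ (mul-conj z)
    ; summand-zero    = λ (p , q) (r , s) (t , _) → +-zeroˡ p r t , q
    ; square-zero     = λ {z} eq → norm-zero z (ℝ.trans (ℝ.sym (proj₁ (mul-conj z))) (proj₁ eq))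
    }

-- Counting by explicit points.

record Enumeration {n} {P : Fin n → Set} (P? : Decidable P) : Set where
  field
    item      : Fin (count P?) → Fin n
    injective : ∀ {i j} → item i ≡ item j → i ≡ j
    sound     : ∀ i → P (item i)
    complete  : ∀ {z} → P z → ∃ λ i → item i ≡ z

enumeration : ∀ {n} {P : Fin n → Set} (P? : Decidable P) → Enumeration P?
enumeration {n} {P} P? = let f , inj , P-f , onto = go n id in record
  { item = f ; injective = inj ; sound = P-f ; complete = onto _ }
  where
  go : ∀ k (g : Fin k → Fin n) → ∃ λ (f : Fin (Vec.count P? (Vec.tabulate g)) → Fin k) →
    (∀ {i j} → f i ≡ f j → i ≡ j) × (∀ i → P (g (f i))) × (∀ z → P (g z) → ∃ λ i → f i ≡ z)
  go zero    g = (λ ()) , (λ { {()} }) , (λ ()) , (λ ())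
  go (suc k) g with P? (g zero) | go k (g ∘ suc)
  ... | no ¬p | f , inj , P-f , onto = suc ∘ f , (λ eq → inj (Finₚ.suc-injective eq)) , P-f ,
    λ { zero p → contradiction p ¬p ; (suc z) p → let i , eq = onto z p in i , ≡.cong suc eq }
  ... | yes p | f , inj , P-f , onto = f′ , inj′ , (λ { zero → p ; (suc i) → P-f i }) ,
    λ { zero _ → zero , ≡.refl ; (suc z) p → let i , eq = onto z p in suc i , ≡.cong suc eq }
    where
    f′ : Fin (suc _) → Fin (suc k)
    f′ zero    = zero
    f′ (suc i) = suc (f i)
    inj′ : ∀ {i j} → f′ i ≡ f′ j → i ≡ j
    inj′ {zero}  {zero}  _  = ≡.refl
    inj′ {zero}  {suc j} ()
    inj′ {suc i} {zero}  ()
    inj′ {suc i} {suc j} eq = ≡.cong suc (inj (Finₚ.suc-injective eq))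

-- A lower bound on a count in the form of explicit points, so that it can be moved between sets of
-- equal size.
Distinct : ∀ {n} → (Fin n → Set) → ℕ → Set
Distinct {n} P k = ∃ λ (g : Fin k → Fin n) → (∀ {i j} → g i ≡ g j → i ≡ j) × (∀ i → P (g i))

distinct-transfer : ∀ {n} {P Q : Fin n → Set} (P? : Decidable P) (Q? : Decidable Q) →
  count P? ≡ count Q? → ∀ {k} → Distinct P k → Distinct Q k
distinct-transfer {n} {P} {Q} P? Q? eq {k} (g , g-inj , P-g) = h , h-inj , λ i → Q.sound _
  where
  module P = Enumeration (enumeration P?)
  module Q = Enumeration (enumeration Q?)
  index : Fin k → Fin (count P?)
  index i = proj₁ (P.complete (P-g i))
  h : Fin k → Fin n
  h i = Q.item (Fin.cast eq (index i))
  h-inj : ∀ {i j} → h i ≡ h j → i ≡ j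
  h-inj {i} {j} hi≡hj = g-inj (≡.trans (≡.sym (proj₂ (P.complete (P-g i)))) (≡.trans
    (≡.cong P.item (cast-inj (Q.injective hi≡hj))) (proj₂ (P.complete (P-g j)))))
    where
    cast-inj : ∀ {a b : Fin (count P?)} → Fin.cast eq a ≡ Fin.cast eq b → a ≡ b
    cast-inj {a} {b} c = Finₚ.toℕ-injective
      (≡.trans (≡.sym (Finₚ.toℕ-cast eq a)) (≡.trans (≡.cong toℕ c) (Finₚ.toℕ-cast eq b)))

pair : ∀ {n} {P : Fin n → Set} {a b} → a ≢ b → P a → P b → Distinct P 2
pair {n} {P} {a} {b} a≢b Pa Pb = g , g-inj , λ { zero → Pa ; (suc zero) → Pb }
  where
  g : Fin 2 → Fin n
  g zero       = a
  g (suc zero) = b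
  g-inj : ∀ {i j} → g i ≡ g j → i ≡ j
  g-inj {zero}     {zero}     _  = ≡.refl
  g-inj {zero}     {suc zero} eq = contradiction eq a≢b
  g-inj {suc zero} {zero}     eq = contradiction (≡.sym eq) a≢b
  g-inj {suc zero} {suc zero} _  = ≡.refl

distinct-count : ∀ {n} {P : Fin n → Set} (P? : Decidable P) {k} → Distinct P k → k ℕ.≤ count P?
distinct-count P? (g , g-inj , P-g) = Finₚ.injective⇒≤ {f = λ i → proj₁ (complete (P-g i))}
  λ {i} {j} eq → g-inj (≡.trans (≡.sym (proj₂ (complete (P-g i))))
    (≡.trans (≡.cong item eq) (proj₂ (complete (P-g j)))))
  where open Enumeration (enumeration P?)

-- Codes that contain every δ-sphere around a codeword which they meet.

module SchemeTheory {n D : ℕ} (𝔛 : SymmetricAssociationScheme n D) (metric : Scheme.Metric 𝔛) where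

  open SymmetricAssociationScheme 𝔛
  open Scheme 𝔛
  open MetricScheme 𝔛 metric

  rel-dist : ∀ {x y x′ y′} → dist x y ≡ dist x′ y′ → rel x y ≡ rel x′ y′
  rel-dist = Finₚ.toℕ-injective

  At : ℕ → ℕ → Fin n → Fin n → Fin n → Set
  At i j x y z = dist x z ≡ i × dist z y ≡ j

  -- `i` and `j` are bare numbers that could exceed D; the first point supplies relations with these
  -- distances, which then index the intersection number. Hence `suc k`.
  At-transfer : ∀ {x y x′ y′} → dist x y ≡ dist x′ y′ →
    ∀ {i j k} → Distinct (At i j x y) (suc k) → Distinct (At i j x′ y′) (suc k)
  At-transfer {x} {y} {x′} {y′} eq {i} {j} {k} (g , g-inj , at)
    with h , h-inj , at′ ← distinct-transfer
           (λ z → (rel x z ≟ rel x (g zero)) ×-dec (rel z y ≟ rel (g zero) y))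
           (λ z → (rel x′ z ≟ rel x (g zero)) ×-dec (rel z y′ ≟ rel (g zero) y))
           (≡.trans (p-intersection _ _ x y)
             (≡.trans (≡.cong (p _ _) (rel-dist eq)) (≡.sym (p-intersection _ _ x′ y′))))
           (g , g-inj , λ a → rel-dist (≡.trans (proj₁ (at a)) (≡.sym (proj₁ (at zero)))) ,
                              rel-dist (≡.trans (proj₂ (at a)) (≡.sym (proj₂ (at zero))))) =
    h , h-inj , λ a → ≡.trans (≡.cong toℕ (proj₁ (at′ a))) (proj₁ (at zero)) ,
                      ≡.trans (≡.cong toℕ (proj₂ (at′ a))) (proj₂ (at zero))

  transfer : ∀ {x y x′ y′} → dist x y ≡ dist x′ y′ →
    ∀ z → ∃ λ z′ → dist x′ z′ ≡ dist x z × dist z′ y′ ≡ dist z y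
  transfer {x} {y} eq z
    with h , _ , at ← At-transfer eq {dist x z} {dist z y} {0}
           ((λ _ → z) , (λ { {zero} {zero} _ → ≡.refl }) , λ _ → ≡.refl , ≡.refl) =
    h zero , at zero

  exists-at : ∀ x {k} → k ℕ.≤ D → ∃ λ z → dist x z ≡ k
  exists-at x {k} k≤D with rel-nonempty (fromℕ< (ℕ.s≤s k≤D))
  ... | a , b , ab with z , xz , _ ← transfer (≡.trans (dist-refl a) (≡.sym (dist-refl x))) b =
    z , ≡.trans xz (≡.trans (≡.cong toℕ ab) (Finₚ.toℕ-fromℕ< (ℕ.s≤s k≤D)))

  ¬Adj-refl : ∀ {x} → ¬ Adj x x
  ¬Adj-refl {x} adj with () ← ≡.trans (≡.sym (dist-refl x)) adj

  triangle-Adj′ : ∀ {x y z} → Adj x y → dist x z ℕ.≤ suc (dist y z)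
  triangle-Adj′ {x} {y} {z} xy = ≡.subst₂ (λ a b → a ℕ.≤ suc b) (dist-sym z x) (dist-sym z y)
    (triangle-Adj z (Adj-sym xy))

  close : ∀ {x y z} → Adj x y → Adj y z → x ≡ z ⊎ Adj x z ⊎ dist x z ≡ 2
  close {x} {y} {z} xy yz with dist x z in eq | triangle-Adj x yz
  ... | 0 | _ = inj₁ (dist-zero eq)
  ... | 1 | _ = inj₂ (inj₁ ≡.refl)
  ... | 2 | _ = inj₂ (inj₂ ≡.refl)
  ... | suc (suc (suc _)) | le with ℕ.s≤s (ℕ.s≤s ()) ← ≡.subst (λ e → _ ℕ.≤ suc e) xy le

  middle : ∀ {x y z} → dist x z ≡ 2 → Adj x y → ¬ Adj x z
  middle xz xy adj with () ← ≡.trans (≡.sym xz) adj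

  module CodeTheory (Y : Subset n) (δ : ℕ) (1≤δ : 1 ℕ.≤ δ)
    (separated : ∀ {x y} → x ∈ Y → y ∈ Y → x ≢ y → δ ℕ.≤ dist x y)
    (sphere-closed : ∀ {x y z} → x ∈ Y → y ∈ Y → dist x y ≡ δ → dist x z ≡ δ → z ∈ Y)
    {x₀ y₀ : Fin n} (x₀∈Y : x₀ ∈ Y) (y₀∈Y : y₀ ∈ Y) (x₀y₀ : dist x₀ y₀ ≡ δ)
    where

    -- `sphere-closed` says nothing about a codeword whose δ-sphere misses Y; this stronger property
    -- propagates along steps of length δ.
    Attaining : Fin n → Set
    Attaining x = x ∈ Y × ∃ λ y → y ∈ Y × dist x y ≡ δ

    attaining-x₀ : Attaining x₀
    attaining-x₀ = x₀∈Y , y₀ , y₀∈Y , x₀y₀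

    attaining-step : ∀ {x z} → Attaining x → dist x z ≡ δ → Attaining z
    attaining-step {x} {z} (x∈Y , y , y∈Y , xy) xz =
      sphere-closed x∈Y y∈Y xy xz , x , x∈Y , ≡.trans (dist-sym z x) xz

    from-x₀ : ∀ {z} → dist x₀ z ≡ δ → z ∈ Y
    from-x₀ xz = proj₁ (attaining-step attaining-x₀ xz)

    δ≤D : δ ℕ.≤ D
    δ≤D = ≡.subst (ℕ._≤ D) x₀y₀ (dist≤D x₀ y₀)

    separated⁻¹ : ∀ {x y} → x ∈ Y → y ∈ Y → dist x y ℕ.< δ → x ≡ y
    separated⁻¹ {x} {y} x∈Y y∈Y lt = decidable-stable (x ≟ y) λ x≢y → ℕₚ.<⇒≱ lt (separated x∈Y y∈Y x≢y)

    connected-full : δ ≡ 1 → ∀ z → z ∈ Y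
    connected-full ≡.refl z = proj₁ (go (dist x₀ z) attaining-x₀ (proj₁ (distance x₀ z)))
      where
      go : ∀ k {x} → Attaining x → Walk k x z → Attaining z
      go zero    att ≡.refl         = att
      go (suc k) att (w , xw , walk) = go k (attaining-step att xw) walk

    -- Transferred to `x₀` and `y₀`, the point `w` becomes a codeword adjacent to the codeword `y₀`,
    -- which is closer than δ.
    no-equilateral : ∀ {x z w} → 2 ℕ.≤ δ → dist x z ≡ δ → dist x w ≡ δ → ¬ Adj w z
    no-equilateral {x} {z} {w} 2≤δ xz xw wz
      with w′ , xw′ , wz′ ← transfer {x} {z} {x₀} {y₀} (≡.trans xz (≡.sym x₀y₀)) w =
      ¬Adj-refl (≡.subst (λ u → Adj u y₀) (separated⁻¹ (from-x₀ (≡.trans xw′ xw)) y₀∈Y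
        (≡.subst (ℕ._< δ) (≡.sym (≡.trans wz′ wz)) 2≤δ)) (≡.trans wz′ wz))

    module DistanceTwo (δ≡2 : δ ≡ 2) (3≤D : 3 ℕ.≤ D) where

      no-isosceles : ∀ {x z w} → dist x z ≡ 2 → dist x w ≡ 2 → ¬ Adj w z
      no-isosceles xz xw = no-equilateral (ℕₚ.≤-reflexive (≡.sym δ≡2))
        (≡.trans xz (≡.sym δ≡2)) (≡.trans xw (≡.sym δ≡2))

      -- A common neighbour of the two middle vertices of a geodesic of length
      -- three would be adjacent to both of its ends.
      triangle-free : ∀ {a b c} → Adj a b → Adj b c → ¬ Adj a c
      triangle-free {a} {b} {c} ab bc ac
        with s , ps ← exists-at x₀ 3≤D
        with q , pq , qs ← geodesic x₀ s ps
        with r , qr , rs ← geodesic q s qs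
        with u , qu , ur ← transfer {a} {b} {q} {r} (≡.trans ab (≡.sym qr)) c = conclude (close pq qu′) (close u~r rs)
        where
        qu′ : Adj q u
        qu′ = ≡.trans qu ac
        u~r : Adj u r
        u~r = ≡.trans ur (≡.trans (dist-sym c b) bc)
        pr : dist x₀ r ≡ 2
        pr with close pq qr
        ... | inj₁ ≡.refl with () ← ≡.trans (≡.sym ps) rs
        ... | inj₂ (inj₂ pr) = pr
        ... | inj₂ (inj₁ pr) with ℕ.s≤s (ℕ.s≤s ()) ← ≡.subst₂ (λ i j → i ℕ.≤ suc j) ps rs (triangle-Adj′ {x₀} {r} {s} pr)
        conclude : x₀ ≡ u ⊎ Adj x₀ u ⊎ dist x₀ u ≡ 2 → u ≡ s ⊎ Adj u s ⊎ dist u s ≡ 2 → _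
        conclude (inj₁ ≡.refl)      _ = middle pr pq u~r
        conclude (inj₂ (inj₂ pu))   _ = no-isosceles pr pu u~r
        conclude (inj₂ (inj₁ pu)) (inj₁ ≡.refl) = middle qs qr qu′
        conclude (inj₂ (inj₁ pu)) (inj₂ (inj₁ us))
          with ℕ.s≤s (ℕ.s≤s ()) ← ≡.subst₂ (λ i j → i ℕ.≤ suc j) ps us (triangle-Adj′ {x₀} {u} {s} pu)
        conclude (inj₂ (inj₁ pu)) (inj₂ (inj₂ us)) =
          no-isosceles (≡.trans (dist-sym s q) qs) (≡.trans (dist-sym s u) us) (Adj-sym qu′)

      -- Induction along a walk to `x₀`: a neighbour v of a vertex next to an attaining c has
      -- distance 0, 1 or 2 from c. Distance 1 would close a triangle, and distance 2 makes v
      -- attaining.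
      covered : ∀ v → Attaining v ⊎ ∃ λ c → Attaining c × Adj c v
      covered v = go (dist v x₀) (proj₁ (distance v x₀))
        where
        go : ∀ k {v} → Walk k v x₀ → Attaining v ⊎ ∃ λ c → Attaining c × Adj c v
        go zero    ≡.refl = inj₁ attaining-x₀
        go (suc k) {v} (z , vz , walk) with go k walk
        ... | inj₁ z-att = inj₂ (z , z-att , Adj-sym vz)
        ... | inj₂ (c , c-att , cz) with close cz (Adj-sym vz)
        ...   | inj₁ ≡.refl      = inj₁ c-att
        ...   | inj₂ (inj₁ cv)   = contradiction cv (triangle-free cz (Adj-sym vz))
        ...   | inj₂ (inj₂ cv)   = inj₁ (attaining-step c-att (≡.trans cv (≡.sym δ≡2)))

      independent : ∀ {a b} → a ∈ Y → b ∈ Y → ¬ Adj a b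
      independent a∈Y b∈Y ab = ¬Adj-refl (≡.subst (Adj _) (≡.sym (separated⁻¹ a∈Y b∈Y
        (≡.subst₂ ℕ._<_ (≡.sym ab) (≡.sym δ≡2) ℕₚ.≤-refl))) ab)

      bipartition : IsBipartition Y
      bipartition a b ab with a ∈? Y
      ... | yes a∈Y = inj₁ (a∈Y , λ b∈Y → independent a∈Y b∈Y ab)
      -- An attaining neighbour `c` of `a` lies at distance 0 or 2 from any other neighbour, which
      -- is therefore a codeword.
      ... | no a∉Y with covered a
      ...   | inj₁ (a∈Y , _) = contradiction a∈Y a∉Y
      ...   | inj₂ (c , c-att , ca) with close ca ab
      ...     | inj₁ ≡.refl    = inj₂ (a∉Y , proj₁ c-att)
      ...     | inj₂ (inj₁ cb) = contradiction cb (triangle-free ca ab)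
      ...     | inj₂ (inj₂ cb) = inj₂ (a∉Y , proj₁ (attaining-step c-att (≡.trans cb (≡.sym δ≡2))))

    module DistanceBetween (3≤δ : 3 ℕ.≤ δ) (δ<D : δ ℕ.< D) where

      -- Transferred to x₀, both u and v are codewords, at distance at most 2.
      unique-neighbour : ∀ {x y u v} → dist x u ≡ δ → dist x v ≡ δ → Adj u y → Adj v y → u ≡ v
      unique-neighbour {x} {y} {u} {v} xu xv uy vy = decidable-stable (u ≟ v) contra
        where
        contra : u ≢ v → _
        contra u≢v
          with z , x₀z ← exists-at x₀ (dist≤D x y)
          with g , g-inj , at ← At-transfer {x} {y} {x₀} {z} (≡.sym x₀z) (pair u≢v (xu , uy) (xv , vy)) =
          contradiction (g-inj {zero} {suc zero} (separated⁻¹ (from-x₀ (proj₁ (at zero))) (from-x₀ (proj₁ (at (suc zero))))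
            (ℕₚ.≤-trans (ℕ.s≤s (ℕₚ.≤-trans (triangle-Adj (g zero) (Adj-sym (proj₂ (at (suc zero)))))
              (ℕ.s≤s (ℕₚ.≤-reflexive (proj₂ (at zero)))))) 3≤δ))) λ ()

      m : ℕ
      m = ℕ.pred δ

      δ≡1+m : δ ≡ suc m
      δ≡1+m = ≡.sym (ℕₚ.suc-pred δ {{ℕ.>-nonZero 1≤δ}})

      side : Fin n → Fin 2
      side w with dist x₀ w ℕₚ.<? δ
      ... | yes _ = zero
      ... | no _  = suc zero

      -- Among three neighbours of `y₀` two lie on the same side of distance δ from `x₀`, distance δ
      -- itself being excluded by `no-equilateral`. A suitable neighbour x of `x₀` is at distance
      -- exactly δ from both, contradicting `unique-neighbour`.
      at-most-two : ∀ {y} → ¬ Distinct (λ w → Adj y w) 3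
      at-most-two {y} (g , g-inj , adj)
        with h , h-inj , at ← At-transfer {y} {y} {y₀} {y₀} (≡.trans (dist-refl y) (≡.sym (dist-refl y₀)))
               {1} {1} {2} (g , g-inj , λ i → adj i , Adj-sym (adj i))
        with i , j , i<j , same ← Finₚ.pigeonhole {2} {3} (ℕ.s≤s (ℕ.s≤s (ℕ.s≤s ℕ.z≤n))) (λ i → side (h i)) =
        contradiction (h-inj (equal (proj₁ (at i)) (proj₁ (at j)) same)) (Finₚ.<⇒≢ i<j)
        where
        upper : ∀ {w} → Adj y₀ w → dist x₀ w ℕ.≤ suc δ
        upper {w} yw = ≡.subst (λ e → dist x₀ w ℕ.≤ suc e) x₀y₀ (triangle-Adj x₀ yw)
        lower : ∀ {w} → Adj y₀ w → δ ℕ.≤ suc (dist x₀ w)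
        lower {w} yw = ≡.subst (ℕ._≤ suc (dist x₀ w)) x₀y₀ (triangle-Adj x₀ (Adj-sym yw))
        off : ∀ {w} → Adj y₀ w → dist x₀ w ≢ δ
        off yw eq = no-equilateral (ℕₚ.≤-trans (ℕₚ.n≤1+n 2) 3≤δ) x₀y₀ eq (Adj-sym yw)
        -- Such an x exists around `y₀` for some vertex at distance δ, because δ < D; regularity
        -- moves it to `x₀`.
        away : ∃ λ x → Adj x x₀ × dist x y₀ ≡ suc δ
        away with z , yz ← exists-at y₀ δ<D
             with z′ , zz′ , z′y ← geodesic z y₀ (≡.trans (dist-sym z y₀) yz)
             with x , yx , xx₀ ← transfer {y₀} {z′} {y₀} {x₀}
                    (≡.trans (dist-sym y₀ z′) (≡.trans z′y (≡.trans (≡.sym x₀y₀) (dist-sym x₀ y₀)))) z =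
             x , ≡.trans xx₀ zz′ , ≡.trans (dist-sym x y₀) (≡.trans yx yz)
        toward : ∃ λ x → Adj x₀ x × dist x y₀ ≡ m
        toward = geodesic x₀ y₀ (≡.trans x₀y₀ (δ≡1+m))
        equal : ∀ {u v} → Adj y₀ u → Adj y₀ v → side u ≡ side v → u ≡ v
        equal {u} {v} yu yv same with dist x₀ u ℕₚ.<? δ | dist x₀ v ℕₚ.<? δ
        ... | yes u< | yes v< = let x , xx₀ , xy = away in
              unique-neighbour (level x xx₀ xy yu u<) (level x xx₀ xy yv v<) (Adj-sym yu) (Adj-sym yv)
          where
          level : ∀ x → Adj x x₀ → dist x y₀ ≡ suc δ → ∀ {w} → Adj y₀ w → dist x₀ w ℕ.< δ → dist x w ≡ δ
          level x xx₀ xy {w} yw lt = ℕₚ.≤-antisym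
            (ℕₚ.≤-trans (triangle-Adj′ xx₀) lt)
            (ℕₚ.≤-pred (≡.subst (ℕ._≤ suc (dist x w)) xy (triangle-Adj x (Adj-sym yw))))
        ... | no u≮ | no v≮ = let x , x₀x , xy = toward in
              unique-neighbour (level x x₀x xy yu u≮) (level x x₀x xy yv v≮) (Adj-sym yu) (Adj-sym yv)
          where
          level : ∀ x → Adj x₀ x → dist x y₀ ≡ m → ∀ {w} → Adj y₀ w → ¬ dist x₀ w ℕ.< δ → dist x w ≡ δ
          level x x₀x xy {w} yw ≮ = ℕₚ.≤-antisym
            (≡.subst (dist x w ℕ.≤_) (≡.trans (≡.cong suc xy) (≡.sym (δ≡1+m))) (triangle-Adj x yw))
            (ℕₚ.≤-pred (ℕₚ.≤-trans (ℕₚ.≤∧≢⇒< (ℕₚ.≮⇒≥ ≮) (off yw ∘ ≡.sym)) (triangle-Adj′ x₀x)))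

      -- An inner vertex of a geodesic has a predecessor and a successor, and the valency is
      -- constant.
      at-least-two : ∀ y → Distinct (λ w → Adj y w) 2
      at-least-two y
        with z , x₀z ← exists-at x₀ δ<D
        with b , zb , bx ← geodesic z x₀ (≡.trans (dist-sym z x₀) x₀z)
        with a , ba , ax ← geodesic b x₀ (≡.trans bx (δ≡1+m))
        with g , g-inj , at ← At-transfer {b} {b} {y} {y} (≡.trans (dist-refl b) (≡.sym (dist-refl y))) {1} {1} {1}
               (pair {a = z} {b = a} (λ { ≡.refl → ℕₚ.m≢1+n+m m (≡.trans (≡.sym ax)
                   (≡.trans (dist-sym z x₀) (≡.trans x₀z (≡.cong suc (δ≡1+m))))) })
                 (Adj-sym zb , zb) (ba , Adj-sym ba)) =
        g , g-inj , λ i → proj₁ (at i)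

    module DistanceMaximal (δ≡D : δ ≡ D) where

      1≤D : 1 ℕ.≤ D
      1≤D = ≡.subst (1 ℕ.≤_) δ≡D 1≤δ

      -- With `x`, `y` moved to `x₀`, `y₀`, the image of `z` is a codeword; it equals `y₀` or is at
      -- distance at least δ = D from it.
      antipodal-transitive : ∀ {x y z} → dist x y ≡ D → dist x z ≡ D → y ≡ z ⊎ dist y z ≡ D
      antipodal-transitive {x} {y} {z} xy xz
        with z′ , xz′ , zy′ ← transfer {x} {y} {x₀} {y₀} (≡.trans xy (≡.trans (≡.sym δ≡D) (≡.sym x₀y₀))) z
        with z′ ≟ y₀
      ... | yes ≡.refl = inj₁ (≡.sym (dist-zero (≡.trans (≡.sym zy′) (dist-refl y₀))))
      ... | no z′≢y₀   = inj₂ (ℕₚ.≤-antisym (dist≤D y z) (≡.subst (D ℕ.≤_) (≡.trans zy′ (dist-sym z y))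
              (≡.subst (ℕ._≤ dist z′ y₀) δ≡D
                (separated (from-x₀ (≡.trans xz′ (≡.trans xz (≡.sym δ≡D)))) y₀∈Y z′≢y₀))))

      rel⇒dist : ∀ {x y} → rel x y ≡ fromℕ D → dist x y ≡ D
      rel⇒dist eq = ≡.trans (≡.cong toℕ eq) (Finₚ.toℕ-fromℕ D)

      dist⇒rel : ∀ {x y} → dist x y ≡ D → rel x y ≡ fromℕ D
      dist⇒rel eq = Finₚ.toℕ-injective (≡.trans eq (≡.sym (Finₚ.toℕ-fromℕ D)))

      module _ (antipode-unique : ∀ {x y z} → dist x y ≡ D → dist x z ≡ D → y ≡ z) where

        double-cover : AntipodalDoubleCover
        double-cover = record { refl = inj₁ ≡.refl ; sym = symm ; trans = transitive } , two
          where
          symm : ∀ {x y} → AntipodalRel x y → AntipodalRel y x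
          symm (inj₁ eq) = inj₁ (≡.sym eq)
          symm (inj₂ xy) = inj₂ (≡.trans (rel-symmetric _ _) xy)
          transitive : ∀ {x y z} → AntipodalRel x y → AntipodalRel y z → AntipodalRel x z
          transitive (inj₁ ≡.refl) yz = yz
          transitive (inj₂ xy) (inj₁ ≡.refl) = inj₂ xy
          transitive {x} {y} {z} (inj₂ xy) (inj₂ yz) =
            inj₁ (antipode-unique (rel⇒dist (≡.trans (rel-symmetric y x) xy)) (rel⇒dist yz))
          two : ∀ y → count (λ z → (y ≟ z) ⊎-dec (rel y z ≟ fromℕ D)) ≡ 2
          two y with y* , yy* ← exists-at y {D} ℕₚ.≤-refl = ℕₚ.≤-antisym (ℕₚ.≮⇒≥ not-three)
            (distinct-count P? (pair {P = λ z → y ≡ z ⊎ rel y z ≡ fromℕ D} {a = y} {b = y*} y≢y* (inj₁ ≡.refl) (inj₂ (dist⇒rel yy*))))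
            where
            P? : Decidable (λ z → y ≡ z ⊎ rel y z ≡ fromℕ D)
            P? z = (y ≟ z) ⊎-dec (rel y z ≟ fromℕ D)
            y≢y* : y ≢ y*
            y≢y* ≡.refl = ℕₚ.<⇒≢ 1≤D (≡.trans (≡.sym (dist-refl y)) yy*)
            open Enumeration (enumeration P?)
            side : ∀ z → y ≡ z ⊎ rel y z ≡ fromℕ D → Fin 2
            side z (inj₁ _) = zero
            side z (inj₂ _) = suc zero
            not-three : ¬ 2 ℕ.< count P?
            not-three 2<count
              with i , j , i<j , same ← Finₚ.pigeonhole 2<count (λ i → side (item i) (sound i)) =
              Finₚ.<⇒≢ i<j (injective (equal (sound i) (sound j) same))
              where
              equal : ∀ {u v} (p : y ≡ u ⊎ rel y u ≡ fromℕ D) (q : y ≡ v ⊎ rel y v ≡ fromℕ D) →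
                      side u p ≡ side v q → u ≡ v
              equal (inj₁ yu) (inj₁ yv) _ = ≡.trans (≡.sym yu) yv
              equal (inj₂ yu) (inj₂ yv) _ = antipode-unique (rel⇒dist yu) (rel⇒dist yv)

        antipodal-pair : IsAntipodalPair Y
        antipodal-pair = x₀ , y₀ , dist⇒rel (≡.trans x₀y₀ δ≡D) , Subsetₚ.⊆-antisym into out
          where
          into : ∀ {z} → z ∈ Y → z ∈ ⁅ x₀ ⁆ ∪ ⁅ y₀ ⁆
          into {z} z∈Y with z ≟ x₀
          ... | yes ≡.refl = Subsetₚ.x∈p∪q⁺ (inj₁ (Subsetₚ.x∈⁅x⁆ x₀))
          ... | no z≢x₀    = Subsetₚ.x∈p∪q⁺ {p = ⁅ x₀ ⁆} (inj₂ (≡.subst (λ u → u ∈ ⁅ y₀ ⁆)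
            (antipode-unique (≡.trans x₀y₀ δ≡D) (ℕₚ.≤-antisym (dist≤D x₀ z)
              (≡.subst (ℕ._≤ dist x₀ z) δ≡D (separated x₀∈Y z∈Y (z≢x₀ ∘ ≡.sym))))) (Subsetₚ.x∈⁅x⁆ y₀)))
          out : ∀ {z} → z ∈ ⁅ x₀ ⁆ ∪ ⁅ y₀ ⁆ → z ∈ Y
          out z∈ with Subsetₚ.x∈p∪q⁻ ⁅ x₀ ⁆ ⁅ y₀ ⁆ z∈
          ... | inj₁ z∈x = ≡.subst (_∈ Y) (≡.sym (Subsetₚ.x∈⁅y⁆⇒x≡y x₀ z∈x)) x₀∈Y
          ... | inj₂ z∈y = ≡.subst (_∈ Y) (≡.sym (Subsetₚ.x∈⁅y⁆⇒x≡y y₀ z∈y)) y₀∈Y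

-- Walking without turning back in a finite 2-regular graph, the first vertex
-- to be revisited is the starting point.
module TwoRegularGraph (em : ∀ {ℓ} → ExcludedMiddle ℓ) {n : ℕ} (Adj : Rel (Fin n) 0ℓ) (adj? : Decidable₂ Adj)
  (Adj-sym : ∀ {x y} → Adj x y → Adj y x) (Adj-irrefl : ∀ {x} → ¬ Adj x x)
  (connected : Graph.Connected Adj adj?)
  (at-least-two : ∀ y → Distinct (Adj y) 2) (at-most-two : ∀ {y} → ¬ Distinct (Adj y) 3)
  (start : Fin n) where

  open Graph Adj adj?

  only-two : ∀ {b a c d} → Adj b a → Adj b c → a ≢ c → Adj b d → d ≡ a ⊎ d ≡ c
  only-two {b} {a} {c} {d} ba bc a≢c bd with d ≟ a | d ≟ c
  ... | yes d≡a | _       = inj₁ d≡a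
  ... | no _    | yes d≡c = inj₂ d≡c
  ... | no d≢a  | no d≢c  = contradiction (g , (λ {i} {j} → g-inj {i} {j}) , adj) at-most-two
    where
    g : Fin 3 → Fin n
    g zero             = a
    g (suc zero)       = c
    g (suc (suc zero)) = d
    adj : ∀ i → Adj b (g i)
    adj zero             = ba
    adj (suc zero)       = bc
    adj (suc (suc zero)) = bd
    g-inj : ∀ {i j} → g i ≡ g j → i ≡ j
    g-inj {zero}           {zero}           _  = ≡.refl
    g-inj {zero}           {suc zero}       eq = contradiction eq a≢c
    g-inj {zero}           {suc (suc zero)} eq = contradiction (≡.sym eq) d≢a
    g-inj {suc zero}       {zero}           eq = contradiction (≡.sym eq) a≢c
    g-inj {suc zero}       {suc zero}       _  = ≡.refl
    g-inj {suc zero}       {suc (suc zero)} eq = contradiction (≡.sym eq) d≢c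
    g-inj {suc (suc zero)} {zero}           eq = contradiction eq d≢a
    g-inj {suc (suc zero)} {suc zero}       eq = contradiction eq d≢c
    g-inj {suc (suc zero)} {suc (suc zero)} _  = ≡.refl

  other : ∀ {a b} → Adj a b → ∃ λ c → Adj b c × c ≢ a
  other {a} {b} ab with g , g-inj , adj ← at-least-two b with g zero ≟ a
  ... | no g₀≢a  = g zero , adj zero , g₀≢a
  ... | yes g₀≡a = g (suc zero) , adj (suc zero) ,
        λ g₁≡a → contradiction (g-inj {zero} {suc zero} (≡.trans g₀≡a (≡.sym g₁≡a))) λ ()

  -- The state of the walk is a directed edge, since the previous vertex must be known in order not
  -- to turn back.
  record Dart : Set where
    field
      {tail head} : Fin n
      edge        : Adj tail head

  open Dart

  dart : ℕ → Dart
  dart zero    = record { edge = proj₂ (proj₂ (at-least-two start)) zero }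
  dart (suc k) = record { edge = proj₁ (proj₂ (other (edge (dart k)))) }

  v : ℕ → Fin n
  v k = tail (dart k)

  v-Adj : ∀ k → Adj (v k) (v (suc k))
  v-Adj k = edge (dart k)

  v-forward : ∀ k → v (suc (suc k)) ≢ v k
  v-forward k = proj₂ (proj₂ (other (edge (dart k))))

  v-neighbours : ∀ k {d} → Adj (v (suc k)) d → d ≡ v k ⊎ d ≡ v (suc (suc k))
  v-neighbours k = only-two (Adj-sym (v-Adj k)) (v-Adj (suc k)) (v-forward k ∘ ≡.sym)

  Repeats : Fin (suc n) → Set
  Repeats j = ∃ λ i → i ℕ.< toℕ j × v i ≡ v (toℕ j)

  first-repeat : ∃ (IsLeast Repeats)
  first-repeat with i , j , i<j , eq ← Finₚ.pigeonhole {n} {suc n} ℕₚ.≤-refl (v ∘ toℕ) =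
    IsLeast-exists em Repeats (j , toℕ i , i<j , eq)

  N : ℕ
  N = toℕ (proj₁ first-repeat)

  N≤n : N ℕ.≤ n
  N≤n = ℕₚ.≤-pred (Finₚ.toℕ<n (proj₁ first-repeat))

  v-distinct : ∀ {i j} → i ℕ.< j → j ℕ.< N → v i ≢ v j
  v-distinct {i} {j} i<j j<N eq = ℕₚ.<⇒≱ j<N (≡.subst (N ℕ.≤_) (Finₚ.toℕ-fromℕ< j<1+n)
    (proj₂ (proj₂ first-repeat) (fromℕ< j<1+n)
      (i , ≡.subst (λ k → i ℕ.< k × v i ≡ v k) (≡.sym (Finₚ.toℕ-fromℕ< j<1+n)) (i<j , eq))))
    where
    j<1+n : j ℕ.< suc n
    j<1+n = ℕₚ.m≤n⇒m≤1+n (ℕₚ.<-≤-trans j<N N≤n)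

  v-injective : ∀ {i j} → i ℕ.< N → j ℕ.< N → v i ≡ v j → i ≡ j
  v-injective {i} {j} i<N j<N eq with ℕₚ.<-cmp i j
  ... | tri< i<j _ _ = contradiction eq (v-distinct i<j j<N)
  ... | tri≈ _ i≡j _ = i≡j
  ... | tri> _ _ j<i = contradiction (≡.sym eq) (v-distinct j<i i<N)

  N-cases : ∃ λ i → i ℕ.< N × v i ≡ v N
  N-cases = proj₁ (proj₂ first-repeat)

  N≢1 : N ≢ 1
  N≢1 N≡1 with N-cases
  ... | zero , _ , eq = Adj-irrefl (≡.subst (Adj (v 0)) (≡.sym (≡.trans eq (≡.cong v N≡1))) (v-Adj 0))
  ... | suc i , i<N , _ with ℕ.s≤s () ← ≡.subst (suc i ℕ.<_) N≡1 i<N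

  P : ℕ
  P = ℕ.pred N

  N≡1+P : N ≡ suc P
  N≡1+P = ≡.sym (ℕₚ.suc-pred N {{ℕ.>-nonZero (ℕₚ.≤-<-trans ℕ.z≤n (proj₁ (proj₂ N-cases)))}})

  P<N : P ℕ.< N
  P<N = ℕₚ.≤-reflexive (≡.sym N≡1+P)

  last-Adj : Adj (v N) (v P)
  last-Adj = ≡.subst (λ k → Adj (v k) (v P)) (≡.sym N≡1+P) (Adj-sym (v-Adj P))

  -- If v N = v (suc i), then v P is a neighbour of v (suc i), hence v i or v (i + 2). The first
  -- contradicts distinctness before N. The second means a turn back when i + 2 < N, and a loop when
  -- i + 2 = N.
  closes : v 0 ≡ v N
  closes with N-cases
  ... | zero  , _   , eq = eq
  ... | suc i , i<N , eq with v-neighbours i (≡.subst (λ u → Adj u (v P)) (≡.sym eq) last-Adj)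
  ...   | inj₁ vP≡vi = contradiction (v-injective P<N (ℕₚ.<-trans ℕₚ.≤-refl i<N) vP≡vi)
          λ { ≡.refl → ℕₚ.<⇒≢ i<N (≡.sym N≡1+P) }
  ...   | inj₂ vP≡ with suc (suc i) ℕₚ.<? N
  ...     | yes lt = contradiction
            (≡.trans (≡.cong v (≡.trans (≡.cong suc (≡.sym (v-injective P<N lt vP≡))) (≡.sym N≡1+P))) (≡.sym eq))
            (v-forward (suc i))
  ...     | no ≮ = contradiction
            (≡.subst (Adj (v N)) (≡.trans vP≡ (≡.cong v (ℕₚ.≤-antisym i<N (ℕₚ.≮⇒≥ ≮)))) last-Adj) Adj-irrefl

  N≢2 : N ≢ 2
  N≢2 N≡2 = v-forward 0 (≡.trans (≡.cong v (≡.sym N≡2)) (≡.sym closes))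

  0<N : 0 ℕ.< N
  0<N = ≡.subst (0 ℕ.<_) (≡.sym N≡1+P) (ℕ.s≤s ℕ.z≤n)

  3≤N : 3 ℕ.≤ N
  3≤N = ℕₚ.≤∧≢⇒< (ℕₚ.≤∧≢⇒< 0<N (N≢1 ∘ ≡.sym)) (N≢2 ∘ ≡.sym)

  neighbours : ∀ {i d} → i ℕ.< N → Adj (v i) d →
    d ≡ v (suc i) ⊎ (∃ λ k → suc k ≡ i × d ≡ v k) ⊎ (i ≡ 0 × d ≡ v P)
  neighbours {suc i} i<N adj with v-neighbours i adj
  ... | inj₁ d≡ = inj₂ (inj₁ (i , ≡.refl , d≡))
  ... | inj₂ d≡ = inj₁ d≡
  neighbours {zero} {d} i<N adj with only-two (v-Adj 0) (≡.subst (λ u → Adj u (v P)) (≡.sym closes) last-Adj) v₁≢vP adj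
    where
    v₁≢vP : v 1 ≢ v P
    v₁≢vP eq = N≢2 (≡.trans N≡1+P (≡.cong suc (≡.sym (v-injective (ℕₚ.<-trans ℕₚ.≤-refl 3≤N) P<N eq))))
  ... | inj₁ d≡ = inj₁ d≡
  ... | inj₂ d≡ = inj₂ (inj₂ (≡.refl , d≡))

  wrap : ∀ {i} → i ℕ.< N → (suc i ℕ.< N) ⊎ (suc i ≡ N × v (suc i) ≡ v 0)
  wrap {i} i<N with suc i ℕₚ.<? N
  ... | yes lt = inj₁ lt
  ... | no ≮   = let eq = ℕₚ.≤-antisym i<N (ℕₚ.≮⇒≥ ≮) in inj₂ (eq , ≡.trans (≡.cong v eq) (≡.sym closes))

  Visited : Fin n → Set
  Visited x = ∃ λ i → i ℕ.< N × v i ≡ x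

  visited-step : ∀ {x y} → Visited x → Adj x y → Visited y
  visited-step (i , i<N , ≡.refl) adj with neighbours i<N adj
  ... | inj₂ (inj₁ (k , ≡.refl , d≡)) = k , ℕₚ.<-trans ℕₚ.≤-refl i<N , ≡.sym d≡
  ... | inj₂ (inj₂ (_ , d≡))          = P , P<N , ≡.sym d≡
  ... | inj₁ d≡ with wrap i<N
  ...   | inj₁ lt       = suc i , lt , ≡.sym d≡
  ...   | inj₂ (_ , eq) = 0 , 0<N , ≡.trans (≡.sym eq) (≡.sym d≡)

  all-visited : ∀ x → Visited x
  all-visited x = let k , walk = connected (v 0) x in go k (0 , 0<N , ≡.refl) walk
    where
    go : ∀ k {y} → Visited y → Walk k y x → Visited x
    go zero    vis ≡.refl           = vis
    go (suc k) vis (z , adj , walk) = go k (visited-step vis adj) walk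

  index : Fin n → Fin N
  index x = fromℕ< (proj₁ (proj₂ (all-visited x)))

  v-index : ∀ x → v (toℕ (index x)) ≡ x
  v-index x = ≡.trans (≡.cong v (Finₚ.toℕ-fromℕ< (proj₁ (proj₂ (all-visited x))))) (proj₂ (proj₂ (all-visited x)))

  n≤N : n ℕ.≤ N
  n≤N = Finₚ.injective⇒≤ {f = index} λ {x} {y} eq →
    ≡.trans (≡.sym (v-index x)) (≡.trans (≡.cong (v ∘ toℕ) eq) (v-index y))

  N≡n : N ≡ n
  N≡n = ℕₚ.≤-antisym N≤n n≤N

  bound : (i : Fin n) → toℕ i ℕ.< N
  bound i = ℕₚ.<-≤-trans (Finₚ.toℕ<n i) n≤N

  ordinary-cycle : OrdinaryCycle
  ordinary-cycle = ≡.subst (3 ℕ.≤_) N≡n 3≤N , permutation (v ∘ toℕ) back back-right back-left ,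
    λ i j → mk⇔ (to i j) (from i j)
    where
    back : Fin n → Fin n
    back x = Fin.cast N≡n (index x)
    back-right : ∀ x → v (toℕ (back x)) ≡ x
    back-right x = ≡.trans (≡.cong v (Finₚ.toℕ-cast N≡n (index x))) (v-index x)
    back-left : ∀ i → back (v (toℕ i)) ≡ i
    back-left i = Finₚ.toℕ-injective (v-injective (bound (back (v (toℕ i)))) (bound i) (back-right (v (toℕ i))))
    to : ∀ i j → Adj (v (toℕ i)) (v (toℕ j)) → CyclicallyNext i j ⊎ CyclicallyNext j i
    to i j adj with neighbours (bound i) adj
    ... | inj₂ (inj₁ (k , 1+k≡i , eq)) = inj₂ (inj₁ (≡.trans (≡.sym 1+k≡i)
          (≡.cong suc (≡.sym (v-injective (bound j) (ℕₚ.<-trans (ℕₚ.≤-reflexive 1+k≡i) (bound i)) eq)))))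
    ... | inj₂ (inj₂ (i≡0 , eq)) = inj₂ (inj₂ (≡.trans (≡.cong suc (v-injective (bound j) P<N eq))
          (≡.trans (≡.sym N≡1+P) N≡n) , i≡0))
    ... | inj₁ eq with wrap (bound i)
    ...   | inj₁ lt = inj₁ (inj₁ (v-injective (bound j) lt eq))
    ...   | inj₂ (1+i≡N , eq′) = inj₁ (inj₂ (≡.trans 1+i≡N N≡n , v-injective (bound j) 0<N (≡.trans eq eq′)))
    next : ∀ i j → CyclicallyNext i j → Adj (v (toℕ i)) (v (toℕ j))
    next i j (inj₁ eq) = ≡.subst (λ k → Adj (v (toℕ i)) (v k)) (≡.sym eq) (v-Adj (toℕ i))
    next i j (inj₂ (1+i≡n , j≡0)) = ≡.subst (Adj (v (toℕ i)))
      (≡.trans (≡.cong v (≡.trans 1+i≡n (≡.sym N≡n))) (≡.trans (≡.sym closes) (≡.cong v (≡.sym j≡0)))) (v-Adj (toℕ i))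
    from : ∀ i j → CyclicallyNext i j ⊎ CyclicallyNext j i → Adj (v (toℕ i)) (v (toℕ j))
    from i j (inj₁ nxt) = next i j nxt
    from i j (inj₂ nxt) = Adj-sym (next j i nxt)

-- From the given scheme and modules to the abstract theory.

module TerwilligerTheory
  (em : ∀ {ℓ} → ExcludedMiddle ℓ) (ℝ : RealNumbers) {n D : ℕ}
  (𝔛 : SymmetricAssociationScheme n D) (metric : Scheme.Metric 𝔛) (1≤D : 1 ℕ.≤ D)
  (ℰ : Terwilliger.PrimitiveIdempotents ℝ 𝔛) (cometric : Terwilliger.Cometric ℝ 𝔛 ℰ)
  where

  open SymmetricAssociationScheme 𝔛
  open Scheme 𝔛 using (Adj)
  open MetricScheme 𝔛 metric
  open ComplexField ℝ
  module 𝕋 = Terwilliger ℝ 𝔛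
  open 𝕋 using (InBoseMesner)
  open 𝕋.PrimitiveIdempotents ℰ

  intersection : MatrixAlgebra.IntersectionRegular em ℂ-conjugationField n rel
  intersection i j {x} {y} {x′} {y′} eq = trans
    (sum-⟦⟧-* (λ w → rel x w ≟ i) (λ w → rel w y ≟ j))
    (trans (reflexive (≡.cong (_·ℕ 1#) (≡.trans (p-intersection i j x y)
        (≡.trans (≡.cong (p i j) eq) (≡.sym (p-intersection i j x′ y′))))))
      (sym (sum-⟦⟧-* (λ w → rel x′ w ≟ i) (λ w → rel w y′ ≟ j))))
    where open FieldTheory em ℂ-conjugationField

  diagonal-rel : ∀ x → rel x x ≡ zero
  diagonal-rel x = Equivalence.from (rel-diagonal x x) ≡.refl

  diagonal-rel⁻¹ : ∀ x y → rel x y ≡ zero → x ≡ y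
  diagonal-rel⁻¹ x y = Equivalence.to (rel-diagonal x y)

  module 𝔸 = RelationAlgebra em ℂ-conjugationField rel rel-symmetric rel-nonempty zero
    diagonal-rel diagonal-rel⁻¹ intersection

  Bose–Mesner⇒constant : ∀ {B} → InBoseMesner B → 𝔸.RelConstant B
  Bose–Mesner⇒constant (c , B≈) {x} {y} {x′} {y′} eq = 𝔸.trans (B≈ x y)
    (𝔸.trans (𝔸.ΣR.cong λ i → 𝔸.*-congˡ {c i} (𝔸.A-constant i eq)) (𝔸.sym (B≈ x′ y′)))

  constant⇒Bose–Mesner : ∀ {B} → 𝔸.RelConstant B → InBoseMesner B
  constant⇒Bose–Mesner {B} B-const = 𝔸.value B , 𝔸.expand B-const

  E-constant : ∀ j → 𝔸.RelConstant (E j)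
  E-constant j = Bose–Mesner⇒constant (proj₁ (proj₁ (E-primitive j)))

  E-idempotent : ∀ j → E j 𝔸.*ᵐ E j 𝔸.≈ᵐ E j
  E-idempotent j = proj₂ (proj₁ (E-primitive j))

  E-minimal : ∀ j → 𝔸.IsMinimal (E j)
  E-minimal j F G F-const FF≈F G-const GG≈G = proj₂ (proj₂ (E-primitive j)) F G
    (constant⇒Bose–Mesner F-const , FF≈F) (constant⇒Bose–Mesner G-const , GG≈G)

  E-orthogonal : ∀ {j k} → j ≢ k → E j 𝔸.*ᵐ E k 𝔸.≈ᵐ 𝔸.0ᵐ
  E-orthogonal {j} {k} j≢k = 𝔸.minimal-orthogonal {E j} {E k} (E-constant j) (E-constant k)
    (E-idempotent j) (E-idempotent k) (E-minimal j) (E-minimal k) (λ eq → j≢k (E-distinct j k eq))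

  one : Fin (suc D)
  one = fromℕ< (ℕ.s≤s 1≤D)

  toℕ-one : toℕ one ≡ 1
  toℕ-one = Finₚ.toℕ-fromℕ< (ℕ.s≤s 1≤D)

  basis : 𝔸.IsIdempotentBasis rel E
  basis = record
    { E-constant   = E-constant
    ; E-idempotent = E-idempotent
    ; E-orthogonal = E-orthogonal
    ; E-nonzero    = λ j → proj₁ (proj₂ (E-primitive j))
    }

  module 𝔹 = IdempotentBasis em ℂ-conjugationField rel rel-symmetric rel-nonempty zero
    diagonal-rel diagonal-rel⁻¹ intersection E basis
  module 𝔻 = 𝔹.CometricTheory one (cometric one toℕ-one)

  one⇒Adj : ∀ {x y} → rel x y ≡ one → Adj x y
  one⇒Adj eq = ≡.trans (≡.cong toℕ eq) toℕ-one

  Adj⇒one : ∀ {x y} → Adj x y → rel x y ≡ one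
  Adj⇒one adj = Finₚ.toℕ-injective (≡.trans adj (≡.sym toℕ-one))

  triangle-one : ∀ x {y z} → rel y z ≡ one → dist x z ℕ.≤ suc (dist x y)
  triangle-one x yz = triangle-Adj x (one⇒Adj yz)

  geodesic-one : ∀ x y {m} → dist x y ≡ suc m → ∃ λ z → rel x z ≡ one × dist z y ≡ m
  geodesic-one x y eq = let z , xz , zy = geodesic x y eq in z , Adj⇒one xz , zy

  module 𝕄 = 𝔻.MetricTheory one ≡.refl triangle-one geodesic-one

  open 𝔹
  open 𝕋 using (T; bose-mesner; dual; resp; add; scale; mult; TModule)

  adjacency∈T : ∀ {x} → T ℰ x (𝔹.A one)
  adjacency∈T = bose-mesner (constant⇒Bose–Mesner (A-constant one))

  -- A*_1 carries the factor n, which is invertible as the base point shows n to be nonzero.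
  dual∈T : ∀ {x} → T ℰ x (diag (E one x))
  dual∈T {x} = rescale (inverse (n ·ℕ 1#) (·ℕ-nonzero n {{Finₚ.nonZeroIndex x}}))
    where
    rescale : (∃ λ m → n ·ℕ 1# * m ≈ 1#) → T ℰ x (diag (E one x))
    rescale (m , n·m≈1) =
      resp (diag-rescale n (trans (*-comm m (n ·ℕ 1#)) n·m≈1) (E one x)) (scale m (dual one))

  invariant : ∀ {x} → TModule ℰ x → 𝕄.Invariant x
  invariant {x} W = record
    { Mem      = Mem
    ; subspace = record { resp-≈ = resp-≈ ; 0-closed = 0-closed ; +-closed = +-closed ; ∙-closed = ∙-closed }
    ; A-closed = λ v∈ → T-closed adjacency∈T v∈
    ; ι-closed = λ {v} v∈ → resp-≈ (diag-$ᵛ (E one x) v) (T-closed dual∈T v∈)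
    }
    where open TModule W

  -- The A_i are generated by A_1 and the A*_i by A*_1. This direction allows the hypothesis on
  -- irreducible T(x)-modules to be applied to an abstract invariant subspace.
  T-invariant : ∀ {x} (W : 𝕄.Invariant x) → ∀ {B} → T ℰ x B → ∀ {v} → 𝕄.Invariant.Mem W v → 𝕄.Invariant.Mem W (B $ᵛ v)
  T-invariant {x} W = go
    where
    open 𝕄.Invariant W
    go : ∀ {B} → T ℰ x B → ∀ {v} → Mem v → Mem (B $ᵛ v)
    go (bose-mesner B∈) v∈ = RelConstant-closed subspace (𝕄.A-generated subspace A-closed) (Bose–Mesner⇒constant B∈) v∈
    go (dual i) {v} v∈ = resp-≈ (λ y → sym (diag-multiple n (E i x) v y))
      (∙-closed (n ·ℕ 1#) (𝕄.dual-generated x subspace ι-closed i v∈))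
    go (resp {B} {C} B≈C B∈) {v} v∈ = resp-≈ ($ᵛ-congˡ {B} {C} v B≈C) (go B∈ v∈)
    go (add {B} {C} B∈ C∈) {v} v∈ = resp-≈ (λ y → sym ($ᵛ-+ˡ B C v y)) (+-closed (go B∈ v∈) (go C∈ v∈))
    go (scale c {B} B∈) {v} v∈ = resp-≈ (λ y → sym ($ᵛ-∙ˡ c B v y)) (∙-closed c (go B∈ v∈))
    go (mult {B} {C} B∈ C∈) {v} v∈ = resp-≈ (λ y → sym ($ᵛ-*ᵐ B C v y)) (go B∈ (go C∈ v∈))

  tmodule : ∀ {x} → 𝕄.Invariant x → TModule ℰ x
  tmodule W = record
    { Mem = Mem ; resp-≈ = resp-≈ ; 0-closed = 0-closed ; +-closed = +-closed ; ∙-closed = ∙-closed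
    ; T-closed = λ B∈ v∈ → T-invariant W B∈ v∈ }
    where open 𝕄.Invariant W

  irreducible : ∀ {x} (W : 𝕄.Invariant x) → 𝕄.Irreducible W → 𝕋.Irreducible ℰ (tmodule W)
  irreducible W (nonzero , simple) = nonzero , λ U U⊆W → simple (invariant U) U⊆W

  E-zero-constant : ∀ y z → E zero y z ≈ E zero y y
  E-zero-constant y z = ·ℕ-cancel n {{Finₚ.nonZeroIndex y}} (trans (E-zero y z) (sym (E-zero y y)))

  sphere-all-or-none : (Y : Subset n) (x y₀ : Fin n) (t : ℕ) → dist x y₀ ℕ.≤ t →
    𝕋.IsRelativeDesign ℰ t x (𝕋.E* (rel x y₀) x $ᵛ 𝕋.χ Y) →
    (∀ (W : TModule ℰ x) → 𝕋.Irreducible ℰ W → ∀ r r* → 𝕋.IsEndpoint ℰ W r → 𝕋.IsDualEndpoint ℰ W r* →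
      1 ℕ.≤ toℕ r → toℕ r ℕ.≤ dist x y₀ → toℕ r* ℕ.≤ toℕ r) →
    ∀ {y z} → rel x y ≡ rel x y₀ → rel x z ≡ rel x y₀ → y ∈ Y → z ∈ Y
  sphere-all-or-none Y x y₀ t δ≤t design endpoints {y} {z} xy xz y∈Y =
    decidable-stable (z ∈? Y) λ z∉Y → 1≉0 (trans (sym (⟦⟧-yes (y ∈? Y) y∈Y))
      (trans (sphere-constant xy xz) (⟦⟧-no (z ∈? Y) z∉Y)))
    where
    open 𝕄.SphereDesign x y₀ (𝕋.χ Y) E-zero-constant
      (λ j 1≤j j≤δ → design j 1≤j (ℕₚ.≤-trans j≤δ δ≤t))
      (λ W irr → endpoints (tmodule W) (irreducible W irr))

  module _ (3≤D : 3 ℕ.≤ D)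
    (antipodal-transitive : ∀ {x y z} → dist x y ≡ D → dist x z ≡ D → y ≡ z ⊎ dist y z ≡ D) where

    open SchemeTheory 𝔛 metric using (At-transfer; exists-at; triangle-Adj′)

    -- At distance D, `w` would be a second antipode of `y`, so transitivity would make the adjacent
    -- points `x` and `w` equal or at distance D.
    antipode-neighbour : ∀ {x y w} → dist x y ≡ D → Adj x w → dist w y ≡ ℕ.pred D
    antipode-neighbour {x} {y} {w} xy xw = ℕₚ.≤-antisym
      (ℕₚ.<⇒≤pred (ℕₚ.≤∧≢⇒< (dist≤D w y) not-antipodal))
      (ℕₚ.pred-mono-≤ (≡.subst (ℕ._≤ suc (dist w y)) xy (triangle-Adj′ xw)))
      where
      not-antipodal : dist w y ≢ D
      not-antipodal wy = ℕₚ.<⇒≢ (ℕₚ.≤-trans (ℕ.s≤s (ℕ.s≤s ℕ.z≤n)) 3≤D) (≡.sym (D≡1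
        (antipodal-transitive (≡.trans (dist-sym y x) xy) (≡.trans (dist-sym y w) wy))))
        where
        D≡1 : x ≡ w ⊎ dist x w ≡ D → D ≡ 1
        D≡1 (inj₁ ≡.refl) with () ← ≡.trans (≡.sym (dist-refl x)) xw
        D≡1 (inj₂ xw′)    = ≡.trans (≡.sym xw′) xw

    -- `AntipodalClasses` needs a centre with two distinct neighbours: the midpoint b of a geodesic
    -- from `x` to a point at distance two. Two antipodes of `x` give two of b, so b has 2 + m
    -- antipodes for some m, the form in which the valency is required.
    antipode-unique : ∀ {x y z} → dist x y ≡ D → dist x z ≡ D → y ≡ z
    antipode-unique {x} {y} {z} xy xz = decidable-stable (y ≟ z) λ y≢z → centred
      (exists-at x {2} (ℕₚ.≤-trans (ℕₚ.n≤1+n 2) 3≤D)) y≢z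
      where
      top : Fin (suc D)
      top = fromℕ D
      toℕ-top : toℕ top ≡ D
      toℕ-top = Finₚ.toℕ-fromℕ D
      top-dist : ∀ {u v} → rel u v ≡ top → dist u v ≡ D
      top-dist eq = ≡.trans (≡.cong toℕ eq) toℕ-top
      top-rel : ∀ {u v} → dist u v ≡ D → rel u v ≡ top
      top-rel eq = Finₚ.toℕ-injective (≡.trans eq (≡.sym toℕ-top))
      pred<1+D : ℕ.pred D ℕ.< suc D
      pred<1+D = ℕ.s≤s ℕₚ.pred[n]≤n
      far two : Fin (suc D)
      far = fromℕ< pred<1+D
      two = fromℕ< (ℕ.s≤s (ℕₚ.≤-trans (ℕₚ.n≤1+n 2) 3≤D))
      zero≢one : zero ≢ one
      zero≢one eq with () ← ≡.trans (≡.cong toℕ eq) toℕ-one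
      zero≢top : zero ≢ top
      zero≢top eq = ℕₚ.<⇒≢ 1≤D (≡.trans (≡.cong toℕ eq) toℕ-top)
      one≢far : one ≢ far
      one≢far eq = ℕₚ.<⇒≢ (ℕₚ.pred-mono-≤ 3≤D)
        (≡.trans (≡.sym toℕ-one) (≡.trans (≡.cong toℕ eq) (Finₚ.toℕ-fromℕ< pred<1+D)))
      transitive : ∀ {x y z} → rel x y ≡ top → rel x z ≡ top → y ≡ z ⊎ rel y z ≡ top
      transitive xy xz with antipodal-transitive (top-dist xy) (top-dist xz)
      ... | inj₁ eq = inj₁ eq
      ... | inj₂ yz = inj₂ (top-rel yz)
      opposite : ∀ {x y w} → rel x y ≡ top → rel x w ≡ one → rel w y ≡ far
      opposite xy xw = Finₚ.toℕ-injective
        (≡.trans (antipode-neighbour (top-dist xy) (one⇒Adj xw)) (≡.sym (Finₚ.toℕ-fromℕ< pred<1+D)))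
      refute : ∀ {b c} → Adj b x → Adj b c → x ≢ c → ∀ {y} → rel b y ≡ top →
        ∀ k → count (λ z → rel b z ≟ top) ≡ k → 2 ℕ.≤ k → ⊥
      refute {b} bx bc x≢c by (suc (suc m)) size (ℕ.s≤s (ℕ.s≤s _)) = 𝔻.AntipodalClasses.impossible
        top far one two (Finₚ.toℕ-fromℕ< (ℕ.s≤s (ℕₚ.≤-trans (ℕₚ.n≤1+n 2) 3≤D)))
        zero≢one zero≢top one≢far transitive opposite by (Adj⇒one bx) (Adj⇒one bc) x≢c m
        (trans (sum-⟦⟧ (λ z → rel b z ≟ top)) (reflexive (≡.cong (_·ℕ 1#) size)))
      centred : (∃ λ c → dist x c ≡ 2) → y ≢ z → ⊥
      centred (c , xc) y≢z =
        let b , xb , bc = geodesic x c xc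
            g , g-inj , at = At-transfer {x} {x} {b} {b} (≡.trans (dist-refl x) (≡.sym (dist-refl b))) {D} {D} {1}
              (pair y≢z (xy , ≡.trans (dist-sym y x) xy) (xz , ≡.trans (dist-sym z x) xz))
        in refute {b} {c} (Adj-sym xb) bc (λ { ≡.refl → 0≢2 (≡.trans (≡.sym (dist-refl x)) xc) })
             (top-rel (proj₁ (at zero))) _ ≡.refl
             (distinct-count (λ w → rel b w ≟ top) (g , g-inj , λ i → top-rel (proj₁ (at i))))
        where
        0≢2 : 0 ≢ 2
        0≢2 ()

-- The theorem, by cases on δ.

open import Data.Nat.Base using (_+_; _≤_; _<_)

theorem6p8 : (∀ {ℓ} → ExcludedMiddle ℓ) →
    (ℝ : RealNumbers) {n D : ℕ} (𝔛 : SymmetricAssociationScheme n D) →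
    let open Scheme 𝔛
        open Terwilliger ℝ 𝔛 hiding (_+_) in
    (ℰ : PrimitiveIdempotents) →
    3 ≤ D →
    Metric →
    Cometric ℰ →
    ¬ OrdinaryCycle →
    (Y : Subset n) → 1 < ∣ Y ∣ → ∣ Y ∣ < n →
    (δ : Fin (suc D)) → IsMinDistance Y δ →
    (t : ℕ) → t ≤ D →
    (∀ (k : Fin (suc D)) (x : Fin n) → x ∈ Y →
       IsRelativeDesign ℰ t x (E* k x $ᵛ χ Y)) →
    (∀ (x : Fin n) → x ∈ Y → (W : TModule ℰ x) → Irreducible ℰ W →
       (r r* : Fin (suc D)) → IsEndpoint ℰ W r → IsDualEndpoint ℰ W r* →
       1 ≤ toℕ r → toℕ r ≤ toℕ δ → toℕ r* ≤ toℕ r) →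
    (Bipartite × IsBipartiteHalf Y)
      ⊎ (AntipodalDoubleCover × IsAntipodalPair Y)
      ⊎ (t + 1 ≤ toℕ δ)
theorem6p8 em ℝ {n} {D} 𝔛 ℰ 3≤D metric cometric not-cycle Y _ ∣Y∣<n
  δ ((δ≢0 , δ-occurs) , δ-least) t _ designs endpoints =
  conclude (t + 1 ℕₚ.≤? toℕ δ) (𝔸.distance-occurs (_∈? Y) δ δ-occurs)
  where
  open SymmetricAssociationScheme 𝔛
  open Scheme 𝔛
  open MetricScheme 𝔛 metric
  open SchemeTheory 𝔛 metric
  1≤D : 1 ≤ D
  1≤D = ℕₚ.≤-trans (ℕ.s≤s ℕ.z≤n) 3≤D
  open TerwilligerTheory em ℝ 𝔛 metric 1≤D ℰ cometric using (module 𝔸; sphere-all-or-none; antipode-unique)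

  Conclusion : Set
  Conclusion = (Bipartite × IsBipartiteHalf Y) ⊎ (AntipodalDoubleCover × IsAntipodalPair Y) ⊎ (t + 1 ≤ toℕ δ)

  separated : ∀ {x y} → x ∈ Y → y ∈ Y → x ≢ y → toℕ δ ≤ dist x y
  separated {x} {y} x∈Y y∈Y x≢y = δ-least (rel x y)
    ((λ eq → x≢y (dist-zero (≡.cong toℕ eq))) , 𝔸.occurring-distance (_∈? Y) (rel x y) x∈Y y∈Y ≡.refl)

  proper : ¬ (∀ z → z ∈ Y)
  proper full = ℕₚ.<⇒≢ ∣Y∣<n (≡.trans (≡.cong ∣_∣ Y≡⊤) (Subsetₚ.∣⊤∣≡n n))
    where
    Y≡⊤ : Y ≡ ⊤
    Y≡⊤ = Subsetₚ.⊆-antisym (λ _ → Subsetₚ.∈⊤) (λ _ → full _)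

  conclude : Dec (t + 1 ≤ toℕ δ) → (∃₂ λ x y → x ∈ Y × y ∈ Y × rel x y ≡ δ) →
    Conclusion
  conclude (yes t<δ) _ = inj₂ (inj₂ t<δ)
  conclude (no t≮δ) (x₀ , y₀ , x₀∈Y , y₀∈Y , x₀y₀) = by-distance (toℕ δ) ≡.refl
    where
    δ≤t : toℕ δ ≤ t
    δ≤t = ℕₚ.≤-pred (≡.subst (toℕ δ <_) (ℕₚ.+-comm t 1) (ℕₚ.≰⇒> t≮δ))

    sphere-closed : ∀ {x y z} → x ∈ Y → y ∈ Y → dist x y ≡ toℕ δ → dist x z ≡ toℕ δ → z ∈ Y
    sphere-closed {x} {y} {z} x∈Y y∈Y xy xz = sphere-all-or-none Y x y t (≡.subst (_≤ t) (≡.sym xy) δ≤t)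
      (designs (rel x y) x x∈Y)
      (λ W irr r r* end end* 1≤r r≤δ → endpoints x x∈Y W irr r r* end end* 1≤r (≡.subst (toℕ r ≤_) xy r≤δ))
      ≡.refl (rel-dist (≡.trans xz (≡.sym xy))) y∈Y

    1≤δ : 1 ≤ toℕ δ
    1≤δ = ℕₚ.n≢0⇒n>0 λ eq → δ≢0 (Finₚ.toℕ-injective eq)

    open CodeTheory Y (toℕ δ) 1≤δ separated sphere-closed x₀∈Y y₀∈Y (≡.cong toℕ x₀y₀)

    large : 3 ≤ toℕ δ → Conclusion
    large 3≤δ with ℕₚ.<-cmp (toℕ δ) D
    ... | tri< δ<D _ _ = contradiction
      (TwoRegularGraph.ordinary-cycle em Adj (λ x y → dist x y ℕₚ.≟ 1) Adj-sym ¬Adj-refl (proj₁ (proj₁ metric))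
        at-least-two at-most-two x₀) not-cycle
      where open DistanceBetween 3≤δ δ<D
    ... | tri≈ _ δ≡D _ = inj₂ (inj₁ (double-cover unique , antipodal-pair unique))
      where
      open DistanceMaximal δ≡D
      unique : ∀ {x y z} → dist x y ≡ D → dist x z ≡ D → y ≡ z
      unique = antipode-unique 3≤D antipodal-transitive
    ... | tri> _ _ D<δ = contradiction δ≤D (ℕₚ.<⇒≱ D<δ)

    by-distance : ∀ k → toℕ δ ≡ k → Conclusion
    by-distance 0 eq = contradiction (Finₚ.toℕ-injective eq) δ≢0
    by-distance 1 eq = contradiction (connected-full eq) proper
    by-distance 2 eq = inj₁ ((Y , bipartition) , (Y , bipartition , inj₁ ≡.refl))
      where open DistanceTwo eq 3≤D
    by-distance (suc (suc (suc k))) eq = large (≡.subst (3 ≤_) (≡.sym eq) (ℕ.s≤s (ℕ.s≤s (ℕ.s≤s ℕ.z≤n))))
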